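{- Let $d\ge1$ be a fixed integer and $c_d>0$ a constant. The following are equivalent. (a) There is a constant $C<\infty$ such that for infinitely many $n$ there is an $\mathbb{F}_2$-linear code of blocklength $n$, distance $d$ and rate $k=n-c_d\log_2 n$ having an $\varepsilon$-smooth local tester of soundness $\delta>0$ with $\varepsilon/\delta\le C$ (where $\varepsilon,\delta$ may depend on $n$). (b) There is a constant $C'<\infty$ such that for infinitely many $h$ there is a Cayley graph $\mathcal{G}=\mathrm{Cay}(\mathbb{F}_2^h,S)$ with $|S|=2^{h/c_d}$ such that $S$ is $d$-wise linearly independent and the shortest-path metric on $\mathcal{G}$ embeds into $\ell_1$ with distortion at most $C'$.
   Context: A code of blocklength $n$ is a linear subspace $\mathcal{C}\subseteq\mathbb{F}_2^n$; its rate is $k=\dim\mathcal{C}$; it has distance $d$ if every nonzero codeword has Hamming weight at least $d$. For $r\in\mathbb{F}_2^n$, $d(r,\mathcal{C})$ is the minimum Hamming distance from $r$ to a codeword. $\mathcal{C}^\perp=\{\alpha\in\mathbb{F}_2^n:\alpha\cdot c=0\ \forall c\in\mathcal{C}\}$. A local tester for $\mathcal{C}$ is a probability distribution $\mathcal{D}$ on $\mathcal{C}^\perp$. It is $\varepsilon$-smooth if $\Pr_{\alpha\leftarrow\mathcal{D}}[\alpha_i=1]\le\varepsilon$ for every $i\in[n]$, and has soundness $\delta$ if $\Pr_{\alpha\leftarrow\mathcal{D}}[\alpha\cdot r=1]\ge\delta\cdot d(r,\mathcal{C})$ for every $r\in\mathbb{F}_2^n$. For a multiset (indexed family) $S$ of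 vectors spanning $\mathbb{F}_2^h$, $\mathrm{Cay}(\mathbb{F}_2^h,S)$ is the (multi)graph with vertex set $\mathbb{F}_2^h$ and edges $(x,x+s)$ for $x\in\mathbb{F}_2^h$, $s\in S$. $S$ is $d$-wise linearly independent if every subfamily of fewer than $d$ of its members is linearly independent over $\mathbb{F}_2$. A metric space $(X,d_1)$ embeds into $\ell_1$ with distortion at most $c$ if there are $m$, a map $f:X\to\mathbb{R}^m$ and $\alpha>0$ with $\alpha\, d_1(x,y)\le\|f(x)-f(y)\|_1\le c\,\alpha\, d_1(x,y)$ for all $x,y\in X$. -}

module Defs where

open import Data.Bool.Base using (Bool; true; false; _xor_; _∧_; if_then_else_)
import Data.Bool.Properties as Bool
open import Data.Fin.Base using (Fin)
open import Data.Integer.Base as ℤ using (+_; _⊖_)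
import Data.Integer.Properties as ℤ
open import Data.List.Base as List using (List; []; _∷_)
open import Data.Nat.Base as ℕ using (ℕ; zero; suc)
import Data.Nat.Properties as ℕ
open import Data.Nat.Logarithm
  using (⌊log₂_⌋; ⌊log₂⌋-mono-≤; ⌊log₂[2^n]⌋≡n; ⌊log₂⌊n/2⌋⌋≡⌊log₂n⌋∸1)
import Data.Nat.Solver as ℕSolver
open import Data.Product.Base using (Σ-syntax; ∃-syntax; _×_; _,_)
open import Data.Rational.Base as ℚ using (ℚ; mkℚ; 0ℚ; 1ℚ; ½; fromℚᵘ)
import Data.Rational.Properties as ℚ
import Data.Rational.Solver as ℚSolver
import Data.Rational.Unnormalised.Base as ℚᵘ
import Data.Rational.Unnormalised.Properties as ℚᵘ
open import Data.Sum.Base using (inj₁; inj₂)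
open import Data.Unit.Base using (⊤)
open import Data.Vec.Base as Vec using (Vec; lookup; replicate; zipWith; count)
import Data.Vec.Functional as Vector
open import Function.Base using (_∘_)
open import Function.Definitions using (Injective)
open import Level using (Level; 0ℓ)
open import Relation.Binary.PropositionalEquality
  using (_≡_; _≢_; refl; sym; trans; cong; cong₂; subst; subst₂)
open import Relation.Unary using (Pred; _∈_; _∉_)

module ℚ-Lemmas where

  open ℚSolver.+-*-Solver public

  half-pos : ∀ {ε} → 0ℚ ℚ.< ε → 0ℚ ℚ.< ε ℚ.* ½
  half-pos {ε} ε>0 =
    subst (ℚ._< ε ℚ.* ½) (ℚ.*-zeroˡ ½) (ℚ.*-monoˡ-<-pos ½ ε>0)

  halves : ∀ ε → ε ℚ.* ½ ℚ.+ ε ℚ.* ½ ≡ ε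
  halves ε = trans (sym (ℚ.*-distribˡ-+ ε ½ ½)) (ℚ.*-identityʳ ε)

  *-pos : ∀ {p q} → 0ℚ ℚ.< p → 0ℚ ℚ.< q → 0ℚ ℚ.< p ℚ.* q
  *-pos {p} {q} p>0 q>0 = subst (ℚ._< p ℚ.* q) (ℚ.*-zeroˡ q)
    (ℚ.*-monoˡ-<-pos q {{ℚ.positive q>0}} p>0)

  *-mono-≤ : ∀ {p q r s} → 0ℚ ℚ.≤ p → 0ℚ ℚ.≤ s → p ℚ.≤ q → r ℚ.≤ s →
             p ℚ.* r ℚ.≤ q ℚ.* s
  *-mono-≤ {p} {q} {r} {s} p≥0 s≥0 p≤q r≤s = ℚ.≤-trans
    (ℚ.*-monoˡ-≤-nonNeg p {{ℚ.nonNegative p≥0}} r≤s)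
    (ℚ.*-monoʳ-≤-nonNeg s {{ℚ.nonNegative s≥0}} p≤q)

  ∣p-q∣≡∣q-p∣ : ∀ p q → ℚ.∣ p ℚ.- q ∣ ≡ ℚ.∣ q ℚ.- p ∣
  ∣p-q∣≡∣q-p∣ p q = trans (sym (ℚ.∣-p∣≡∣p∣ (p ℚ.- q)))
    (cong ℚ.∣_∣ (solve 2 (λ p q → :- (p :- q) := q :- p) refl p q))

  p≤∣p∣ : ∀ p → p ℚ.≤ ℚ.∣ p ∣
  p≤∣p∣ p with ℚ.≤-total 0ℚ p
  ... | inj₁ 0≤p = ℚ.≤-reflexive (sym (ℚ.0≤p⇒∣p∣≡p 0≤p))
  ... | inj₂ p≤0 = ℚ.≤-trans p≤0 (ℚ.0≤∣p∣ p)

  ∣p∣≤∣q∣+∣p-q∣ : ∀ p q → ℚ.∣ p ∣ ℚ.≤ ℚ.∣ q ∣ ℚ.+ ℚ.∣ p ℚ.- q ∣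
  ∣p∣≤∣q∣+∣p-q∣ p q = subst (λ t → ℚ.∣ t ∣ ℚ.≤ ℚ.∣ q ∣ ℚ.+ ℚ.∣ p ℚ.- q ∣)
    (solve 2 (λ p q → q :+ (p :- q) := p) refl p q)
    (ℚ.∣p+q∣≤∣p∣+∣q∣ q (p ℚ.- q))

  ∣p-q∣<r : ∀ {p q r} → p ℚ.< q ℚ.+ r → q ℚ.< p ℚ.+ r → ℚ.∣ p ℚ.- q ∣ ℚ.< r
  ∣p-q∣<r {p} {q} {r} p<q+r q<p+r with ℚ.∣p∣≡p∨∣p∣≡-p (p ℚ.- q)
  ... | inj₁ eq = subst₂ ℚ._<_ (sym eq)
    (solve 2 (λ q r → (q :+ r) :- q := r) refl q r)
    (ℚ.+-monoˡ-< (ℚ.- q) p<q+r)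
  ... | inj₂ eq = subst₂ ℚ._<_
    (trans (solve 2 (λ p q → q :- p := :- (p :- q)) refl p q) (sym eq))
    (solve 2 (λ p r → (p :+ r) :- p := r) refl p r)
    (ℚ.+-monoˡ-< (ℚ.- p) q<p+r)

  +-difference : ∀ a b c d → (a ℚ.- b) ℚ.+ (c ℚ.- d) ≡ (a ℚ.+ c) ℚ.- (b ℚ.+ d)
  +-difference = solve 4 (λ a b c d → (a :- b) :+ (c :- d) := (a :+ c) :- (b :+ d)) refl

  *-difference : ∀ a b c d → a ℚ.* (c ℚ.- d) ℚ.+ d ℚ.* (a ℚ.- b) ≡ a ℚ.* c ℚ.- b ℚ.* d
  *-difference =
    solve 4 (λ a b c d → a :* (c :- d) :+ d :* (a :- b) := a :* c :- b :* d) refl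

  cross-difference : ∀ i j a b →
    (i ℚ.- j) ℚ.* (a ℚ.* b) ≡ (i ℚ.* a) ℚ.* b ℚ.- (j ℚ.* b) ℚ.* a
  cross-difference =
    solve 4 (λ i j a b → (i :- j) :* (a :* b) := (i :* a) :* b :- (j :* b) :* a) refl

  scale : ∀ {ε B} → 0ℚ ℚ.< ε → 0ℚ ℚ.< B →
          Σ[ η ∈ ℚ ] 0ℚ ℚ.< η × B ℚ.* η ≡ ε
  scale {ε} {B} ε>0 B>0 = 1/B ℚ.* ε , *-pos 1/B>0 ε>0 ,
    trans (sym (ℚ.*-assoc B 1/B ε))
      (trans (cong (ℚ._* ε) (ℚ.*-inverseʳ B {{ℚ.>-nonZero B>0}})) (ℚ.*-identityˡ ε))
    where
    1/B : ℚ
    1/B = ℚ.1/_ B {{ℚ.>-nonZero B>0}}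
    1/B>0 : 0ℚ ℚ.< 1/B
    1/B>0 = ℚ.positive⁻¹ 1/B {{ℚ.1/pos⇒pos B {{ℚ.positive B>0}}}}

  product-bound : ∀ p q {B η ε} → 0ℚ ℚ.< B → B ℚ.* η ≡ ε →
                  ℚ.∣ p ∣ ℚ.≤ B → ℚ.∣ q ∣ ℚ.< η → ℚ.∣ p ℚ.* q ∣ ℚ.< ε
  product-bound p q {B} B>0 eq p≤ q< =
    subst₂ ℚ._<_ (sym (ℚ.∣p*q∣≡∣p∣*∣q∣ p q)) eq (ℚ.≤-<-trans
      (ℚ.*-monoʳ-≤-nonNeg ℚ.∣ q ∣ {{ℚ.∣-∣-nonNeg q}} p≤)
      (ℚ.*-monoʳ-<-pos B {{ℚ.positive B>0}} q<))

  product-close : ∀ a b c d {ε} →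
    ℚ.∣ a ℚ.* (c ℚ.- d) ∣ ℚ.< ε ℚ.* ½ → ℚ.∣ d ℚ.* (a ℚ.- b) ∣ ℚ.< ε ℚ.* ½ →
    ℚ.∣ a ℚ.* c ℚ.- b ℚ.* d ∣ ℚ.< ε
  product-close a b c d {ε} l r = subst (λ t → ℚ.∣ t ∣ ℚ.< ε) (*-difference a b c d)
    (ℚ.≤-<-trans (ℚ.∣p+q∣≤∣p∣+∣q∣ (a ℚ.* (c ℚ.- d)) (d ℚ.* (a ℚ.- b)))
      (subst (_ ℚ.<_) (halves ε) (ℚ.+-mono-< l r)))

  ∣p∣+1>0 : ∀ p → 0ℚ ℚ.< ℚ.∣ p ∣ ℚ.+ 1ℚ
  ∣p∣+1>0 p = ℚ.<-≤-trans (ℚ.positive⁻¹ 1ℚ)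
    (subst (ℚ._≤ ℚ.∣ p ∣ ℚ.+ 1ℚ) (ℚ.+-identityˡ 1ℚ) (ℚ.+-monoˡ-≤ 1ℚ (ℚ.0≤∣p∣ p)))

  archimedean : ∀ ε → 0ℚ ℚ.< ε → ∃[ N ] fromℚᵘ (ℚᵘ.mkℚᵘ (+ 1) N) ℚ.< ε
  archimedean (mkℚ ℤ.+0 d-1 c) (ℚ.*<* (ℤ.+<+ ()))
  archimedean (mkℚ (ℤ.-[1+ n ]) d-1 c) (ℚ.*<* ())
  archimedean (mkℚ ℤ.+[1+ n ] d-1 c) _ = suc d-1 ,
    ℚ.toℚᵘ-cancel-< (ℚᵘ.<-respˡ-≃ (ℚᵘ.≃-sym (ℚ.toℚᵘ-fromℚᵘ (ℚᵘ.mkℚᵘ (+ 1) (suc d-1))))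
      (ℚᵘ.*<* (subst₂ ℤ._<_ (ℤ.pos-* 1 (suc d-1)) (ℤ.pos-* (suc n) (suc (suc d-1)))
        (ℤ.+<+ (ℕ.<-≤-trans (ℕ.≤-reflexive (cong suc (ℕ.*-identityˡ (suc d-1))))
          (ℕ.m≤n*m (suc (suc d-1)) (suc n)))))))

Eventually : (ℕ → Set) → Set
Eventually P = ∃[ N ] (∀ n → N ℕ.≤ n → P n)

IsCauchy : (ℕ → ℚ) → Set
IsCauchy s = ∀ ε → 0ℚ ℚ.< ε →
  ∃[ N ] (∀ m n → N ℕ.≤ m → N ℕ.≤ n → ℚ.∣ s m ℚ.- s n ∣ ℚ.< ε)

record ℝ : Set where
  constructor mkℝ
  field
    seq    : ℕ → ℚ
    cauchy : IsCauchy seq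

open ℝ public

infix 4 _≃_ _≤_ _<_

_≃_ : ℝ → ℝ → Set
x ≃ y = ∀ ε → 0ℚ ℚ.< ε → Eventually λ n → ℚ.∣ seq x n ℚ.- seq y n ∣ ℚ.< ε

_≤_ : ℝ → ℝ → Set
x ≤ y = ∀ ε → 0ℚ ℚ.< ε → Eventually λ n → seq x n ℚ.< seq y n ℚ.+ ε

_<_ : ℝ → ℝ → Set
x < y = Σ[ ε ∈ ℚ ] 0ℚ ℚ.< ε × Eventually λ n → seq x n ℚ.+ ε ℚ.< seq y n

abstract
  const-cauchy : ∀ p → IsCauchy (λ _ → p)
  const-cauchy p ε ε>0 = 0 , λ _ _ _ _ →
    subst (λ t → ℚ.∣ t ∣ ℚ.< ε) (sym (ℚ.+-inverseʳ p)) ε>0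

fromℚ : ℚ → ℝ
fromℚ p = mkℝ (λ _ → p) (const-cauchy p)

fromℕ : ℕ → ℝ
fromℕ n = fromℚ (+ n ℚ./ 1)

0ℝ 1ℝ : ℝ
0ℝ = fromℚ 0ℚ
1ℝ = fromℚ 1ℚ

infixl 6 _+_ _-_
infixl 7 _*_
infix  8 -_

abstract
  +-cauchy : ∀ x y → IsCauchy (λ n → seq x n ℚ.+ seq y n)
  +-cauchy x y ε ε>0 =
    let
      M , p = cauchy x (ε ℚ.* ½) (half-pos ε>0)
      N , q = cauchy y (ε ℚ.* ½) (half-pos ε>0)
    in M ℕ.⊔ N , λ m n m≥ n≥ →
    subst₂ ℚ._<_ refl (halves ε) (ℚ.≤-<-trans
      (subst (λ t → ℚ.∣ t ∣ ℚ.≤ ℚ.∣ seq x m ℚ.- seq x n ∣ ℚ.+ ℚ.∣ seq y m ℚ.- seq y n ∣)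
        (+-difference (seq x m) (seq x n) (seq y m) (seq y n))
        (ℚ.∣p+q∣≤∣p∣+∣q∣ (seq x m ℚ.- seq x n) (seq y m ℚ.- seq y n)))
      (ℚ.+-mono-< (p m n (ℕ.m⊔n≤o⇒m≤o M N m≥) (ℕ.m⊔n≤o⇒m≤o M N n≥))
                  (q m n (ℕ.m⊔n≤o⇒n≤o M N m≥) (ℕ.m⊔n≤o⇒n≤o M N n≥))))
    where open ℚ-Lemmas

_+_ : ℝ → ℝ → ℝ
x + y = mkℝ (λ n → seq x n ℚ.+ seq y n) (+-cauchy x y)

abstract
  -‿cauchy : ∀ x → IsCauchy (λ n → ℚ.- seq x n)
  -‿cauchy x ε ε>0 with cauchy x ε ε>0
  ... | N , p = N , λ m n m≥ n≥ → subst (λ t → ℚ.∣ t ∣ ℚ.< ε)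
    (solve 2 (λ a b → b :- a := :- a :- :- b) refl (seq x m) (seq x n)) (p n m n≥ m≥)
    where open ℚ-Lemmas

-_ : ℝ → ℝ
- x = mkℝ (λ n → ℚ.- seq x n) (-‿cauchy x)

_-_ : ℝ → ℝ → ℝ
x - y = x + (- y)

abstract
  ∣-∣-cauchy : ∀ x → IsCauchy (λ n → ℚ.∣ seq x n ∣)
  ∣-∣-cauchy x ε ε>0 with cauchy x ε ε>0
  ... | N , p = N , λ m n m≥ n≥ → ∣p-q∣<r (bound m n m≥ n≥) (bound n m n≥ m≥)
    where
    open ℚ-Lemmas
    bound : ∀ m n → N ℕ.≤ m → N ℕ.≤ n → ℚ.∣ seq x m ∣ ℚ.< ℚ.∣ seq x n ∣ ℚ.+ ε
    bound m n m≥ n≥ = ℚ.≤-<-trans (∣p∣≤∣q∣+∣p-q∣ (seq x m) (seq x n))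
      (ℚ.+-monoʳ-< ℚ.∣ seq x n ∣ (p m n m≥ n≥))

∣_∣ : ℝ → ℝ
∣ x ∣ = mkℝ (λ n → ℚ.∣ seq x n ∣) (∣-∣-cauchy x)

eventually-bounded : (x : ℝ) →
  ∃[ N ] Σ[ B ∈ ℚ ] 0ℚ ℚ.< B × (∀ n → N ℕ.≤ n → ℚ.∣ seq x n ∣ ℚ.≤ B)
eventually-bounded x with cauchy x 1ℚ (ℚ.positive⁻¹ 1ℚ)
... | N , p = N , ℚ.∣ seq x N ∣ ℚ.+ 1ℚ , ∣p∣+1>0 (seq x N) ,
  λ n n≥ → ℚ.≤-trans (∣p∣≤∣q∣+∣p-q∣ (seq x n) (seq x N))
    (ℚ.+-monoʳ-≤ ℚ.∣ seq x N ∣ (ℚ.<⇒≤ (p n N n≥ ℕ.≤-refl)))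
  where open ℚ-Lemmas

abstract
  *-cauchy : ∀ x y → IsCauchy (λ n → seq x n ℚ.* seq y n)
  *-cauchy x y ε ε>0 =
    let
      Nx , Bx , Bx>0 , x≤ = eventually-bounded x
      Ny , By , By>0 , y≤ = eventually-bounded y
      ηy , ηy>0 , eqy = scale (half-pos ε>0) Bx>0
      ηx , ηx>0 , eqx = scale (half-pos ε>0) By>0
      My , py = cauchy y ηy ηy>0
      Mx , px = cauchy x ηx ηx>0
    in (Nx ℕ.⊔ Ny) ℕ.⊔ (My ℕ.⊔ Mx) , λ m n m≥ n≥ →
    let
      m≥₁ = ℕ.m⊔n≤o⇒m≤o (Nx ℕ.⊔ Ny) (My ℕ.⊔ Mx) m≥
      n≥₁ = ℕ.m⊔n≤o⇒m≤o (Nx ℕ.⊔ Ny) (My ℕ.⊔ Mx) n≥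
      m≥₂ = ℕ.m⊔n≤o⇒n≤o (Nx ℕ.⊔ Ny) (My ℕ.⊔ Mx) m≥
      n≥₂ = ℕ.m⊔n≤o⇒n≤o (Nx ℕ.⊔ Ny) (My ℕ.⊔ Mx) n≥
    in product-close (seq x m) (seq x n) (seq y m) (seq y n)
      (product-bound (seq x m) (seq y m ℚ.- seq y n) Bx>0 eqy
        (x≤ m (ℕ.m⊔n≤o⇒m≤o Nx Ny m≥₁))
        (py m n (ℕ.m⊔n≤o⇒m≤o My Mx m≥₂) (ℕ.m⊔n≤o⇒m≤o My Mx n≥₂)))
      (product-bound (seq y n) (seq x m ℚ.- seq x n) By>0 eqx
        (y≤ n (ℕ.m⊔n≤o⇒n≤o Nx Ny n≥₁))
        (px m n (ℕ.m⊔n≤o⇒n≤o My Mx m≥₂) (ℕ.m⊔n≤o⇒n≤o My Mx n≥₂)))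
    where open ℚ-Lemmas

_*_ : ℝ → ℝ → ℝ
x * y = mkℝ (λ n → seq x n ℚ.* seq y n) (*-cauchy x y)

-- If η is a positive rational with η < xₙ for all large n, then
-- 1 / max(xₙ, η) is defined for every n and equals 1 / xₙ for all large n.

module Reciprocal (x : ℝ) (η : ℚ) (η>0 : 0ℚ ℚ.< η) (N : ℕ)
                  (η<x : ∀ n → N ℕ.≤ n → 0ℚ ℚ.+ η ℚ.< seq x n) where

  open ℚ-Lemmas

  m : ℕ → ℚ
  m n = seq x n ℚ.⊔ η

  η≤m : ∀ n → η ℚ.≤ m n
  η≤m n = ℚ.p≤q⊔p (seq x n) η

  m>0 : ∀ n → 0ℚ ℚ.< m n
  m>0 n = ℚ.<-≤-trans η>0 (η≤m n)

  inv : ℕ → ℚ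
  inv n = ℚ.1/_ (m n) {{ℚ.>-nonZero (m>0 n)}}

  inv-m : ∀ n → inv n ℚ.* m n ≡ 1ℚ
  inv-m n = ℚ.*-inverseˡ (m n) {{ℚ.>-nonZero (m>0 n)}}

  m≡x : ∀ n → N ℕ.≤ n → m n ≡ seq x n
  m≡x n n≥ = ℚ.p≥q⇒p⊔q≡p
    (ℚ.<⇒≤ (subst (ℚ._< seq x n) (ℚ.+-identityˡ η) (η<x n n≥)))

  diff : ∀ k l → ℚ.∣ inv k ℚ.- inv l ∣ ℚ.* (m k ℚ.* m l) ≡ ℚ.∣ m l ℚ.- m k ∣
  diff k l = trans
    (cong (ℚ.∣ inv k ℚ.- inv l ∣ ℚ.*_)
      (sym (ℚ.0≤p⇒∣p∣≡p (ℚ.<⇒≤ (*-pos (m>0 k) (m>0 l))))))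
    (trans (sym (ℚ.∣p*q∣≡∣p∣*∣q∣ (inv k ℚ.- inv l) (m k ℚ.* m l)))
    (cong ℚ.∣_∣ (trans
      (cross-difference (inv k) (inv l) (m k) (m l))
      (cong₂ ℚ._-_
        (trans (cong (ℚ._* m l) (inv-m k)) (ℚ.*-identityˡ (m l)))
        (trans (cong (ℚ._* m k) (inv-m l)) (ℚ.*-identityˡ (m k)))))))

  abstract
    inv-cauchy : IsCauchy inv
    inv-cauchy ε ε>0 =
      let M , p = cauchy x (ε ℚ.* (η ℚ.* η)) (*-pos ε>0 (*-pos η>0 η>0))
      in M ℕ.⊔ N , λ k l k≥ l≥ →
      ℚ.*-cancelʳ-<-nonNeg (m k ℚ.* m l)
        {{ℚ.nonNegative (ℚ.<⇒≤ (*-pos (m>0 k) (m>0 l)))}}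
        (ℚ.<-≤-trans
          (subst (ℚ._< ε ℚ.* (η ℚ.* η))
            (trans (cong₂ (λ s t → ℚ.∣ s ℚ.- t ∣)
                (sym (m≡x l (ℕ.m⊔n≤o⇒n≤o M N l≥))) (sym (m≡x k (ℕ.m⊔n≤o⇒n≤o M N k≥))))
              (sym (diff k l)))
            (p l k (ℕ.m⊔n≤o⇒m≤o M N l≥) (ℕ.m⊔n≤o⇒m≤o M N k≥)))
          (ℚ.*-monoˡ-≤-nonNeg ε {{ℚ.nonNegative (ℚ.<⇒≤ ε>0)}}
            (*-mono-≤ (ℚ.<⇒≤ η>0) (ℚ.<⇒≤ (m>0 l)) (η≤m k) (η≤m l))))

_⁻¹[_] : (x : ℝ) → 0ℝ < x → ℝ
x ⁻¹[ η , η>0 , N , η<x ] = mkℝ inv inv-cauchy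
  where open Reciprocal x η η>0 N η<x

infixl 7 _÷_[_]

_÷_[_] : (x y : ℝ) → 0ℝ < y → ℝ
x ÷ y [ y>0 ] = x * y ⁻¹[ y>0 ]

module Log₂ where

  L : ℕ → ℕ → ℕ
  L n a = ⌊log₂ (n ℕ.^ suc a) ⌋

  2^⌊log₂n⌋≤n : ∀ l n → ⌊log₂ (suc n) ⌋ ≡ l → 2 ℕ.^ l ℕ.≤ suc n
  2^⌊log₂n⌋≤n zero    n             eq = ℕ.s≤s ℕ.z≤n
  2^⌊log₂n⌋≤n (suc l) zero          ()
  2^⌊log₂n⌋≤n (suc l) (suc n)       eq = ℕ.≤-trans
    (ℕ.*-monoʳ-≤ 2 (2^⌊log₂n⌋≤n l ℕ.⌊ n /2⌋
      (trans (⌊log₂⌊n/2⌋⌋≡⌊log₂n⌋∸1 (suc (suc n))) (cong ℕ.pred eq))))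
    (2*⌊n/2⌋≤n (suc (suc n)))
    where
    2*⌊n/2⌋≤n : ∀ n → 2 ℕ.* ℕ.⌊ n /2⌋ ℕ.≤ n
    2*⌊n/2⌋≤n n = subst₂ ℕ._≤_
      (cong (ℕ.⌊ n /2⌋ ℕ.+_) (sym (ℕ.+-identityʳ ℕ.⌊ n /2⌋)))
      (ℕ.⌊n/2⌋+⌈n/2⌉≡n n)
      (ℕ.+-monoʳ-≤ ℕ.⌊ n /2⌋ (ℕ.⌊n/2⌋≤⌈n/2⌉ n))

  n<2^1+⌊log₂n⌋ : ∀ n → n ℕ.< 2 ℕ.^ suc ⌊log₂ n ⌋
  n<2^1+⌊log₂n⌋ n = ℕ.≰⇒> λ le → ℕ.1+n≰n
    (subst (ℕ._≤ ⌊log₂ n ⌋) (⌊log₂[2^n]⌋≡n (suc ⌊log₂ n ⌋)) (⌊log₂⌋-mono-≤ le))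

  cross : ∀ n a b → L n a ℕ.* suc b ℕ.≤ suc (L n b) ℕ.* suc a
  cross zero    a b = ℕ.z≤n
  cross (suc n) a b = ℕ.≮⇒≥ λ lt → ℕ.<-irrefl refl (ℕ.<-≤-trans strict
    (ℕ.^-monoʳ-≤ 2 (ℕ.<⇒≤ lt)))
    where
    N : ℕ
    N = suc n
    pow : ∀ k → 2 ℕ.^ L N k ℕ.≤ N ℕ.^ suc k
    pow k = subst (λ t → 2 ℕ.^ ⌊log₂ t ⌋ ℕ.≤ t)
      (ℕ.suc-pred (N ℕ.^ suc k) {{ℕ.m^n≢0 N (suc k)}}) (2^⌊log₂n⌋≤n _ _ refl)
    strict : 2 ℕ.^ (L N a ℕ.* suc b) ℕ.< 2 ℕ.^ (suc (L N b) ℕ.* suc a)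
    strict = begin-strict
      2 ℕ.^ (L N a ℕ.* suc b)          ≡⟨ ℕ.^-*-assoc 2 (L N a) (suc b) ⟨
      (2 ℕ.^ L N a) ℕ.^ suc b          ≤⟨ ℕ.^-monoˡ-≤ (suc b) (pow a) ⟩
      (N ℕ.^ suc a) ℕ.^ suc b          ≡⟨ ℕ.^-*-assoc N (suc a) (suc b) ⟩
      N ℕ.^ (suc a ℕ.* suc b)          ≡⟨ cong (N ℕ.^_) (ℕ.*-comm (suc a) (suc b)) ⟩
      N ℕ.^ (suc b ℕ.* suc a)          ≡⟨ ℕ.^-*-assoc N (suc b) (suc a) ⟨
      (N ℕ.^ suc b) ℕ.^ suc a          <⟨ ℕ.^-monoˡ-< (suc a) (n<2^1+⌊log₂n⌋ (N ℕ.^ suc b)) ⟩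
      (2 ℕ.^ suc (L N b)) ℕ.^ suc a    ≡⟨ ℕ.^-*-assoc 2 (suc (L N b)) (suc a) ⟩
      2 ℕ.^ (suc (L N b) ℕ.* suc a)    ∎
      where open ℕ.≤-Reasoning

  approx : ℕ → ℕ → ℚ
  approx n a = + L n a ℚ./ suc a

  close : ∀ n N a b → N ℕ.≤ b →
          approx n a ℚ.≤ approx n b ℚ.+ fromℚᵘ (ℚᵘ.mkℚᵘ (+ 1) N)
  close n N a b N≤b = ℚ.toℚᵘ-cancel-≤ (begin
    ℚ.toℚᵘ (approx n a)                          ≃⟨ ℚ.toℚᵘ-fromℚᵘ A ⟩
    A                                            ≤⟨ ℚᵘ.*≤* ineq ⟩
    B ℚᵘ.+ E                                     ≃⟨ ℚᵘ.+-cong (ℚ.toℚᵘ-fromℚᵘ B) (ℚ.toℚᵘ-fromℚᵘ E) ⟨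
    ℚ.toℚᵘ (approx n b) ℚᵘ.+ ℚ.toℚᵘ (fromℚᵘ E)   ≃⟨ ℚ.toℚᵘ-homo-+ (approx n b) (fromℚᵘ E) ⟨
    ℚ.toℚᵘ (approx n b ℚ.+ fromℚᵘ E)             ∎)
    where
    open ℚᵘ.≤-Reasoning
    A B E : ℚᵘ.ℚᵘ
    A = ℚᵘ.mkℚᵘ (+ L n a) a
    B = ℚᵘ.mkℚᵘ (+ L n b) b
    E = ℚᵘ.mkℚᵘ (+ 1) N
    ineqℕ : L n a ℕ.* (suc b ℕ.* suc N) ℕ.≤
            (L n b ℕ.* suc N ℕ.+ 1 ℕ.* suc b) ℕ.* suc a
    ineqℕ = ℕ.≤-trans
      (subst₂ ℕ._≤_ (ℕ.*-assoc (L n a) (suc b) (suc N))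
        (solve 3 (λ l a N → (con 1 :+ l) :* a :* N := (l :* N :+ N) :* a) refl
          (L n b) (suc a) (suc N))
        (ℕ.*-monoˡ-≤ (suc N) (cross n a b)))
      (ℕ.*-monoˡ-≤ (suc a) (ℕ.+-monoʳ-≤ (L n b ℕ.* suc N)
        (subst (suc N ℕ.≤_) (sym (ℕ.*-identityˡ (suc b))) (ℕ.s≤s N≤b))))
      where open ℕSolver.+-*-Solver
    ineq : ℚᵘ.↥ A ℤ.* ℚᵘ.↧ (B ℚᵘ.+ E) ℤ.≤ ℚᵘ.↥ (B ℚᵘ.+ E) ℤ.* ℚᵘ.↧ A
    ineq = subst₂ ℤ._≤_
      (ℤ.pos-* (L n a) (suc b ℕ.* suc N))
      (trans (ℤ.pos-* (L n b ℕ.* suc N ℕ.+ 1 ℕ.* suc b) (suc a))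
        (cong (ℤ._* + suc a)
          (cong₂ ℤ._+_ (ℤ.pos-* (L n b) (suc N)) (ℤ.pos-* 1 (suc b)))))
      (ℤ.+≤+ ineqℕ)

  abstract
    approx-cauchy : ∀ n → IsCauchy (approx n)
    approx-cauchy n ε ε>0 =
      let N , lt = ℚ-Lemmas.archimedean ε ε>0
      in N , λ a b a≥ b≥ → ℚ-Lemmas.∣p-q∣<r
      (ℚ.≤-<-trans (close n N a b b≥) (ℚ.+-monoʳ-< (approx n b) lt))
      (ℚ.≤-<-trans (close n N b a a≥) (ℚ.+-monoʳ-< (approx n a) lt))

-- The limit of ⌊log₂ nᵃ⌋ / a as a → ∞, which is log₂ n for n ≥ 1 since
-- log₂ nᵃ - 1 < ⌊log₂ nᵃ⌋ ≤ log₂ nᵃ.  As for ⌊log₂_⌋, log₂ 0 is 0.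

log₂ : ℕ → ℝ
log₂ n = mkℝ (Log₂.approx n) (Log₂.approx-cauchy n)

-- N ≡2^ x says that N = 2ˣ: the power 2ˣ is the number lying strictly
-- between 2ʳ and 2ˢ for all rationals r < x < s.  A rational exponent is
-- written (a - b) / q with q ≥ 1, and 2^((a - b) / q) < N is
-- 2ᵃ < 2ᵇ * N^q.

infix 4 _≡2^_

_≡2^_ : ℕ → ℝ → Set
N ≡2^ x = ∀ a b q .{{_ : ℕ.NonZero q}} →
  (fromℚ ((a ⊖ b) ℚ./ q) < x → 2 ℕ.^ a ℕ.< 2 ℕ.^ b ℕ.* N ℕ.^ q) ×
  (x < fromℚ ((a ⊖ b) ℚ./ q) → 2 ℕ.^ b ℕ.* N ℕ.^ q ℕ.< 2 ℕ.^ a)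

-- 𝔽₂ is the field (Bool, _xor_, _∧_).
𝔽₂^ : ℕ → Set
𝔽₂^ n = Vec Bool n

𝟎 : ∀ {n} → 𝔽₂^ n
𝟎 = replicate _ false

infixl 6 _⊕_
infixr 7 _•_

_⊕_ : ∀ {n} → 𝔽₂^ n → 𝔽₂^ n → 𝔽₂^ n
_⊕_ = zipWith _xor_

_•_ : ∀ {n} → Bool → 𝔽₂^ n → 𝔽₂^ n
a • v = Vec.map (a ∧_) v

dot : ∀ {n} → 𝔽₂^ n → 𝔽₂^ n → Bool
dot x y = Vec.foldr _ _xor_ false (zipWith _∧_ x y)

allVectors : ∀ n → List (𝔽₂^ n)
allVectors zero    = Vec.[] ∷ []
allVectors (suc n) = List.map (false Vec.∷_) (allVectors n) List.++
                     List.map (true  Vec.∷_) (allVectors n)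

weight : ∀ {n} → 𝔽₂^ n → ℕ
weight = count (Bool._≟ true)

hammingDistance : ∀ {n} → 𝔽₂^ n → 𝔽₂^ n → ℕ
hammingDistance x y = weight (x ⊕ y)

combination : ∀ {k n} → (Fin k → Bool) → (Fin k → 𝔽₂^ n) → 𝔽₂^ n
combination a v = Vector.foldr _⊕_ 𝟎 (λ i → a i • v i)

LinearlyIndependent : ∀ {k n} → (Fin k → 𝔽₂^ n) → Set
LinearlyIndependent v = ∀ a → combination a v ≡ 𝟎 → ∀ i → a i ≡ false

Spans : ∀ {k n} → (Fin k → 𝔽₂^ n) → Pred (𝔽₂^ n) 0ℓ → Set
Spans v P = ∀ {x} → x ∈ P → ∃[ a ] combination a v ≡ x

-- Closure under scalars is automatic: they are false and true, acting as
-- zero and the identity.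
record LinearCode (n : ℕ) : Set₁ where
  field
    Codeword : Pred (𝔽₂^ n) 0ℓ
    𝟎-closed : 𝟎 ∈ Codeword
    ⊕-closed : ∀ {x y} → x ∈ Codeword → y ∈ Codeword → (x ⊕ y) ∈ Codeword

open LinearCode public

HasDimension : ∀ {n} → LinearCode n → ℕ → Set
HasDimension 𝒞 k = Σ[ v ∈ (Fin k → 𝔽₂^ _) ]
  (∀ i → v i ∈ Codeword 𝒞) × LinearlyIndependent v × Spans v (Codeword 𝒞)

HasDistance : ∀ {n} → LinearCode n → ℕ → Set
HasDistance 𝒞 d = ∀ c → c ∈ Codeword 𝒞 → c ≢ 𝟎 → d ℕ.≤ weight c

-- The relation d(r, 𝒞) = m.
IsDistanceTo : ∀ {n} → 𝔽₂^ n → LinearCode n → ℕ → Set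
IsDistanceTo r 𝒞 m =
  (∃[ c ] c ∈ Codeword 𝒞 × hammingDistance r c ≡ m) ×
  (∀ c → c ∈ Codeword 𝒞 → m ℕ.≤ hammingDistance r c)

infix 9 _⊥

_⊥ : ∀ {n} → LinearCode n → Pred (𝔽₂^ n) 0ℓ
(𝒞 ⊥) α = ∀ c → c ∈ Codeword 𝒞 → dot α c ≡ false

sumOver : ∀ {n} → (𝔽₂^ n → ℝ) → ℝ
sumOver {n} f = List.foldr _+_ 0ℝ (List.map f (allVectors n))

record LocalTester {n : ℕ} (𝒞 : LinearCode n) : Set where
  field
    prob        : 𝔽₂^ n → ℝ
    nonNegative : ∀ α → 0ℝ ≤ prob α
    total       : sumOver prob ≃ 1ℝ
    supported   : ∀ α → α ∉ 𝒞 ⊥ → prob α ≃ 0ℝ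

open LocalTester public

Pr : ∀ {n} {𝒞 : LinearCode n} → LocalTester 𝒞 → (𝔽₂^ n → Bool) → ℝ
Pr 𝒟 event = sumOver (λ α → if event α then prob 𝒟 α else 0ℝ)

IsSmooth : ∀ {n} {𝒞 : LinearCode n} → LocalTester 𝒞 → ℝ → Set
IsSmooth 𝒟 ε = ∀ i → Pr 𝒟 (λ α → lookup α i) ≤ ε

HasSoundness : ∀ {n} {𝒞 : LinearCode n} → LocalTester 𝒞 → ℝ → Set
HasSoundness {𝒞 = 𝒞} 𝒟 δ =
  ∀ r m → IsDistanceTo r 𝒞 m → δ * fromℕ m ≤ Pr 𝒟 (λ α → dot α r)

record Multigraph : Set₁ where
  field
    Vertex : Set
    Edge   : Vertex → Vertex → Set

open Multigraph public

data Walk (𝒢 : Multigraph) : Vertex 𝒢 → Vertex 𝒢 → ℕ → Set where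
  nil  : ∀ {x} → Walk 𝒢 x x 0
  cons : ∀ {x y z ℓ} → Edge 𝒢 x y → Walk 𝒢 y z ℓ → Walk 𝒢 x z (suc ℓ)

IsShortestPathMetric : (𝒢 : Multigraph) → (Vertex 𝒢 → Vertex 𝒢 → ℕ) → Set
IsShortestPathMetric 𝒢 ρ = ∀ x y →
  Walk 𝒢 x y (ρ x y) × (∀ ℓ → Walk 𝒢 x y ℓ → ρ x y ℕ.≤ ℓ)

Cay : ∀ {n} h → (Fin n → 𝔽₂^ h) → Multigraph
Cay {n} h S = record
  { Vertex = 𝔽₂^ h
  ; Edge   = λ x y → Σ[ i ∈ Fin n ] y ≡ x ⊕ S i
  }

WiseIndependent : ∀ {n h} → ℕ → (Fin n → 𝔽₂^ h) → Set
WiseIndependent {n} d S = ∀ m (ι : Fin m → Fin n) → Injective _≡_ _≡_ ι →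
  m ℕ.< d → LinearlyIndependent (S ∘ ι)

ℓ₁-distance : ∀ {m} → (Fin m → ℝ) → (Fin m → ℝ) → ℝ
ℓ₁-distance u v = Vector.foldr _+_ 0ℝ (λ i → ∣ u i - v i ∣)

EmbedsIntoℓ₁ : (X : Set) → (X → X → ℝ) → ℝ → Set
EmbedsIntoℓ₁ X d₁ c =
  Σ[ m ∈ ℕ ] Σ[ f ∈ (X → Fin m → ℝ) ] Σ[ α ∈ ℝ ] 0ℝ < α ×
  (∀ x y → α * d₁ x y ≤ ℓ₁-distance (f x) (f y) ×
           ℓ₁-distance (f x) (f y) ≤ c * α * d₁ x y)

InfinitelyMany : ∀ {ℓ : Level} → (ℕ → Set ℓ) → Set ℓ
InfinitelyMany P = ∀ N → ∃[ n ] N ℕ.< n × P n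

SmoothTestableCodes : ℕ → ℝ → Set₁
SmoothTestableCodes d c = Σ[ C ∈ ℝ ] InfinitelyMany λ n →
  Σ[ 𝒞 ∈ LinearCode n ] Σ[ k ∈ ℕ ]
    HasDimension 𝒞 k × HasDistance 𝒞 d × fromℕ k ≃ fromℕ n - c * log₂ n ×
    (Σ[ 𝒟 ∈ LocalTester 𝒞 ] Σ[ ε ∈ ℝ ] Σ[ δ ∈ ℝ ] Σ[ δ>0 ∈ 0ℝ < δ ]
      IsSmooth 𝒟 ε × HasSoundness 𝒟 δ × ε ÷ δ [ δ>0 ] ≤ C)

ℓ₁-EmbeddableCayleyGraphs : ℕ → (c : ℝ) → 0ℝ < c → Set
ℓ₁-EmbeddableCayleyGraphs d c c>0 = Σ[ C ∈ ℝ ] InfinitelyMany λ h →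
  Σ[ n ∈ ℕ ] Σ[ S ∈ (Fin n → 𝔽₂^ h) ]
    Spans S (λ _ → ⊤) × n ≡2^ fromℕ h ÷ c [ c>0 ] × WiseIndependent d S ×
    (Σ[ ρ ∈ (𝔽₂^ h → 𝔽₂^ h → ℕ) ]
      IsShortestPathMetric (Cay h S) ρ ×
      EmbedsIntoℓ₁ (𝔽₂^ h) (λ x y → fromℕ (ρ x y)) C)

{-# OPTIONS --safe #-}
module Submission where

-- A code of codimension h is the kernel of a surjection H : 𝔽₂ⁿ → 𝔽₂ʰ, and
-- with S the family of columns of H the distance from r to the code is the
-- distance from 0 to H r in Cay(𝔽₂ʰ, S).  A tester 𝒟 yields the embedding
-- y ↦ (𝒟(α) [ α · g y = 1 ])_α, where g is a section of H: soundness is its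
-- lower bound, and smoothness with a union bound over the support of a coset
-- leader is its upper bound.  Conversely, averaging an embedding f over
-- translations gives x ↦ ∑_z ‖ f(z + x) - f(z) ‖, which by Fourier inversion
-- is ∑_β w_β [ β · x = 1 ] with w_β proportional to
-- - ∑_{y,z} ‖ f(y) - f(z) ‖ χ_β(y + z).  These weights are nonnegative for
-- β ≠ 0 because ℓ₁ is of negative type, and the tester picks Sᵀ β with
-- probability proportional to w_β.

open import Data.Bool.Base using (Bool; true; false; _xor_; _∧_; not; if_then_else_)
import Data.Bool.Properties as Bool
open import Data.Fin.Base using (Fin; zero; suc)
import Data.Fin.Properties as Fin
open import Data.Integer.Base as ℤ using (+_; -[1+_]; _⊖_)
import Data.Integer.Properties as ℤ
import Data.Integer.Solver as ℤSolver
open import Data.List.Base as List using (List; []; _∷_)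
import Data.List.Membership.Propositional as List
open import Data.List.Membership.Propositional.Properties
  using (∈-++⁺ˡ; ∈-++⁺ʳ; ∈-map⁺; ∈-filter⁺)
import Data.List.Properties as List
open import Data.List.Relation.Binary.Permutation.Propositional as Perm using (_↭_)
open import Data.List.Relation.Unary.All as All using (All; []; _∷_)
import Data.List.Relation.Unary.All.Properties as All
open import Data.List.Relation.Unary.AllPairs using (AllPairs; []; _∷_)
open import Data.List.Relation.Unary.Any using (here)
open import Data.List.Relation.Unary.Linked.Properties using (Linked⇒AllPairs)
import Data.List.Sort as Sort
open import Data.Nat.Base as ℕ using (ℕ; zero; suc)
open import Data.Nat.Logarithm using (⌊log₂_⌋; ⌊log₂⌋-mono-≤; ⌊log₂[2^n]⌋≡n)
import Data.Nat.Properties as ℕ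
open import Data.Product.Base using (Σ-syntax; ∃-syntax; _×_; _,_; proj₁; proj₂)
open import Data.Rational.Base as ℚ using (ℚ; mkℚ; 0ℚ; 1ℚ; ½; fromℚᵘ)
import Data.Rational.Properties as ℚ
import Data.Rational.Unnormalised.Base as ℚᵘ
import Data.Rational.Unnormalised.Properties as ℚᵘ
open import Data.Sum.Base using (inj₁; inj₂)
open import Data.Unit.Base using (⊤)
open import Data.Vec.Base as Vec using (Vec; []; _∷_; lookup; tabulate; head; tail)
import Data.Vec.Functional as Vector
import Data.Vec.Properties as Vec
open import Function.Base using (_∘_; id)
open import Function.Bundles using (_⇔_; mk⇔)
open import Function.Definitions using (Injective)
import Relation.Binary.Construct.On as On
open import Relation.Binary.PropositionalEquality
open import Relation.Nullary.Decidable.Core using (yes; no; does)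
open import Relation.Nullary.Negation.Core using (¬_; contradiction)
open import Relation.Unary using (_∈_; _∉_)
import Data.List.Extrema ℕ.≤-totalOrder as Extrema
open import Defs
open ℚ-Lemmas using
  ( solve; _:=_; _:+_; _:-_; _:*_; :-_; con; half-pos; halves; *-pos; scale
  ; p≤∣p∣; ∣p-q∣<r; ∣p-q∣≡∣q-p∣ )

-- Linear algebra over 𝔽₂

-- What shapes the argument is that the reals are Cauchy sequences, whose order is not decidable.
-- Negative type is proved by sorting points on a line, so it is established for rational points.
-- The terms of an embedding at any fixed index form a rational map into ℓ₁, and the Fourier
-- identities hold there exactly, so the weights are nonnegative at every index; limits enter only
-- in comparisons with distances, `ε` and `δ`. The linear algebra is effective because a code comes
-- with a basis: elimination turns it into a parity check map, and it decides membership in the dual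
-- code. Infinitude transfers because the codimension is `h`, so that the rate condition reads
-- `h = c log₂ n` and large `n` goes with large `h`. Distance matches `d`-wise independence because
-- a codeword of weight `m` is a vanishing sum of `m` columns. The distortion constant equals the
-- bound on `ε / δ` from codes to graphs and becomes `∣ C ∣` on the way back, where generators at
-- distance 0 and at distance 1 share one bound.

_≟_ : ∀ {n} (x y : 𝔽₂^ n) → _
_≟_ = Vec.≡-dec Bool._≟_

⊕-assoc : ∀ {n} (x y z : 𝔽₂^ n) → (x ⊕ y) ⊕ z ≡ x ⊕ (y ⊕ z)
⊕-assoc = Vec.zipWith-assoc Bool.xor-assoc

⊕-comm : ∀ {n} (x y : 𝔽₂^ n) → x ⊕ y ≡ y ⊕ x
⊕-comm = Vec.zipWith-comm Bool.xor-comm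

⊕-identityˡ : ∀ {n} (x : 𝔽₂^ n) → 𝟎 ⊕ x ≡ x
⊕-identityˡ = Vec.zipWith-identityˡ Bool.xor-identityˡ

⊕-identityʳ : ∀ {n} (x : 𝔽₂^ n) → x ⊕ 𝟎 ≡ x
⊕-identityʳ = Vec.zipWith-identityʳ Bool.xor-identityʳ

⊕-same : ∀ {n} (x : 𝔽₂^ n) → x ⊕ x ≡ 𝟎
⊕-same []       = refl
⊕-same (a ∷ x) = cong₂ _∷_ (Bool.xor-same a) (⊕-same x)

⊕-interchange : ∀ {n} (x y z w : 𝔽₂^ n) → (x ⊕ y) ⊕ (z ⊕ w) ≡ (x ⊕ z) ⊕ (y ⊕ w)
⊕-interchange x y z w = begin
  (x ⊕ y) ⊕ (z ⊕ w)  ≡⟨ ⊕-assoc x y (z ⊕ w) ⟩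
  x ⊕ (y ⊕ (z ⊕ w))  ≡⟨ cong (x ⊕_) (⊕-assoc y z w) ⟨
  x ⊕ ((y ⊕ z) ⊕ w)  ≡⟨ cong (λ t → x ⊕ (t ⊕ w)) (⊕-comm y z) ⟩
  x ⊕ ((z ⊕ y) ⊕ w)  ≡⟨ cong (x ⊕_) (⊕-assoc z y w) ⟩
  x ⊕ (z ⊕ (y ⊕ w))  ≡⟨ ⊕-assoc x z (y ⊕ w) ⟨
  (x ⊕ z) ⊕ (y ⊕ w)  ∎
  where open ≡-Reasoning

xor-interchange : ∀ a b c d → (a xor b) xor (c xor d) ≡ (a xor c) xor (b xor d)
xor-interchange a b c d = cong head (⊕-interchange (a ∷ []) (b ∷ []) (c ∷ []) (d ∷ []))

⊕-cancelˡ : ∀ {n} (x y : 𝔽₂^ n) → x ⊕ (x ⊕ y) ≡ y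
⊕-cancelˡ x y = begin
  x ⊕ (x ⊕ y)  ≡⟨ ⊕-assoc x x y ⟨
  (x ⊕ x) ⊕ y  ≡⟨ cong (_⊕ y) (⊕-same x) ⟩
  𝟎 ⊕ y        ≡⟨ ⊕-identityˡ y ⟩
  y            ∎
  where open ≡-Reasoning

⊕-cancelʳ : ∀ {n} (x y : 𝔽₂^ n) → (x ⊕ y) ⊕ y ≡ x
⊕-cancelʳ x y = trans (⊕-comm (x ⊕ y) y) (trans (cong (y ⊕_) (⊕-comm x y)) (⊕-cancelˡ y x))

⊕≡𝟎⇒≡ : ∀ {n} (x y : 𝔽₂^ n) → x ⊕ y ≡ 𝟎 → x ≡ y
⊕≡𝟎⇒≡ x y eq = begin
  x            ≡⟨ ⊕-identityʳ x ⟨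
  x ⊕ 𝟎        ≡⟨ cong (x ⊕_) eq ⟨
  x ⊕ (x ⊕ y)  ≡⟨ ⊕-cancelˡ x y ⟩
  y            ∎
  where open ≡-Reasoning

true• : ∀ {n} (x : 𝔽₂^ n) → true • x ≡ x
true• = Vec.map-id

false• : ∀ {n} (x : 𝔽₂^ n) → false • x ≡ 𝟎
false• x = Vec.map-const x false

•-𝟎 : ∀ {n} a → a • 𝟎 {n} ≡ 𝟎
•-𝟎 true  = true• 𝟎
•-𝟎 false = false• 𝟎

xor-• : ∀ {n} a b (x : 𝔽₂^ n) → (a xor b) • x ≡ a • x ⊕ b • x
xor-• a b []       = refl
xor-• a b (c ∷ x) = cong₂ _∷_ (Bool.∧-distribʳ-xor c a b) (xor-• a b x)

-- This is linearity: compatibility with scalars follows, since they act as zero and the identity.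
Additive : ∀ {m n} → (𝔽₂^ m → 𝔽₂^ n) → Set
Additive L = ∀ x y → L (x ⊕ y) ≡ L x ⊕ L y

AdditiveForm : ∀ {n} → (𝔽₂^ n → Bool) → Set
AdditiveForm φ = ∀ x y → φ (x ⊕ y) ≡ φ x xor φ y

module _ {m n : ℕ} {L : 𝔽₂^ m → 𝔽₂^ n} (L-⊕ : Additive L) where

  additive-𝟎 : L 𝟎 ≡ 𝟎
  additive-𝟎 = begin
    L 𝟎          ≡⟨ cong L (⊕-same 𝟎) ⟨
    L (𝟎 ⊕ 𝟎)    ≡⟨ L-⊕ 𝟎 𝟎 ⟩
    L 𝟎 ⊕ L 𝟎    ≡⟨ ⊕-same (L 𝟎) ⟩
    𝟎            ∎
    where open ≡-Reasoning

  additive-• : ∀ a x → L (a • x) ≡ a • L x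
  additive-• true  x = trans (cong L (true• x)) (sym (true• (L x)))
  additive-• false x = trans (cong L (false• x)) (trans additive-𝟎 (sym (false• (L x))))

  additive-combination : ∀ {k} a (v : Fin k → 𝔽₂^ m) →
                         L (combination a v) ≡ combination a (L ∘ v)
  additive-combination {zero}  a v = additive-𝟎
  additive-combination {suc k} a v = trans (L-⊕ (a zero • v zero) _)
    (cong₂ _⊕_ (additive-• (a zero) (v zero)) (additive-combination (a ∘ suc) (v ∘ suc)))

additiveForm-𝟎 : ∀ {n} (φ : 𝔽₂^ n → Bool) → AdditiveForm φ → φ 𝟎 ≡ false
additiveForm-𝟎 φ φ-⊕ = begin
  φ 𝟎            ≡⟨ cong φ (⊕-same 𝟎) ⟨
  φ (𝟎 ⊕ 𝟎)      ≡⟨ φ-⊕ 𝟎 𝟎 ⟩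
  φ 𝟎 xor φ 𝟎    ≡⟨ Bool.xor-same (φ 𝟎) ⟩
  false          ∎
  where open ≡-Reasoning

combination-cong : ∀ {k n} {a b : Fin k → Bool} {u v : Fin k → 𝔽₂^ n} →
                   (∀ i → a i ≡ b i) → (∀ i → u i ≡ v i) →
                   combination a u ≡ combination b v
combination-cong {zero}  p q = refl
combination-cong {suc k} p q = cong₂ _⊕_ (cong₂ _•_ (p zero) (q zero))
  (combination-cong (p ∘ suc) (q ∘ suc))

combination-xor : ∀ {k n} (a b : Fin k → Bool) (v : Fin k → 𝔽₂^ n) →
  combination (λ i → a i xor b i) v ≡ combination a v ⊕ combination b v
combination-xor {zero}  a b v = sym (⊕-same 𝟎)
combination-xor {suc k} a b v = trans
  (cong₂ _⊕_ (xor-• (a zero) (b zero) (v zero))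
             (combination-xor (a ∘ suc) (b ∘ suc) (v ∘ suc)))
  (⊕-interchange (a zero • v zero) (b zero • v zero) _ _)

combination-false : ∀ {k n} (v : Fin k → 𝔽₂^ n) → combination (λ _ → false) v ≡ 𝟎
combination-false {zero}  v = refl
combination-false {suc k} v = trans
  (cong₂ _⊕_ (false• (v zero)) (combination-false (v ∘ suc))) (⊕-identityˡ 𝟎)

-- The matrix with columns `S` applied to `x`; every additive map has this form by
-- `additive≡syndrome`.
syndrome : ∀ {n h} → (Fin n → 𝔽₂^ h) → 𝔽₂^ n → 𝔽₂^ h
syndrome S x = combination (lookup x) S

syndrome-⊕ : ∀ {n h} (S : Fin n → 𝔽₂^ h) → Additive (syndrome S)
syndrome-⊕ S x y = trans
  (combination-cong (λ i → Vec.lookup-zipWith _xor_ i x y) (λ _ → refl))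
  (combination-xor (lookup x) (lookup y) S)

syndrome-tabulate : ∀ {n h} (S : Fin n → 𝔽₂^ h) a →
                    syndrome S (tabulate a) ≡ combination a S
syndrome-tabulate S a = combination-cong (Vec.lookup∘tabulate a) (λ _ → refl)

unit : ∀ {n} → Fin n → 𝔽₂^ n
unit zero    = true ∷ 𝟎
unit (suc i) = false ∷ unit i

combination-unit : ∀ {n} (a : Fin n → Bool) → combination a unit ≡ tabulate a
combination-unit {zero}  a = refl
combination-unit {suc n} a = begin
  a zero • unit zero ⊕ combination (a ∘ suc) (λ i → false ∷ unit i)
    ≡⟨ cong (a zero • unit zero ⊕_)
         (additive-combination {L = false ∷_} (λ _ _ → refl) (a ∘ suc) unit) ⟨
  a zero • unit zero ⊕ (false ∷ combination (a ∘ suc) unit)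
    ≡⟨ cong₂ _∷_ (trans (Bool.xor-identityʳ _) (Bool.∧-identityʳ (a zero)))
         (trans (cong₂ _⊕_ (•-𝟎 (a zero)) (combination-unit (a ∘ suc))) (⊕-identityˡ _)) ⟩
  tabulate a ∎
  where open ≡-Reasoning

syndrome-unit : ∀ {n} (x : 𝔽₂^ n) → syndrome unit x ≡ x
syndrome-unit x = trans (combination-unit (lookup x)) (Vec.tabulate∘lookup x)

additive≡syndrome : ∀ {m n} {L : 𝔽₂^ m → 𝔽₂^ n} → Additive L →
                    ∀ x → L x ≡ syndrome (L ∘ unit) x
additive≡syndrome {L = L} L-⊕ x = trans (cong L (sym (syndrome-unit x)))
  (additive-combination L-⊕ (lookup x) unit)

syndrome-at-unit : ∀ {n h} (S : Fin n → 𝔽₂^ h) i → syndrome S (unit i) ≡ S i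
syndrome-at-unit S zero    = trans
  (cong₂ _⊕_ (true• (S zero)) (trans
    (combination-cong {u = S ∘ suc} {v = S ∘ suc} (λ i → Vec.lookup-replicate i false) (λ _ → refl))
    (combination-false (S ∘ suc))))
  (⊕-identityʳ (S zero))
syndrome-at-unit S (suc i) = trans
  (cong₂ _⊕_ (false• (S zero)) (syndrome-at-unit (S ∘ suc) i)) (⊕-identityˡ _)

independent-tail : ∀ {k n} (v : Fin (suc k) → 𝔽₂^ n) →
                   LinearlyIndependent v → LinearlyIndependent (v ∘ suc)
independent-tail v indep a eq i =
  indep (λ { zero → false ; (suc j) → a j })
    (trans (cong₂ _⊕_ (false• (v zero)) eq) (⊕-identityˡ 𝟎)) (suc i)

-- Quotients, hyperplanes and kernels in coordinates

record LineQuotient {h} (w : 𝔽₂^ h) : Set where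
  field
    {h-1}   : ℕ
    dim     : h ≡ suc h-1
    map     : 𝔽₂^ h → 𝔽₂^ h-1
    map-⊕   : Additive map
    onto    : ∀ y → ∃[ x ] map x ≡ y
    map-w   : map w ≡ 𝟎
    kernel  : ∀ x → map x ≡ 𝟎 → ∃[ b ] x ≡ b • w

-- Elimination with the first nonzero coordinate of `w` as pivot: adding a multiple of `w` clears
-- the pivot, which is then dropped, and the coordinates before it are kept.
lineQuotient : ∀ {h} (w : 𝔽₂^ h) → w ≢ 𝟎 → LineQuotient w
lineQuotient []          w≢𝟎 = contradiction refl w≢𝟎
lineQuotient (true ∷ w)  w≢𝟎 = record
  { dim    = refl
  ; map    = λ x → tail x ⊕ head x • w
  ; map-⊕  = λ { (a ∷ x) (b ∷ y) → trans
      (cong ((x ⊕ y) ⊕_) (xor-• a b w))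
      (⊕-interchange x y (a • w) (b • w)) }
  ; onto   = λ y → false ∷ y , trans (cong (y ⊕_) (false• w)) (⊕-identityʳ y)
  ; map-w  = trans (cong (w ⊕_) (true• w)) (⊕-same w)
  ; kernel = λ { (a ∷ x) eq → a , cong₂ _∷_ (sym (Bool.∧-identityʳ a)) (⊕≡𝟎⇒≡ x (a • w) eq) }
  }
lineQuotient (false ∷ w) w≢𝟎 with lineQuotient w (w≢𝟎 ∘ cong (false ∷_))
... | record { dim = refl ; map = P ; map-⊕ = P-⊕ ; onto = onto ; map-w = P-w ; kernel = ker } = record
  { dim    = refl
  ; map    = λ x → head x ∷ P (tail x)
  ; map-⊕  = λ { (a ∷ x) (b ∷ y) → cong ((a xor b) ∷_) (P-⊕ x y) }
  ; onto   = λ { (a ∷ y) → a ∷ proj₁ (onto y) , cong (a ∷_) (proj₂ (onto y)) }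
  ; map-w  = cong (false ∷_) P-w
  ; kernel = λ { (a ∷ x) eq → proj₁ (ker x (Vec.∷-injectiveʳ eq)) ,
      cong₂ _∷_ (trans (Vec.∷-injectiveˡ eq) (sym (Bool.∧-zeroʳ _)))
        (proj₂ (ker x (Vec.∷-injectiveʳ eq))) }
  }

record ParityCheck {k n} (v : Fin k → 𝔽₂^ n) : Set where
  field
    {h}    : ℕ
    dim    : k ℕ.+ h ≡ n
    map    : 𝔽₂^ n → 𝔽₂^ h
    map-⊕  : Additive map
    onto   : ∀ y → ∃[ x ] map x ≡ y
    map-v  : ∀ i → map (v i) ≡ 𝟎
    kernel : ∀ x → map x ≡ 𝟎 → ∃[ a ] combination a v ≡ x

-- Starting from the identity, each further basis vector is killed by a quotient by the line through
-- its image. Independence makes that image nonzero, so every vector costs exactly one dimension.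
parityCheck : ∀ {k n} (v : Fin k → 𝔽₂^ n) → LinearlyIndependent v → ParityCheck v
parityCheck {zero} v indep = record
  { dim    = refl
  ; map    = id
  ; map-⊕  = λ _ _ → refl
  ; onto   = λ y → y , refl
  ; map-v  = λ ()
  ; kernel = λ x x≡𝟎 → (λ ()) , sym x≡𝟎
  }
parityCheck {suc k} v indep
  with record { map = H ; map-⊕ = H-⊕ ; onto = H-onto ; map-v = H-v ; kernel = H-ker ; dim = H-dim }
       ← parityCheck (v ∘ suc) (independent-tail v indep)
  with H (v zero) ≟ 𝟎
-- If `H` killed `v zero`, that vector would be a combination of the others, and the relation with
-- leading coefficient `true` would contradict independence.
... | yes Hv₀≡𝟎 = contradiction
  (indep (λ { zero → true ; (suc j) → a j })
    (trans (cong₂ _⊕_ (true• (v zero)) eq) (⊕-same (v zero))) zero) λ ()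
  where
  a = proj₁ (H-ker (v zero) Hv₀≡𝟎)
  eq : combination a (v ∘ suc) ≡ v zero
  eq = proj₂ (H-ker (v zero) Hv₀≡𝟎)
... | no Hv₀≢𝟎
  with record { dim = refl ; map = P ; map-⊕ = P-⊕ ; onto = P-onto ; map-w = P-w ; kernel = P-ker }
       ← lineQuotient (H (v zero)) Hv₀≢𝟎 = record
  { dim    = trans (sym (ℕ.+-suc k _)) H-dim
  ; map    = P ∘ H
  ; map-⊕  = λ x y → trans (cong P (H-⊕ x y)) (P-⊕ (H x) (H y))
  ; onto   = λ y → let z , Pz≡y = P-onto y ; x , Hx≡z = H-onto z in
      x , trans (cong P Hx≡z) Pz≡y
  ; map-v  = λ { zero    → P-w
               ; (suc i) → trans (cong P (H-v i)) (additive-𝟎 P-⊕) }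
  ; kernel = λ x PHx≡𝟎 →
      let
        b , Hx≡b•Hv₀ = P-ker (H x) PHx≡𝟎
        -- `H x` is a multiple of `H (v zero)`; the same multiple of `v zero` moves `x` into the
        -- kernel of `H`.
        a , eq = H-ker (b • v zero ⊕ x) (begin
          H (b • v zero ⊕ x)         ≡⟨ H-⊕ (b • v zero) x ⟩
          H (b • v zero) ⊕ H x       ≡⟨ cong₂ _⊕_ (additive-• H-⊕ b (v zero)) Hx≡b•Hv₀ ⟩
          b • H (v zero) ⊕ b • H (v zero)  ≡⟨ ⊕-same _ ⟩
          𝟎                          ∎)
      in (λ { zero → b ; (suc j) → a j }) ,
        trans (cong (b • v zero ⊕_) eq) (⊕-cancelˡ (b • v zero) x)
  }
  where open ≡-Reasoning

record Hyperplane {n} (φ : 𝔽₂^ n → Bool) : Set where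
  field
    {n-1}     : ℕ
    dim       : n ≡ suc n-1
    map       : 𝔽₂^ n-1 → 𝔽₂^ n
    map-⊕     : Additive map
    injective : ∀ x → map x ≡ 𝟎 → x ≡ 𝟎
    φ-map     : ∀ x → φ (map x) ≡ false
    kernel    : ∀ y → φ y ≡ false → ∃[ x ] map x ≡ y

form-∷ : ∀ {n} (φ : 𝔽₂^ (suc n) → Bool) → AdditiveForm φ →
         ∀ b y → φ (b ∷ y) ≡ (b ∧ φ (unit zero)) xor φ (false ∷ y)
form-∷ φ φ-⊕ false y = refl
form-∷ φ φ-⊕ true y = trans (cong (φ ∘ (true ∷_)) (sym (⊕-identityˡ y)))
  (φ-⊕ (unit zero) (false ∷ y))

-- If `φ` is true on the first unit vector, the equation `φ = 0` solves for the first coordinate in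
-- terms of the others. Otherwise `φ` ignores that coordinate, and the witness of nonvanishing
-- passes to the tail.
hyperplane : ∀ {n} (φ : 𝔽₂^ n → Bool) → AdditiveForm φ → ∃[ x ] φ x ≡ true → Hyperplane φ
hyperplane {zero}  φ φ-⊕ ([] , φ≡true) =
  contradiction (trans (sym φ≡true) (additiveForm-𝟎 φ φ-⊕)) λ ()
hyperplane {suc n} φ φ-⊕ (b₀ ∷ z₀ , φ≡true) = split (φ (unit zero)) (form-∷ φ φ-⊕)
  where
  split : ∀ c → (∀ b y → φ (b ∷ y) ≡ (b ∧ c) xor φ (false ∷ y)) → Hyperplane φ
  split true φ-∷ = record
    { dim       = refl
    ; map       = λ y → φ (false ∷ y) ∷ y
    ; map-⊕     = λ x y → cong (_∷ x ⊕ y) (φ-⊕ (false ∷ x) (false ∷ y))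
    ; injective = λ x eq → Vec.∷-injectiveʳ eq
    ; φ-map     = λ y → trans (φ-∷′ (φ (false ∷ y)) y) (Bool.xor-same (φ (false ∷ y)))
    ; kernel    = λ { (b ∷ y) φ≡false → y ,
        cong (_∷ y) (sym (xor-false b _ (trans (sym (φ-∷′ b y)) φ≡false))) }
    }
    where
    xor-false : ∀ a b → a xor b ≡ false → a ≡ b
    xor-false true  true  _ = refl
    xor-false false b     e = sym e
    φ-∷′ : ∀ b y → φ (b ∷ y) ≡ b xor φ (false ∷ y)
    φ-∷′ b y = trans (φ-∷ b y) (cong (_xor φ (false ∷ y)) (Bool.∧-identityʳ b))
  split false φ-∷ = lift (hyperplane (φ ∘ (false ∷_)) (λ x y → φ-⊕ (false ∷ x) (false ∷ y))
                           (z₀ , trans (sym (φ-∷′ b₀ z₀)) φ≡true))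
    where
    φ-∷′ : ∀ b y → φ (b ∷ y) ≡ φ (false ∷ y)
    φ-∷′ b y = trans (φ-∷ b y) (cong (_xor φ (false ∷ y)) (Bool.∧-zeroʳ b))
    lift : Hyperplane (φ ∘ (false ∷_)) → Hyperplane φ
    lift record { dim = refl ; map = J ; map-⊕ = J-⊕ ; injective = J-inj
                ; φ-map = φ-J ; kernel = J-ker } = record
      { dim       = refl
      ; map       = λ y → head y ∷ J (tail y)
      ; map-⊕     = λ { (a ∷ x) (b ∷ y) → cong ((a xor b) ∷_) (J-⊕ x y) }
      ; injective = λ { (a ∷ x) eq →
          cong₂ _∷_ (Vec.∷-injectiveˡ eq) (J-inj x (Vec.∷-injectiveʳ eq)) }
      ; φ-map     = λ { (a ∷ x) → trans (φ-∷′ a (J x)) (φ-J x) }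
      ; kernel    = λ { (a ∷ y) φ≡false →
          let x , Jx≡y = J-ker y (trans (sym (φ-∷′ a y)) φ≡false)
          in a ∷ x , cong (a ∷_) Jx≡y }
      }

record Kernel {n h} (L : 𝔽₂^ n → 𝔽₂^ h) : Set where
  field
    {k}       : ℕ
    dim       : k ℕ.+ h ≡ n
    map       : 𝔽₂^ k → 𝔽₂^ n
    map-⊕     : Additive map
    injective : ∀ x → map x ≡ 𝟎 → x ≡ 𝟎
    L-map     : ∀ x → L (map x) ≡ 𝟎
    kernel    : ∀ y → L y ≡ 𝟎 → ∃[ x ] map x ≡ y

-- The coordinates of `L` are imposed one at a time. Surjectivity keeps each of them nonzero on the
-- subspace cut out so far, which gives `k + h = n` without a separate notion of rank.
kernel-of-surjection : ∀ {n} h (L : 𝔽₂^ n → 𝔽₂^ h) → Additive L →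
                       (∀ y → ∃[ x ] L x ≡ y) → Kernel L
kernel-of-surjection {n} zero L L-⊕ onto = record
  { dim       = ℕ.+-identityʳ n
  ; map       = id
  ; map-⊕     = λ _ _ → refl
  ; injective = λ _ → id
  ; L-map     = λ x → empty (L x)
  ; kernel    = λ y _ → y , refl
  }
  where
  empty : ∀ (x : 𝔽₂^ 0) → x ≡ 𝟎
  empty [] = refl
kernel-of-surjection (suc h) L L-⊕ onto = lift
  (hyperplane (head ∘ L) (λ x y → trans (cong head (L-⊕ x y)) (head-⊕ (L x) (L y)))
    (proj₁ (onto (true ∷ 𝟎)) , cong head (proj₂ (onto (true ∷ 𝟎)))))
  where
  head-⊕ : ∀ {n} (x y : 𝔽₂^ (suc n)) → head (x ⊕ y) ≡ head x xor head y
  head-⊕ (a ∷ x) (b ∷ y) = refl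
  tail-⊕ : ∀ {n} (x y : 𝔽₂^ (suc n)) → tail (x ⊕ y) ≡ tail x ⊕ tail y
  tail-⊕ (a ∷ x) (b ∷ y) = refl
  ∷-η : ∀ {n} {a} {x : 𝔽₂^ n} (y : 𝔽₂^ (suc n)) → head y ≡ a → tail y ≡ x → y ≡ a ∷ x
  ∷-η (_ ∷ _) refl refl = refl
  lift : Hyperplane (head ∘ L) → Kernel L
  lift record { dim = refl ; map = J ; map-⊕ = J-⊕ ; injective = J-inj
              ; φ-map = φ-J ; kernel = J-ker }
    with kernel-of-surjection h (tail ∘ L ∘ J)
           (λ x y → trans (cong tail (trans (cong L (J-⊕ x y)) (L-⊕ (J x) (J y)))) (tail-⊕ (L (J x)) (L (J y))))
           -- The remaining coordinates stay onto on the hyperplane: a preimage of `false ∷ y` lies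
           -- in it.
           (λ y → let x , Lx≡ = onto (false ∷ y) ; x′ , Jx′≡x = J-ker x (cong head Lx≡)
                  in x′ , trans (cong (tail ∘ L) Jx′≡x) (cong tail Lx≡))
  ... | record { k = k ; dim = dim ; map = K ; map-⊕ = K-⊕ ; injective = K-inj
               ; L-map = L-K ; kernel = K-ker } = record
    { dim       = trans (ℕ.+-suc k h) (cong suc dim)
    ; map       = J ∘ K
    ; map-⊕     = λ x y → trans (cong J (K-⊕ x y)) (J-⊕ (K x) (K y))
    ; injective = λ x JKx≡𝟎 → K-inj x (J-inj (K x) JKx≡𝟎)
    ; L-map     = λ x → ∷-η (L (J (K x))) (φ-J (K x)) (L-K x)
    ; kernel    = λ y Ly≡𝟎 →
        let x , Jx≡y = J-ker y (cong head Ly≡𝟎)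
            z , Kz≡x = K-ker x (cong tail (trans (cong L Jx≡y) Ly≡𝟎))
        in z , trans (cong J Kz≡x) Jx≡y
    }

-- The dot product and the transpose

dot-𝟎ʳ : ∀ {n} (α : 𝔽₂^ n) → dot α 𝟎 ≡ false
dot-𝟎ʳ []       = refl
dot-𝟎ʳ (a ∷ α) = cong₂ _xor_ (Bool.∧-zeroʳ a) (dot-𝟎ʳ α)

dot-⊕ʳ : ∀ {n} (α : 𝔽₂^ n) → AdditiveForm (dot α)
dot-⊕ʳ []       []       []       = refl
dot-⊕ʳ (a ∷ α) (b ∷ x) (c ∷ y) = trans
  (cong₂ _xor_ (Bool.∧-distribˡ-xor a b c) (dot-⊕ʳ α x y))
  (xor-interchange (a ∧ b) (a ∧ c) (dot α x) (dot α y))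

dot-•ʳ : ∀ {n} (α : 𝔽₂^ n) b x → dot α (b • x) ≡ b ∧ dot α x
dot-•ʳ α true  x = cong (dot α) (true• x)
dot-•ʳ α false x = trans (cong (dot α) (false• x)) (dot-𝟎ʳ α)

transpose : ∀ {n h} → (Fin n → 𝔽₂^ h) → 𝔽₂^ h → 𝔽₂^ n
transpose S β = tabulate (λ i → dot β (S i))

-- Adjointness. It places every `transpose S β` in the dual of the kernel of `S`, and turns a test
-- of `x` into a character of its syndrome.
dot-transpose : ∀ {n h} (S : Fin n → 𝔽₂^ h) β x →
                dot (transpose S β) x ≡ dot β (syndrome S x)
dot-transpose S β []       = sym (dot-𝟎ʳ β)
dot-transpose S β (b ∷ x) = begin
  (dot β (S zero) ∧ b) xor dot (transpose (S ∘ suc) β) x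
    ≡⟨ cong₂ _xor_ (Bool.∧-comm _ b) (dot-transpose (S ∘ suc) β x) ⟩
  (b ∧ dot β (S zero)) xor dot β (syndrome (S ∘ suc) x)
    ≡⟨ cong (_xor _) (dot-•ʳ β b (S zero)) ⟨
  dot β (b • S zero) xor dot β (syndrome (S ∘ suc) x)
    ≡⟨ dot-⊕ʳ β (b • S zero) _ ⟨
  dot β (syndrome S (b ∷ x)) ∎
  where open ≡-Reasoning

dot-combination : ∀ {k n} (α : 𝔽₂^ n) a (v : Fin k → 𝔽₂^ n) →
  (∀ i → dot α (v i) ≡ false) → dot α (combination a v) ≡ false
dot-combination {zero}  α a v orth = dot-𝟎ʳ α
dot-combination {suc k} α a v orth = trans (dot-⊕ʳ α (a zero • v zero) _)
  (cong₂ _xor_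
    (trans (dot-•ʳ α (a zero) (v zero)) (trans (cong (a zero ∧_) (orth zero)) (Bool.∧-zeroʳ (a zero))))
    (dot-combination α (a ∘ suc) (v ∘ suc) (orth ∘ suc)))

-- Hamming weight, unit vectors and supports

weight-𝟎 : ∀ n → weight (𝟎 {n}) ≡ 0
weight-𝟎 zero    = refl
weight-𝟎 (suc n) = weight-𝟎 n

weight≡0⇒𝟎 : ∀ {n} (x : 𝔽₂^ n) → weight x ≡ 0 → x ≡ 𝟎
weight≡0⇒𝟎 []           _  = refl
weight≡0⇒𝟎 (false ∷ x) eq = cong (false ∷_) (weight≡0⇒𝟎 x eq)

weight-unit-⊕ : ∀ {n} (i : Fin n) x → weight (unit i ⊕ x) ℕ.≤ suc (weight x)
weight-unit-⊕ zero    (true ∷ x)  = ℕ.≤-trans (ℕ.≤-reflexive (cong weight (⊕-identityˡ x)))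
  (ℕ.m≤n+m _ 2)
weight-unit-⊕ zero    (false ∷ x) = ℕ.s≤s (ℕ.≤-reflexive (cong weight (⊕-identityˡ x)))
weight-unit-⊕ (suc i) (true ∷ x)  = ℕ.s≤s (weight-unit-⊕ i x)
weight-unit-⊕ (suc i) (false ∷ x) = weight-unit-⊕ i x

weight-unit : ∀ {n} (i : Fin n) → weight (unit i) ≡ 1
weight-unit {suc n} zero = cong suc (weight-𝟎 n)
weight-unit (suc i) = weight-unit i

weight-combination-units : ∀ {m n} (ι : Fin m → Fin n) a →
                           weight (combination a (unit ∘ ι)) ℕ.≤ m
weight-combination-units {zero} {n} ι a = ℕ.≤-reflexive (weight-𝟎 n)
weight-combination-units {suc m} ι a with a zero
... | true  = ℕ.≤-trans
  (ℕ.≤-reflexive (cong (λ t → weight (t ⊕ combination (a ∘ suc) (unit ∘ ι ∘ suc))) (true• (unit (ι zero)))))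
  (ℕ.≤-trans (weight-unit-⊕ (ι zero) _) (ℕ.s≤s (weight-combination-units (ι ∘ suc) (a ∘ suc))))
... | false = ℕ.≤-trans (ℕ.≤-reflexive (cong weight (trans
    (cong (_⊕ combination (a ∘ suc) (unit ∘ ι ∘ suc)) (false• (unit (ι zero)))) (⊕-identityˡ _))))
  (ℕ.m≤n⇒m≤1+n (weight-combination-units (ι ∘ suc) (a ∘ suc)))

lookup-unit-≢ : ∀ {n} (i j : Fin n) → i ≢ j → lookup (unit i) j ≡ false
lookup-unit-≢ zero    zero    i≢j = contradiction refl i≢j
lookup-unit-≢ zero    (suc j) i≢j = Vec.lookup-replicate j false
lookup-unit-≢ (suc i) zero    i≢j = refl
lookup-unit-≢ (suc i) (suc j) i≢j = lookup-unit-≢ i j (i≢j ∘ cong suc)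

lookup-unit-≡ : ∀ {n} (i : Fin n) → lookup (unit i) i ≡ true
lookup-unit-≡ zero    = refl
lookup-unit-≡ (suc i) = lookup-unit-≡ i

lookup-•-⊕ : ∀ {n} a (x y : 𝔽₂^ n) i →
             lookup (a • x ⊕ y) i ≡ (a ∧ lookup x i) xor lookup y i
lookup-•-⊕ a x y i = trans (Vec.lookup-zipWith _xor_ i (a • x) y)
  (cong (_xor lookup y i) (Vec.lookup-map i (a ∧_) x))

lookup-combination-units-∉ : ∀ {m n} (ι : Fin m → Fin n) a i → (∀ j → ι j ≢ i) →
                             lookup (combination a (unit ∘ ι)) i ≡ false
lookup-combination-units-∉ {zero}  ι a i i∉ = Vec.lookup-replicate i false
lookup-combination-units-∉ {suc m} ι a i i∉ = trans (lookup-•-⊕ (a zero) (unit (ι zero)) _ i)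
  (cong₂ _xor_
    (trans (cong (a zero ∧_) (lookup-unit-≢ (ι zero) i (i∉ zero))) (Bool.∧-zeroʳ (a zero)))
    (lookup-combination-units-∉ (ι ∘ suc) (a ∘ suc) i (i∉ ∘ suc)))

lookup-combination-units : ∀ {m n} (ι : Fin m → Fin n) → Injective _≡_ _≡_ ι → ∀ a j →
                           lookup (combination a (unit ∘ ι)) (ι j) ≡ a j
lookup-combination-units {suc m} ι ι-inj a zero = begin
  lookup (combination a (unit ∘ ι)) (ι zero)
    ≡⟨ lookup-•-⊕ (a zero) (unit (ι zero)) _ (ι zero) ⟩
  (a zero ∧ lookup (unit (ι zero)) (ι zero)) xor
    lookup (combination (a ∘ suc) (unit ∘ ι ∘ suc)) (ι zero)
    ≡⟨ cong₂ _xor_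
         (trans (cong (a zero ∧_) (lookup-unit-≡ (ι zero))) (Bool.∧-identityʳ (a zero)))
         (lookup-combination-units-∉ (ι ∘ suc) (a ∘ suc) (ι zero) λ j eq → Fin.0≢1+n (sym (ι-inj eq))) ⟩
  a zero xor false  ≡⟨ Bool.xor-identityʳ (a zero) ⟩
  a zero            ∎
  where open ≡-Reasoning
lookup-combination-units {suc m} ι ι-inj a (suc j) = begin
  lookup (combination a (unit ∘ ι)) (ι (suc j))
    ≡⟨ lookup-•-⊕ (a zero) (unit (ι zero)) _ (ι (suc j)) ⟩
  (a zero ∧ lookup (unit (ι zero)) (ι (suc j))) xor
    lookup (combination (a ∘ suc) (unit ∘ ι ∘ suc)) (ι (suc j))
    ≡⟨ cong₂ _xor_
         (trans (cong (a zero ∧_) (lookup-unit-≢ (ι zero) (ι (suc j)) (λ eq → Fin.0≢1+n (ι-inj eq))))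
           (Bool.∧-zeroʳ (a zero)))
         (lookup-combination-units (ι ∘ suc) (Fin.suc-injective ∘ ι-inj) (a ∘ suc) j) ⟩
  a (suc j)  ∎
  where open ≡-Reasoning

units-independent : ∀ {m n} (ι : Fin m → Fin n) → Injective _≡_ _≡_ ι →
                    LinearlyIndependent (unit ∘ ι)
units-independent ι ι-inj a eq j = trans (sym (lookup-combination-units ι ι-inj a j))
  (trans (cong (λ t → lookup t (ι j)) eq) (Vec.lookup-replicate (ι j) false))

support : ∀ {n} (x : 𝔽₂^ n) → Fin (weight x) → Fin n
support (true ∷ x)  zero    = zero
support (true ∷ x)  (suc i) = suc (support x i)
support (false ∷ x) i       = suc (support x i)

support-injective : ∀ {n} (x : 𝔽₂^ n) → Injective _≡_ _≡_ (support x)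
support-injective (true ∷ x)  {zero}  {zero}  eq = refl
support-injective (true ∷ x)  {suc i} {suc j} eq = cong suc (support-injective x (Fin.suc-injective eq))
support-injective (false ∷ x) eq = support-injective x (Fin.suc-injective eq)

combination-support : ∀ {n h} (S : Fin n → 𝔽₂^ h) x →
                      combination (λ _ → true) (S ∘ support x) ≡ syndrome S x
combination-support S []           = refl
combination-support S (true ∷ x)  = cong (true • S zero ⊕_) (combination-support (S ∘ suc) x)
combination-support S (false ∷ x) = trans (combination-support (S ∘ suc) x)
  (sym (trans (cong (_⊕ syndrome (S ∘ suc) x) (false• (S zero))) (⊕-identityˡ _)))

-- The columns on the support of a codeword sum to zero with all coefficients `true`. If there were
-- fewer than `d` of them, independence would make each coefficient `false`, so the support would be
-- empty.
wiseIndependent⇒distance : ∀ {n h d} (S : Fin n → 𝔽₂^ h) → WiseIndependent d S →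
  ∀ x → syndrome S x ≡ 𝟎 → x ≢ 𝟎 → d ℕ.≤ weight x
wiseIndependent⇒distance S indep x σx≡𝟎 x≢𝟎 = ℕ.≮⇒≥ λ wx<d → x≢𝟎 (weight≡0⇒𝟎 x
  (no-elements (indep (weight x) (support x) (support-injective x) wx<d (λ _ → true)
    (trans (combination-support S x) σx≡𝟎))))
  where
  no-elements : ∀ {m} → (Fin m → true ≡ false) → m ≡ 0
  no-elements {zero}  _ = refl
  no-elements {suc m} f = contradiction (f zero) λ ()

-- A relation among `m` columns is a vector of weight at most `m` in the kernel. For `m < d` it must
-- vanish, and distinct unit vectors admit no nontrivial relation.
distance⇒wiseIndependent : ∀ {n h d} (H : 𝔽₂^ n → 𝔽₂^ h) → Additive H →
  (∀ x → H x ≡ 𝟎 → x ≢ 𝟎 → d ℕ.≤ weight x) → WiseIndependent d (H ∘ unit)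
distance⇒wiseIndependent H H-⊕ dist m ι ι-inj m<d a eq
  with combination a (unit ∘ ι) ≟ 𝟎
... | yes x≡𝟎 = units-independent ι ι-inj a x≡𝟎
... | no  x≢𝟎 = contradiction
  (ℕ.≤-trans (dist _ (trans (additive-combination H-⊕ a (unit ∘ ι)) eq) x≢𝟎)
    (weight-combination-units ι a))
  (ℕ.<⇒≱ m<d)

-- Walks in Cayley graphs and coset leaders

module _ {n h : ℕ} (S : Fin n → 𝔽₂^ h) where

  -- Every step adds the unit vector of its generator. A generator used twice cancels, so the weight
  -- can fall below the length.
  walk⇒vector : ∀ {x y ℓ} → Walk (Cay h S) x y ℓ →
                ∃[ a ] syndrome S a ≡ x ⊕ y × weight a ℕ.≤ ℓ
  walk⇒vector {x} nil = 𝟎 , trans (additive-𝟎 (syndrome-⊕ S)) (sym (⊕-same x)) ,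
    ℕ.≤-reflexive (weight-𝟎 n)
  walk⇒vector {x} {z} (cons {y = y} (i , y≡x⊕Si) w) with walk⇒vector w
  ... | a , σa≡y⊕z , wa≤ℓ = unit i ⊕ a , (begin
    syndrome S (unit i ⊕ a)           ≡⟨ syndrome-⊕ S (unit i) a ⟩
    syndrome S (unit i) ⊕ syndrome S a ≡⟨ cong₂ _⊕_ (syndrome-at-unit S i) σa≡y⊕z ⟩
    S i ⊕ (y ⊕ z)                     ≡⟨ ⊕-assoc (S i) y z ⟨
    (S i ⊕ y) ⊕ z                     ≡⟨ cong (λ t → (S i ⊕ t) ⊕ z) (trans y≡x⊕Si (⊕-comm x (S i))) ⟩
    (S i ⊕ (S i ⊕ x)) ⊕ z             ≡⟨ cong (_⊕ z) (⊕-cancelˡ (S i) x) ⟩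
    x ⊕ z                             ∎) ,
    ℕ.≤-trans (weight-unit-⊕ i a) (ℕ.s≤s wa≤ℓ)
    where open ≡-Reasoning

  -- The reindexing `ι` serves the recursion: the tail of `a` selects from fewer generators, while
  -- the graph remains that of all of `S`.
  walk-along : ∀ {m} (ι : Fin m → Fin n) a x →
               Walk (Cay h S) x (x ⊕ syndrome (S ∘ ι) a) (weight a)
  walk-along ι []           x = subst (λ y → Walk (Cay h S) x y 0) (sym (⊕-identityʳ x)) nil
  walk-along ι (true ∷ a)  x = cons (ι zero , refl)
    (subst (λ y → Walk (Cay h S) (x ⊕ S (ι zero)) y (weight a))
      (trans (⊕-assoc x (S (ι zero)) _)
        (cong (λ t → x ⊕ (t ⊕ syndrome (S ∘ ι ∘ suc) a)) (sym (true• (S (ι zero))))))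
      (walk-along (ι ∘ suc) a (x ⊕ S (ι zero))))
  walk-along ι (false ∷ a) x = subst (λ y → Walk (Cay h S) x y (weight a))
    (cong (x ⊕_) (sym (trans
      (cong (_⊕ syndrome (S ∘ ι ∘ suc) a) (false• (S (ι zero)))) (⊕-identityˡ _))))
    (walk-along (ι ∘ suc) a x)

  vector⇒walk : ∀ {x y} a → syndrome S a ≡ x ⊕ y → Walk (Cay h S) x y (weight a)
  vector⇒walk {x} {y} a eq = subst (λ z → Walk (Cay h S) x z (weight a))
    (trans (cong (x ⊕_) eq) (⊕-cancelˡ x y)) (walk-along id a x)

∈-allVectors : ∀ {n} (x : 𝔽₂^ n) → x List.∈ allVectors n
∈-allVectors []           = here refl
∈-allVectors (false ∷ x) = ∈-++⁺ˡ (∈-map⁺ (false ∷_) (∈-allVectors x))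
∈-allVectors {suc n} (true ∷ x)  =
  ∈-++⁺ʳ (List.map (false ∷_) (allVectors n)) (∈-map⁺ (true ∷_) (∈-allVectors x))

module _ {n h : ℕ} (H : 𝔽₂^ n → 𝔽₂^ h) (onto : ∀ y → ∃[ x ] H x ≡ y) where

  private
    coset : 𝔽₂^ h → List (𝔽₂^ n)
    coset y = List.filter (λ x → H x ≟ y) (allVectors n)

  -- Exhaustive search over the coset. The default required by `argmin` is a preimage from `onto`,
  -- hence itself in the coset.
  cosetLeader : 𝔽₂^ h → 𝔽₂^ n
  cosetLeader y = Extrema.argmin weight (proj₁ (onto y)) (coset y)

  H-cosetLeader : ∀ y → H (cosetLeader y) ≡ y
  H-cosetLeader y = Extrema.argmin-all weight {xs = coset y} {P = λ x → H x ≡ y} (proj₂ (onto y))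
    (All.all-filter (λ x → H x ≟ y) (allVectors n))

  cosetLeader-minimal : ∀ {y} x → H x ≡ y → weight (cosetLeader y) ℕ.≤ weight x
  cosetLeader-minimal {y} x Hx≡y = All.lookup
    (Extrema.f[argmin]≤f[xs] {f = weight} (proj₁ (onto y)) (coset y))
    (∈-filter⁺ (λ x → H x ≟ y) (∈-allVectors x) Hx≡y)

-- Real numbers

-- The order and equality of ℝ unfold to statements about terms, from which
-- the reals cannot be inferred; hence the explicit implicit arguments.

eventually-map : ∀ {P Q : ℕ → Set} → (∀ {n} → P n → Q n) → Eventually P → Eventually Q
eventually-map f (N , p) = N , λ n n≥ → f (p n n≥)

infixr 4 _⊗_

_⊗_ : ∀ {P Q : ℕ → Set} → Eventually P → Eventually Q → Eventually (λ n → P n × Q n)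
(M , p) ⊗ (N , q) = M ℕ.⊔ N , λ n n≥ →
  p n (ℕ.m⊔n≤o⇒m≤o M N n≥) , q n (ℕ.m⊔n≤o⇒n≤o M N n≥)

p<p+ε : ∀ p {ε} → 0ℚ ℚ.< ε → p ℚ.< p ℚ.+ ε
p<p+ε p {ε} ε>0 = subst (ℚ._< p ℚ.+ ε) (ℚ.+-identityʳ p) (ℚ.+-monoʳ-< p ε>0)

≤-eventually : ∀ {x y} → Eventually (λ n → seq x n ℚ.≤ seq y n) → x ≤ y
≤-eventually {x} {y} p ε ε>0 =
  eventually-map (λ {n} x≤y → ℚ.≤-<-trans x≤y (p<p+ε (seq y n) ε>0)) p

≤-termwise : ∀ {x y} → (∀ n → seq x n ℚ.≤ seq y n) → x ≤ y
≤-termwise {x} {y} p = ≤-eventually {x} {y} (0 , λ n _ → p n)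

≤-refl : ∀ {x} → x ≤ x
≤-refl {x} = ≤-termwise {x} {x} (λ _ → ℚ.≤-refl)

≤-trans : ∀ {x y z} → x ≤ y → y ≤ z → x ≤ z
≤-trans {x} {y} {z} x≤y y≤z ε ε>0 = eventually-map
  (λ {n} (p , q) → ℚ.<-trans p (subst (seq y n ℚ.+ ε ℚ.* ½ ℚ.<_)
    (trans (ℚ.+-assoc (seq z n) _ _) (cong (seq z n ℚ.+_) (halves ε)))
    (ℚ.+-monoˡ-< (ε ℚ.* ½) q)))
  (x≤y (ε ℚ.* ½) (half-pos ε>0) ⊗ y≤z (ε ℚ.* ½) (half-pos ε>0))

<⇒≤ : ∀ {x y} → x < y → x ≤ y
<⇒≤ {x} {y} (η , η>0 , p) = ≤-eventually {x} {y}
  (eventually-map (λ {n} x+η<y → ℚ.<⇒≤ (ℚ.<-trans (p<p+ε (seq x n) η>0) x+η<y)) p)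

p<q+r⇒p-r<q : ∀ {p q r} → p ℚ.< q ℚ.+ r → p ℚ.- r ℚ.< q
p<q+r⇒p-r<q {p} {q} {r} p<q+r = subst (p ℚ.- r ℚ.<_)
  (solve 2 (λ q r → (q :+ r) :- r := q) refl q r) (ℚ.+-monoˡ-< (ℚ.- r) p<q+r)

∣p-q∣<r⇒p<q+r : ∀ {p q r} → ℚ.∣ p ℚ.- q ∣ ℚ.< r → p ℚ.< q ℚ.+ r
∣p-q∣<r⇒p<q+r {p} {q} {r} lt = subst (ℚ._< q ℚ.+ r)
  (solve 2 (λ p q → q :+ (p :- q) := p) refl p q)
  (ℚ.+-monoʳ-< q (ℚ.≤-<-trans (p≤∣p∣ (p ℚ.- q)) lt))

<-≤-trans : ∀ {x y z} → x < y → y ≤ z → x < z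
<-≤-trans {x} {y} {z} (η , η>0 , p) y≤z = η ℚ.* ½ , half-pos η>0 ,
  eventually-map (λ {n} (x+η<y , y<z+) → subst (ℚ._< seq z n)
      (trans (ℚ.+-assoc (seq x n) η _) (cong (seq x n ℚ.+_) (trans
        (cong (ℚ._- η ℚ.* ½) (sym (halves η)))
        (solve 1 (λ t → (t :+ t) :- t := t) refl (η ℚ.* ½)))))
      (ℚ.<-trans (ℚ.+-monoˡ-< (ℚ.- (η ℚ.* ½)) x+η<y) (p<q+r⇒p-r<q y<z+)))
    (p ⊗ y≤z (η ℚ.* ½) (half-pos η>0))

≤-<-trans : ∀ {x y z} → x ≤ y → y < z → x < z
≤-<-trans {x} {y} {z} x≤y (η , η>0 , p) = η ℚ.* ½ , half-pos η>0 ,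
  eventually-map (λ {n} (y+η<z , x<y+) → ℚ.<-trans
      (subst (seq x n ℚ.+ η ℚ.* ½ ℚ.<_)
        (trans (ℚ.+-assoc (seq y n) _ _) (cong (seq y n ℚ.+_) (halves η)))
        (ℚ.+-monoˡ-< (η ℚ.* ½) x<y+))
      y+η<z)
    (p ⊗ x≤y (η ℚ.* ½) (half-pos η>0))

-- One rational comparison decides, at an index beyond which `y - x` varies by less than ε/4. A gap
-- below ε/2 there stays below ε; a gap of at least ε/2 stays above ε/4 and would witness `x < y`.
≮⇒≥ : ∀ {x y} → ¬ (x < y) → y ≤ x
≮⇒≥ {x} {y} x≮y ε ε>0 with cauchy (y - x) (ε ℚ.* ½ ℚ.* ½) (half-pos (half-pos ε>0))
... | N , p with (seq y N ℚ.- seq x N) ℚ.<? ε ℚ.* ½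
... | yes d<ε/2 = N , λ n n≥ → subst₂ ℚ._<_
  (solve 2 (λ x y → x :+ (y :- x) := y) refl (seq x n) (seq y n)) refl
  (ℚ.+-monoʳ-< (seq x n) (ℚ.<-trans (∣p-q∣<r⇒p<q+r (p n N n≥ ℕ.≤-refl))
    (subst (seq y N ℚ.- seq x N ℚ.+ ε ℚ.* ½ ℚ.* ½ ℚ.<_) (halves ε)
      (ℚ.+-mono-< d<ε/2 ε/4<ε/2))))
  where
  ε/4<ε/2 : ε ℚ.* ½ ℚ.* ½ ℚ.< ε ℚ.* ½
  ε/4<ε/2 = subst (ε ℚ.* ½ ℚ.* ½ ℚ.<_) (halves (ε ℚ.* ½)) (p<p+ε _ (half-pos (half-pos ε>0)))
... | no d≮ε/2 = contradiction
  (ε ℚ.* ½ ℚ.* ½ , half-pos (half-pos ε>0) , N , λ n n≥ → subst (seq x n ℚ.+ ε ℚ.* ½ ℚ.* ½ ℚ.<_)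
    (solve 2 (λ x y → x :+ (y :- x) := y) refl (seq x n) (seq y n))
    (ℚ.+-monoʳ-< (seq x n) (ℚ.≤-<-trans
      (subst (ℚ._≤ seq y N ℚ.- seq x N ℚ.- ε ℚ.* ½ ℚ.* ½)
        (trans (cong (ℚ._- ε ℚ.* ½ ℚ.* ½) (sym (halves (ε ℚ.* ½))))
          (solve 1 (λ t → (t :+ t) :- t := t) refl (ε ℚ.* ½ ℚ.* ½)))
        (ℚ.+-monoˡ-≤ (ℚ.- (ε ℚ.* ½ ℚ.* ½)) (ℚ.≮⇒≥ d≮ε/2)))
      (p<q+r⇒p-r<q {seq y N ℚ.- seq x N} {seq y n ℚ.- seq x n} (∣p-q∣<r⇒p<q+r (p N n ℕ.≤-refl n≥))))))
  x≮y

≃-eventually : ∀ {x y} → Eventually (λ n → seq x n ≡ seq y n) → x ≃ y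
≃-eventually {x} {y} p ε ε>0 = eventually-map
  (λ {n} eq → subst (ℚ._< ε) (cong ℚ.∣_∣ (sym (trans (cong (ℚ._- seq y n) eq) (ℚ.+-inverseʳ (seq y n))))) ε>0) p

≃-termwise : ∀ {x y} → (∀ n → seq x n ≡ seq y n) → x ≃ y
≃-termwise {x} {y} p = ≃-eventually {x} {y} (0 , λ n _ → p n)

≃⇒≤ : ∀ {x y} → x ≃ y → x ≤ y
≃⇒≤ x≃y ε ε>0 = eventually-map ∣p-q∣<r⇒p<q+r (x≃y ε ε>0)

≃-sym : ∀ {x y} → x ≃ y → y ≃ x
≃-sym {x} {y} x≃y ε ε>0 = eventually-map
  (λ {n} → subst (ℚ._< ε) (∣p-q∣≡∣q-p∣ (seq x n) (seq y n))) (x≃y ε ε>0)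

≤-antisym : ∀ {x y} → x ≤ y → y ≤ x → x ≃ y
≤-antisym x≤y y≤x ε ε>0 =
  eventually-map (λ (p , q) → ∣p-q∣<r p q) (x≤y ε ε>0 ⊗ y≤x ε ε>0)

≃-trans : ∀ {x y z} → x ≃ y → y ≃ z → x ≃ z
≃-trans {x} {y} {z} p q = ≤-antisym {x} {z}
  (≤-trans {x} {y} {z} (≃⇒≤ {x} {y} p) (≃⇒≤ {y} {z} q))
  (≤-trans {z} {y} {x} (≃⇒≤ {z} {y} (≃-sym {y} {z} q)) (≃⇒≤ {y} {x} (≃-sym {x} {y} p)))

+-mono-≤ : ∀ {x y z w} → x ≤ y → z ≤ w → x + z ≤ y + w
+-mono-≤ {x} {y} {z} {w} x≤y z≤w ε ε>0 = eventually-map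
  (λ {n} (p , q) → subst (seq x n ℚ.+ seq z n ℚ.<_)
    (trans (solve 3 (λ y w e → (y :+ e) :+ (w :+ e) := (y :+ w) :+ (e :+ e)) refl (seq y n) (seq w n) (ε ℚ.* ½))
      (cong ((seq y n ℚ.+ seq w n) ℚ.+_) (halves ε)))
    (ℚ.+-mono-< p q))
  (x≤y (ε ℚ.* ½) (half-pos ε>0) ⊗ z≤w (ε ℚ.* ½) (half-pos ε>0))

eventually-positive : ∀ {x} → 0ℝ < x → Eventually (λ n → 0ℚ ℚ.< seq x n)
eventually-positive (η , η>0 , p) =
  eventually-map (ℚ.<-trans (subst (0ℚ ℚ.<_) (sym (ℚ.+-identityˡ η)) η>0)) p

-- The permitted error is magnified by `z`, so `x ≤ y` is invoked with `ε / B` for an eventual bound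
-- `B` of `z`.
*-monoʳ-≤ : ∀ {x y z} → 0ℝ < z → x ≤ y → z * x ≤ z * y
*-monoʳ-≤ {x} {y} {z} z>0 x≤y ε ε>0 =
  let
    N , B , B>0 , ∣z∣≤B = eventually-bounded z
    η , η>0 , Bη≡ε = scale ε>0 B>0
  in eventually-map
  (λ {n} (z>0 , x<y+η , ∣z∣≤B) → ℚ.<-≤-trans
    (ℚ.*-monoʳ-<-pos (seq z n) {{ℚ.positive z>0}} x<y+η)
    (subst₂ ℚ._≤_ (sym (ℚ.*-distribˡ-+ (seq z n) (seq y n) η)) (cong (seq z n ℚ.* seq y n ℚ.+_) Bη≡ε)
      (ℚ.+-monoʳ-≤ (seq z n ℚ.* seq y n)
        (ℚ.*-monoʳ-≤-nonNeg η {{ℚ.nonNegative (ℚ.<⇒≤ η>0)}} (ℚ.≤-trans (p≤∣p∣ (seq z n)) ∣z∣≤B)))))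
  (eventually-positive {z} z>0 ⊗ x≤y η η>0 ⊗ (N , ∣z∣≤B))

*-congˡ : ∀ {x y z} → 0ℝ < z → x ≃ y → z * x ≃ z * y
*-congˡ {x} {y} {z} z>0 x≃y = ≤-antisym {z * x} {z * y}
  (*-monoʳ-≤ {x} {y} {z} z>0 (≃⇒≤ {x} {y} x≃y))
  (*-monoʳ-≤ {y} {x} {z} z>0 (≃⇒≤ {y} {x} (≃-sym {x} {y} x≃y)))

0<x*y : ∀ {x y} → 0ℝ < x → 0ℝ < y → 0ℝ < x * y
0<x*y {x} {y} (η , η>0 , p) (θ , θ>0 , q) = η ℚ.* θ , *-pos η>0 θ>0 ,
  eventually-map (λ {n} (η<x , θ<y) →
    subst (ℚ._< seq x n ℚ.* seq y n) (sym (ℚ.+-identityˡ (η ℚ.* θ)))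
      (ℚ.<-≤-trans
        (ℚ.*-monoˡ-<-pos θ {{ℚ.positive θ>0}} (subst (ℚ._< seq x n) (ℚ.+-identityˡ η) η<x))
        (ℚ.*-monoˡ-≤-nonNeg (seq x n)
          {{ℚ.nonNegative (ℚ.<⇒≤ (ℚ.<-trans η>0 (subst (ℚ._< seq x n) (ℚ.+-identityˡ η) η<x)))}}
          (ℚ.<⇒≤ (subst (ℚ._< seq y n) (ℚ.+-identityˡ θ) θ<y)))))
    (p ⊗ q)

module _ (x : ℝ) (x>0 : 0ℝ < x) where

  private
    η = proj₁ x>0
    η>0 = proj₁ (proj₂ x>0)
    N = proj₁ (proj₂ (proj₂ x>0))
    η<x = proj₂ (proj₂ (proj₂ x>0))
  open Reciprocal x η η>0 N η<x

  ⁻¹-inverse : Eventually (λ n → seq (x ⁻¹[ x>0 ]) n ℚ.* seq x n ≡ 1ℚ)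
  ⁻¹-inverse = N , λ n n≥ → trans (cong (inv n ℚ.*_) (sym (m≡x n n≥))) (inv-m n)

  0<⁻¹-termwise : ∀ n → 0ℚ ℚ.< seq (x ⁻¹[ x>0 ]) n
  0<⁻¹-termwise n = ℚ.positive⁻¹ _ {{ℚ.1/pos⇒pos (m n) {{ℚ.positive (m>0 n)}}}}

  0<⁻¹ : 0ℝ < x ⁻¹[ x>0 ]
  0<⁻¹ =
    let
      M , B , B>0 , ∣x∣≤B = eventually-bounded x
      -- `θ` is `1 / B`, a lower bound of the reciprocals; the strict gap required by `_<_` is half
      -- of it.
      θ , θ>0 , Bθ≡1 = scale (ℚ.positive⁻¹ 1ℚ) B>0
    in θ ℚ.* ½ , half-pos θ>0 , eventually-map
    (λ {n} (∣x∣≤B , invx≡1) → subst (ℚ._< inv n) (sym (ℚ.+-identityˡ (θ ℚ.* ½)))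
      (ℚ.<-≤-trans (subst (θ ℚ.* ½ ℚ.<_) (halves θ) (p<p+ε (θ ℚ.* ½) (half-pos θ>0)))
        (ℚ.*-cancelʳ-≤-pos B {{ℚ.positive B>0}}
          (ℚ.≤-trans (ℚ.≤-reflexive (trans (ℚ.*-comm θ B) (trans Bθ≡1 (sym invx≡1))))
            (ℚ.*-monoˡ-≤-nonNeg (inv n) {{ℚ.nonNegative (ℚ.<⇒≤ (0<⁻¹-termwise n))}}
              (ℚ.≤-trans (p≤∣p∣ (seq x n)) ∣x∣≤B))))))
    ((M , ∣x∣≤B) ⊗ ⁻¹-inverse)

  *-÷-cancel : ∀ y → (x * y) ÷ x [ x>0 ] ≃ y
  *-÷-cancel y = ≃-eventually {(x * y) ÷ x [ x>0 ]} {y} (eventually-map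
    (λ {n} eq → trans (solve 3 (λ x y i → (x :* y) :* i := (i :* x) :* y) refl (seq x n) (seq y n) (inv n))
      (trans (cong (ℚ._* seq y n) eq) (ℚ.*-identityˡ (seq y n)))) ⁻¹-inverse)

  ÷-*-cancel : ∀ y → x * (y ÷ x [ x>0 ]) ≃ y
  ÷-*-cancel y = ≃-eventually {x * (y ÷ x [ x>0 ])} {y} (eventually-map
    (λ {n} eq → trans (solve 3 (λ x y i → x :* (y :* i) := (i :* x) :* y) refl (seq x n) (seq y n) (inv n))
      (trans (cong (ℚ._* seq y n) eq) (ℚ.*-identityˡ (seq y n)))) ⁻¹-inverse)

*-comm : ∀ x y → x * y ≃ y * x
*-comm x y = ≃-termwise {x * y} {y * x} (λ n → ℚ.*-comm (seq x n) (seq y n))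

÷-mono-≤ : ∀ {x y} z (z>0 : 0ℝ < z) → x ≤ y → x ÷ z [ z>0 ] ≤ y ÷ z [ z>0 ]
÷-mono-≤ {x} {y} z z>0 x≤y = ≤-trans {x * i} {i * x} {y * i} (≃⇒≤ {x * i} {i * x} (*-comm x i))
  (≤-trans {i * x} {i * y} {y * i} (*-monoʳ-≤ {x} {y} {i} (0<⁻¹ z z>0) x≤y) (≃⇒≤ {i * y} {y * i} (*-comm i y)))
  where i = z ⁻¹[ z>0 ]

÷-cong : ∀ {x y} z (z>0 : 0ℝ < z) → x ≃ y → x ÷ z [ z>0 ] ≃ y ÷ z [ z>0 ]
÷-cong {x} {y} z z>0 x≃y = ≤-antisym {x ÷ z [ z>0 ]} {y ÷ z [ z>0 ]}
  (÷-mono-≤ {x} {y} z z>0 (≃⇒≤ {x} {y} x≃y))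
  (÷-mono-≤ {y} {x} z z>0 (≃⇒≤ {y} {x} (≃-sym {x} {y} x≃y)))

÷≤⇒≤* : ∀ {x y z} (z>0 : 0ℝ < z) → x ÷ z [ z>0 ] ≤ y → x ≤ z * y
÷≤⇒≤* {x} {y} {z} z>0 le = ≤-trans {x} {z * (x ÷ z [ z>0 ])} {z * y}
  (≃⇒≤ {x} {z * (x ÷ z [ z>0 ])} (≃-sym {z * (x ÷ z [ z>0 ])} {x} (÷-*-cancel z z>0 x)))
  (*-monoʳ-≤ {x ÷ z [ z>0 ]} {y} {z} z>0 le)

∑ : ∀ {A : Set} → List A → (A → ℝ) → ℝ
∑ xs f = List.foldr _+_ 0ℝ (List.map f xs)

∑-mono-≤ : ∀ {A : Set} (xs : List A) {f g : A → ℝ} → (∀ x → f x ≤ g x) → ∑ xs f ≤ ∑ xs g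
∑-mono-≤ []       f≤g = ≤-refl {0ℝ}
∑-mono-≤ (x ∷ xs) {f} {g} f≤g =
  +-mono-≤ {f x} {g x} {∑ xs f} {∑ xs g} (f≤g x) (∑-mono-≤ xs f≤g)

-- The terms of `x` may be negative. Being eventually above -ε/2, a negative term `p` still
-- satisfies `- p < p + ε`.
0≤x⇒∣x∣≤x : ∀ {x} → 0ℝ ≤ x → ∣ x ∣ ≤ x
0≤x⇒∣x∣≤x {x} 0≤x ε ε>0 = eventually-map (λ {n} 0<x+ → bound (seq x n) 0<x+) (0≤x (ε ℚ.* ½) (half-pos ε>0))
  where
  bound : ∀ p → 0ℚ ℚ.< p ℚ.+ ε ℚ.* ½ → ℚ.∣ p ∣ ℚ.< p ℚ.+ ε
  bound p 0<p+ with ℚ.∣p∣≡p∨∣p∣≡-p p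
  ... | inj₁ eq = subst (ℚ._< p ℚ.+ ε) (sym eq) (p<p+ε p ε>0)
  ... | inj₂ eq = subst₂ ℚ._<_
    (trans (ℚ.+-identityˡ (ℚ.- p)) (sym eq))
    (trans (solve 2 (λ p e → (p :+ e) :+ (p :+ e) :- p := p :+ (e :+ e)) refl p (ε ℚ.* ½))
      (cong (p ℚ.+_) (halves ε)))
    (ℚ.+-monoˡ-< (ℚ.- p) (subst (ℚ._< (p ℚ.+ ε ℚ.* ½) ℚ.+ (p ℚ.+ ε ℚ.* ½))
      (ℚ.+-identityˡ 0ℚ) (ℚ.+-mono-< 0<p+ 0<p+)))

-- Logarithms

/-cancel-< : ∀ i d j e → i ℚ./ suc d ℚ.< j ℚ./ suc e → i ℤ.* + suc e ℤ.< j ℤ.* + suc d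
/-cancel-< i d j e lt with ℚᵘ.<-respˡ-≃ (ℚ.toℚᵘ-fromℚᵘ (ℚᵘ.mkℚᵘ i d))
  (ℚᵘ.<-respʳ-≃ (ℚ.toℚᵘ-fromℚᵘ (ℚᵘ.mkℚᵘ j e)) (ℚ.toℚᵘ-mono-< lt))
... | ℚᵘ.*<* p = p

/-mono-≤ : ∀ i d j e → i ℤ.* + suc e ℤ.≤ j ℤ.* + suc d → i ℚ./ suc d ℚ.≤ j ℚ./ suc e
/-mono-≤ i d j e le = ℚ.toℚᵘ-cancel-≤
  (ℚᵘ.≤-respˡ-≃ (ℚᵘ.≃-sym (ℚ.toℚᵘ-fromℚᵘ (ℚᵘ.mkℚᵘ i d)))
    (ℚᵘ.≤-respʳ-≃ (ℚᵘ.≃-sym (ℚ.toℚᵘ-fromℚᵘ (ℚᵘ.mkℚᵘ j e))) (ℚᵘ.*≤* le)))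

ι : ℕ → ℚ
ι n = + n ℚ./ 1

ι-cancel-< : ∀ m n → ι m ℚ.< ι n → m ℕ.< n
ι-cancel-< m n lt with /-cancel-< (+ m) 0 (+ n) 0 lt
... | p = ℤ.drop‿+<+ (subst₂ ℤ._<_ (ℤ.*-identityʳ (+ m)) (ℤ.*-identityʳ (+ n)) p)

ι-mono-≤ : ∀ {m n} → m ℕ.≤ n → ι m ℚ.≤ ι n
ι-mono-≤ {m} {n} m≤n = /-mono-≤ (+ m) 0 (+ n) 0
  (subst₂ ℤ._≤_ (sym (ℤ.*-identityʳ (+ m))) (sym (ℤ.*-identityʳ (+ n))) (ℤ.+≤+ m≤n))

ι-+ : ∀ m n → ι (m ℕ.+ n) ≡ ι m ℚ.+ ι n
ι-+ m n = ℚ.toℚᵘ-injective (begin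
  ℚ.toℚᵘ (ι (m ℕ.+ n))              ≈⟨ ℚ.toℚᵘ-fromℚᵘ (ℚᵘ.mkℚᵘ (+ (m ℕ.+ n)) 0) ⟩
  ℚᵘ.mkℚᵘ (+ (m ℕ.+ n)) 0           ≈⟨ ℚᵘ.*≡* (solve′ (+ m) (+ n)) ⟩
  ℚᵘ.mkℚᵘ (+ m) 0 ℚᵘ.+ ℚᵘ.mkℚᵘ (+ n) 0
    ≈⟨ ℚᵘ.+-cong (ℚ.toℚᵘ-fromℚᵘ (ℚᵘ.mkℚᵘ (+ m) 0)) (ℚ.toℚᵘ-fromℚᵘ (ℚᵘ.mkℚᵘ (+ n) 0)) ⟨
  ℚ.toℚᵘ (ι m) ℚᵘ.+ ℚ.toℚᵘ (ι n)    ≈⟨ ℚ.toℚᵘ-homo-+ (ι m) (ι n) ⟨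
  ℚ.toℚᵘ (ι m ℚ.+ ι n)              ∎)
  where
  open ℚᵘ.≃-Reasoning
  solve′ : ∀ i j → (i ℤ.+ j) ℤ.* + 1 ≡ (i ℤ.* + 1 ℤ.+ j ℤ.* + 1) ℤ.* + 1
  solve′ = ℤS.solve 2 (λ i j → (i ℤS.:+ j) ℤS.:* ℤS.con (+ 1) ℤS.:=
    (i ℤS.:* ℤS.con (+ 1) ℤS.:+ j ℤS.:* ℤS.con (+ 1)) ℤS.:* ℤS.con (+ 1)) refl
    where module ℤS = ℤSolver.+-*-Solver

1/[1+_] : ℕ → ℚ
1/[1+ n ] = fromℚᵘ (ℚᵘ.mkℚᵘ (+ 1) n)

1/[1+]-antimono : ∀ {m n} → m ℕ.≤ n → 1/[1+ n ] ℚ.≤ 1/[1+ m ]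
1/[1+]-antimono {m} {n} m≤n = /-mono-≤ (+ 1) n (+ 1) m
  (subst₂ ℤ._≤_ (sym (ℤ.*-identityˡ (+ suc m))) (sym (ℤ.*-identityˡ (+ suc n))) (ℤ.+≤+ (ℕ.s≤s m≤n)))

eventually-1/[1+]< : ∀ {ε} → 0ℚ ℚ.< ε → Eventually (λ n → 1/[1+ n ] ℚ.< ε)
eventually-1/[1+]< {ε} ε>0 =
  let N , lt = ℚ-Lemmas.archimedean ε ε>0
  in N , λ n N≤n → ℚ.≤-<-trans (1/[1+]-antimono N≤n) lt

suc/ : ∀ l d → + suc l ℚ./ suc d ≡ + l ℚ./ suc d ℚ.+ 1/[1+ d ]
suc/ l d = ℚ.toℚᵘ-injective (begin
  ℚ.toℚᵘ (+ suc l ℚ./ suc d)                          ≈⟨ ℚ.toℚᵘ-fromℚᵘ (ℚᵘ.mkℚᵘ (+ suc l) d) ⟩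
  ℚᵘ.mkℚᵘ (+ suc l) d                                 ≈⟨ ℚᵘ.*≡* (solve′ (+ l) (+ suc d)) ⟩
  ℚᵘ.mkℚᵘ (+ l) d ℚᵘ.+ ℚᵘ.mkℚᵘ (+ 1) d
    ≈⟨ ℚᵘ.+-cong (ℚ.toℚᵘ-fromℚᵘ (ℚᵘ.mkℚᵘ (+ l) d)) (ℚ.toℚᵘ-fromℚᵘ (ℚᵘ.mkℚᵘ (+ 1) d)) ⟨
  ℚ.toℚᵘ (+ l ℚ./ suc d) ℚᵘ.+ ℚ.toℚᵘ 1/[1+ d ]        ≈⟨ ℚ.toℚᵘ-homo-+ (+ l ℚ./ suc d) 1/[1+ d ] ⟨
  ℚ.toℚᵘ (+ l ℚ./ suc d ℚ.+ 1/[1+ d ])                ∎)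
  where
  open ℚᵘ.≃-Reasoning
  solve′ : ∀ i d → (+ 1 ℤ.+ i) ℤ.* (d ℤ.* d) ≡ (i ℤ.* d ℤ.+ + 1 ℤ.* d) ℤ.* d
  solve′ = ℤS.solve 2 (λ i d → (ℤS.con (+ 1) ℤS.:+ i) ℤS.:* (d ℤS.:* d) ℤS.:=
    (i ℤS.:* d ℤS.:+ ℤS.con (+ 1) ℤS.:* d) ℤS.:* d) refl
    where module ℤS = ℤSolver.+-*-Solver

-- A sequence is eventually close to one of its own terms, so a common bound on the terms bounds the
-- limit.
terms-≤⇒≤ : ∀ x y → (∀ j → fromℚ (seq y j) ≤ x) → y ≤ x
terms-≤⇒≤ x y y≤x ε ε>0 =
  let N , close = cauchy y (ε ℚ.* ½) (half-pos ε>0)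
  in eventually-map (λ {m} (N≤m , lt) → ℚ.<-trans
      (∣p-q∣<r⇒p<q+r (close m N N≤m ℕ.≤-refl))
      (subst (seq y N ℚ.+ ε ℚ.* ½ ℚ.<_)
        (trans (ℚ.+-assoc (seq x m) (ε ℚ.* ½) (ε ℚ.* ½)) (cong (seq x m ℚ.+_) (halves ε)))
        (ℚ.+-monoˡ-< (ε ℚ.* ½) lt)))
    ((N , λ _ → id) ⊗ y≤x N (ε ℚ.* ½) (half-pos ε>0))

terms-+1/[1+]-≥⇒≥ : ∀ x y → (∀ j → x ≤ fromℚ (seq y j ℚ.+ 1/[1+ j ])) → x ≤ y
terms-+1/[1+]-≥⇒≥ x y x≤y ε ε>0 =
  let
    -- A quarter of `ε` pays for replacing term `J` of `y` by later terms, a quarter for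
    -- `1/[1+ J ]`, and the remaining half for the hypothesis at `J`.
    ε/4 = ε ℚ.* ½ ℚ.* ½
    ε/4>0 = half-pos (half-pos ε>0)
    M , close = cauchy y ε/4 ε/4>0
    N , 1/j< = eventually-1/[1+]< ε/4>0
    J = M ℕ.⊔ N
  in eventually-map (λ {m} (J≤m , lt) → ℚ.<-trans lt
      (subst ((seq y J ℚ.+ 1/[1+ J ]) ℚ.+ ε ℚ.* ½ ℚ.<_)
        (trans (cong (ℚ._+ ε ℚ.* ½)
            (trans (ℚ.+-assoc (seq y m) ε/4 ε/4) (cong (seq y m ℚ.+_) (halves (ε ℚ.* ½)))))
          (trans (ℚ.+-assoc (seq y m) (ε ℚ.* ½) (ε ℚ.* ½)) (cong (seq y m ℚ.+_) (halves ε))))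
        (ℚ.+-monoˡ-< (ε ℚ.* ½) (ℚ.+-mono-<
          (∣p-q∣<r⇒p<q+r {seq y J} {seq y m} (close J m (ℕ.m≤m⊔n M N) (ℕ.≤-trans (ℕ.m≤m⊔n M N) J≤m)))
          (1/j< J (ℕ.m≤n⊔m M N))))))
    ((J , λ _ → id) ⊗ x≤y J (ε ℚ.* ½) (half-pos ε>0))

⊖-*+ : ∀ a b k → + (b ℕ.* k) ℤ.+ (a ⊖ b) ℤ.* + k ≡ + (a ℕ.* k)
⊖-*+ a b k = trans
  (cong₂ ℤ._+_ (ℤ.pos-* b k) (cong (ℤ._* + k) (sym (ℤ.m-n≡m⊖n a b))))
  (trans (solve′ (+ a) (+ b) (+ k)) (sym (ℤ.pos-* a k)))
  where
  solve′ : ∀ a b k → b ℤ.* k ℤ.+ (a ℤ.- b) ℤ.* k ≡ a ℤ.* k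
  solve′ = ℤS.solve 3 (λ a b k → b ℤS.:* k ℤS.:+ (a ℤS.:- b) ℤS.:* k ℤS.:= a ℤS.:* k) refl
    where module ℤS = ℤSolver.+-*-Solver

⊖-*-< : ∀ a b k m → (a ⊖ b) ℤ.* + k ℤ.< + m → a ℕ.* k ℕ.< b ℕ.* k ℕ.+ m
⊖-*-< a b k m lt = ℤ.drop‿+<+ (subst (ℤ._< _) (⊖-*+ a b k) (ℤ.+-monoʳ-< (+ (b ℕ.* k)) lt))

<-⊖-* : ∀ a b k m → + m ℤ.< (a ⊖ b) ℤ.* + k → b ℕ.* k ℕ.+ m ℕ.< a ℕ.* k
<-⊖-* a b k m lt = ℤ.drop‿+<+ (subst (_ ℤ.<_) (⊖-*+ a b k) (ℤ.+-monoʳ-< (+ (b ℕ.* k)) lt))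

^-distribʳ-* : ∀ k m n → (m ℕ.* n) ℕ.^ k ≡ m ℕ.^ k ℕ.* n ℕ.^ k
^-distribʳ-* zero    m n = refl
^-distribʳ-* (suc k) m n = trans (cong (m ℕ.* n ℕ.*_) (^-distribʳ-* k m n))
  (ℕ.[m*n]*[o*p]≡[m*o]*[n*p] m n (m ℕ.^ k) (n ℕ.^ k))

module _ (n : ℕ) .{{_ : ℕ.NonZero n}} where

  open Log₂ using (L; approx)

  2^L≤ : ∀ j → 2 ℕ.^ L n j ℕ.≤ n ℕ.^ suc j
  2^L≤ j = subst (λ t → 2 ℕ.^ ⌊log₂ t ⌋ ℕ.≤ t)
    (ℕ.suc-pred (n ℕ.^ suc j) {{ℕ.m^n≢0 n (suc j)}}) (Log₂.2^⌊log₂n⌋≤n _ _ refl)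

  <2^1+L : ∀ j → n ℕ.^ suc j ℕ.< 2 ℕ.^ suc (L n j)
  <2^1+L j = Log₂.n<2^1+⌊log₂n⌋ (n ℕ.^ suc j)

  private
    power : ∀ b q j l → 2 ℕ.^ (b ℕ.* suc j ℕ.+ l ℕ.* q) ≡ (2 ℕ.^ b) ℕ.^ suc j ℕ.* (2 ℕ.^ l) ℕ.^ q
    power b q j l = trans (ℕ.^-distribˡ-+-* 2 (b ℕ.* suc j) (l ℕ.* q))
      (sym (cong₂ ℕ._*_ (ℕ.^-*-assoc 2 b (suc j)) (ℕ.^-*-assoc 2 l q)))

    power′ : ∀ b q j → (2 ℕ.^ b ℕ.* n ℕ.^ q) ℕ.^ suc j ≡ (2 ℕ.^ b) ℕ.^ suc j ℕ.* (n ℕ.^ suc j) ℕ.^ q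
    power′ b q j = trans (^-distribʳ-* (suc j) (2 ℕ.^ b) (n ℕ.^ q))
      (cong ((2 ℕ.^ b) ℕ.^ suc j ℕ.*_) (trans (ℕ.^-*-assoc n q (suc j))
        (trans (cong (n ℕ.^_) (ℕ.*-comm q (suc j))) (sym (ℕ.^-*-assoc n (suc j) q)))))

  -- After raising to the power `suc j`, the hypothesis compares exponents of 2, and
  -- `2 ^ L ≤ n ^ suc j` replaces the floor of the logarithm by `n`.
  <approx⇒2^< : ∀ a b q-1 j → (a ⊖ b) ℚ./ suc q-1 ℚ.< approx n j →
                2 ℕ.^ a ℕ.< 2 ℕ.^ b ℕ.* n ℕ.^ suc q-1
  <approx⇒2^< a b q-1 j lt = ℕ.≰⇒> λ le → ℕ.<-irrefl refl (begin-strict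
    (2 ℕ.^ b ℕ.* n ℕ.^ q) ℕ.^ suc j               ≤⟨ ℕ.^-monoˡ-≤ (suc j) le ⟩
    (2 ℕ.^ a) ℕ.^ suc j                           ≡⟨ ℕ.^-*-assoc 2 a (suc j) ⟩
    2 ℕ.^ (a ℕ.* suc j)                           <⟨ ℕ.^-monoʳ-< 2 (ℕ.s≤s (ℕ.s≤s ℕ.z≤n)) exponents ⟩
    2 ℕ.^ (b ℕ.* suc j ℕ.+ L n j ℕ.* q)           ≡⟨ power b q j (L n j) ⟩
    (2 ℕ.^ b) ℕ.^ suc j ℕ.* (2 ℕ.^ L n j) ℕ.^ q   ≤⟨ ℕ.*-monoʳ-≤ ((2 ℕ.^ b) ℕ.^ suc j) (ℕ.^-monoˡ-≤ q (2^L≤ j)) ⟩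
    (2 ℕ.^ b) ℕ.^ suc j ℕ.* (n ℕ.^ suc j) ℕ.^ q   ≡⟨ power′ b q j ⟨
    (2 ℕ.^ b ℕ.* n ℕ.^ q) ℕ.^ suc j               ∎)
    where
    open ℕ.≤-Reasoning
    q = suc q-1
    exponents : a ℕ.* suc j ℕ.< b ℕ.* suc j ℕ.+ L n j ℕ.* q
    exponents = ⊖-*-< a b (suc j) (L n j ℕ.* q)
      (subst (_ ℤ.<_) (sym (ℤ.pos-* (L n j) q)) (/-cancel-< (a ⊖ b) q-1 (+ L n j) j lt))

  -- Adding `1/[1+ j ]` raises the numerator from `L` to `suc L`, which is where
  -- `n ^ suc j < 2 ^ suc L` applies.
  approx<⇒<2^ : ∀ a b q-1 j → approx n j ℚ.+ 1/[1+ j ] ℚ.< (a ⊖ b) ℚ./ suc q-1 →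
                2 ℕ.^ b ℕ.* n ℕ.^ suc q-1 ℕ.< 2 ℕ.^ a
  approx<⇒<2^ a b q-1 j lt = ℕ.≰⇒> λ le → ℕ.<-irrefl refl (begin-strict
    (2 ℕ.^ b ℕ.* n ℕ.^ q) ℕ.^ suc j                   ≡⟨ power′ b q j ⟩
    (2 ℕ.^ b) ℕ.^ suc j ℕ.* (n ℕ.^ suc j) ℕ.^ q
      ≤⟨ ℕ.*-monoʳ-≤ ((2 ℕ.^ b) ℕ.^ suc j) (ℕ.^-monoˡ-≤ q (ℕ.<⇒≤ (<2^1+L j))) ⟩
    (2 ℕ.^ b) ℕ.^ suc j ℕ.* (2 ℕ.^ suc (L n j)) ℕ.^ q ≡⟨ power b q j (suc (L n j)) ⟨
    2 ℕ.^ (b ℕ.* suc j ℕ.+ suc (L n j) ℕ.* q)         <⟨ ℕ.^-monoʳ-< 2 (ℕ.s≤s (ℕ.s≤s ℕ.z≤n)) exponents ⟩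
    2 ℕ.^ (a ℕ.* suc j)                               ≡⟨ ℕ.^-*-assoc 2 a (suc j) ⟨
    (2 ℕ.^ a) ℕ.^ suc j                               ≤⟨ ℕ.^-monoˡ-≤ (suc j) le ⟩
    (2 ℕ.^ b ℕ.* n ℕ.^ q) ℕ.^ suc j                   ∎)
    where
    open ℕ.≤-Reasoning
    q = suc q-1
    exponents : b ℕ.* suc j ℕ.+ suc (L n j) ℕ.* q ℕ.< a ℕ.* suc j
    exponents = <-⊖-* a b (suc j) (suc (L n j) ℕ.* q)
      (subst (ℤ._< (a ⊖ b) ℤ.* + suc j) (sym (ℤ.pos-* (suc (L n j)) q))
        (/-cancel-< (+ suc (L n j)) j (a ⊖ b) q-1 (subst (ℚ._< _) (sym (suc/ (L n j) j)) lt)))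

  -- A strict inequality with the limit leaves a gap `η`, so it already holds at a single
  -- approximation `j`; from above, `j` must also satisfy `1/[1+ j ] < η`.
  ≃log₂⇒≡2^ : ∀ {x} → x ≃ log₂ n → n ≡2^ x
  ≃log₂⇒≡2^ {x} x≃log a b (suc q-1) = below , above
    where
    at : ∀ {P : ℕ → Set} → Eventually P → ∃[ j ] P j
    at (N , p) = N , p N ℕ.≤-refl
    below : fromℚ ((a ⊖ b) ℚ./ suc q-1) < x → 2 ℕ.^ a ℕ.< 2 ℕ.^ b ℕ.* n ℕ.^ suc q-1
    below p<x =
      let
        η , η>0 , p<log = <-≤-trans {fromℚ ((a ⊖ b) ℚ./ suc q-1)} {x} {log₂ n} p<x (≃⇒≤ {x} {log₂ n} x≃log)
        j , lt = at p<log
      in <approx⇒2^< a b q-1 j (ℚ.<-trans (p<p+ε ((a ⊖ b) ℚ./ suc q-1) η>0) lt)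
    above : x < fromℚ ((a ⊖ b) ℚ./ suc q-1) → 2 ℕ.^ b ℕ.* n ℕ.^ suc q-1 ℕ.< 2 ℕ.^ a
    above x<p =
      let
        η , η>0 , log<p = ≤-<-trans {log₂ n} {x} {fromℚ ((a ⊖ b) ℚ./ suc q-1)}
          (≃⇒≤ {log₂ n} {x} (≃-sym {x} {log₂ n} x≃log)) x<p
        j , log+η<p , 1/j<η = at (log<p ⊗ eventually-1/[1+]< η>0)
      in approx<⇒<2^ a b q-1 j (ℚ.<-trans (ℚ.+-monoʳ-< (approx n j) 1/j<η) log+η<p)

  -- The cut is evaluated only at `L / suc j` and `suc L / suc j`, which bracket the logarithm. If
  -- `x` lay outside, the cut would contradict `2 ^ L ≤ n ^ suc j < 2 ^ suc L`.
  ≡2^⇒≃log₂ : ∀ {x} → n ≡2^ x → x ≃ log₂ n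
  ≡2^⇒≃log₂ {x} n≡2^x = ≤-antisym {x} {log₂ n}
    (terms-+1/[1+]-≥⇒≥ x (log₂ n) x≤approx+) (terms-≤⇒≤ x (log₂ n) approx≤x)
    where
    approx≤x : ∀ j → fromℚ (approx n j) ≤ x
    approx≤x j = ≮⇒≥ {x} {fromℚ (approx n j)} λ x<approx → ℕ.<⇒≱ (proj₂ (n≡2^x (L n j) 0 (suc j)) x<approx)
      (subst (2 ℕ.^ L n j ℕ.≤_) (sym (ℕ.*-identityˡ (n ℕ.^ suc j))) (2^L≤ j))
    x≤approx+ : ∀ j → x ≤ fromℚ (approx n j ℚ.+ 1/[1+ j ])
    x≤approx+ j = ≮⇒≥ {fromℚ (approx n j ℚ.+ 1/[1+ j ])} {x} λ approx+<x →
      ℕ.<-asym (subst (2 ℕ.^ suc (L n j) ℕ.<_) (ℕ.*-identityˡ (n ℕ.^ suc j))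
        (proj₁ (n≡2^x (suc (L n j)) 0 (suc j))
          (subst (λ p → fromℚ p < x) (sym (suc/ (L n j) j)) approx+<x))) (<2^1+L j)

2^≤⇒≤log₂ : ∀ {n} k → 2 ℕ.^ k ℕ.≤ n → fromℕ k ≤ log₂ n
2^≤⇒≤log₂ {n} k 2^k≤n = ≤-termwise {fromℕ k} {log₂ n} λ j → /-mono-≤ (+ k) 0 (+ Log₂.L n j) j
  (subst₂ ℤ._≤_ (ℤ.pos-* k (suc j)) (sym (ℤ.*-identityʳ (+ Log₂.L n j)))
    (ℤ.+≤+ (subst (ℕ._≤ Log₂.L n j) (⌊log₂[2^n]⌋≡n (k ℕ.* suc j))
      (⌊log₂⌋-mono-≤ (subst (ℕ._≤ n ℕ.^ suc j) (ℕ.^-*-assoc 2 k (suc j)) (ℕ.^-monoˡ-≤ (suc j) 2^k≤n))))))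

-- Negative type and Fourier inversion

∑ℚ : ∀ {A : Set} → List A → (A → ℚ) → ℚ
∑ℚ xs f = List.foldr ℚ._+_ 0ℚ (List.map f xs)

seq-∑ : ∀ {A : Set} (xs : List A) (f : A → ℝ) n → seq (∑ xs f) n ≡ ∑ℚ xs (λ x → seq (f x) n)
seq-∑ []       f n = refl
seq-∑ (x ∷ xs) f n = cong (seq (f x) n ℚ.+_) (seq-∑ xs f n)

module _ {A : Set} where

  ∑ℚ-cong : ∀ (xs : List A) {f g : A → ℚ} → (∀ x → f x ≡ g x) → ∑ℚ xs f ≡ ∑ℚ xs g
  ∑ℚ-cong []       f≡g = refl
  ∑ℚ-cong (x ∷ xs) f≡g = cong₂ ℚ._+_ (f≡g x) (∑ℚ-cong xs f≡g)

  ∑ℚ-cong-All : ∀ {xs : List A} {f g : A → ℚ} → All (λ x → f x ≡ g x) xs → ∑ℚ xs f ≡ ∑ℚ xs g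
  ∑ℚ-cong-All []          = refl
  ∑ℚ-cong-All (eq ∷ eqs) = cong₂ ℚ._+_ eq (∑ℚ-cong-All eqs)

  ∑ℚ-0 : ∀ (xs : List A) → ∑ℚ xs (λ _ → 0ℚ) ≡ 0ℚ
  ∑ℚ-0 []       = refl
  ∑ℚ-0 (x ∷ xs) = trans (ℚ.+-identityˡ _) (∑ℚ-0 xs)

  ∑ℚ-+ : ∀ (xs : List A) (f g : A → ℚ) → ∑ℚ xs (λ x → f x ℚ.+ g x) ≡ ∑ℚ xs f ℚ.+ ∑ℚ xs g
  ∑ℚ-+ []       f g = refl
  ∑ℚ-+ (x ∷ xs) f g = trans (cong ((f x ℚ.+ g x) ℚ.+_) (∑ℚ-+ xs f g))
    (solve 4 (λ a b c d → (a :+ b) :+ (c :+ d) := (a :+ c) :+ (b :+ d)) refl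
      (f x) (g x) (∑ℚ xs f) (∑ℚ xs g))

  ∑ℚ-*ˡ : ∀ c (xs : List A) (f : A → ℚ) → ∑ℚ xs (λ x → c ℚ.* f x) ≡ c ℚ.* ∑ℚ xs f
  ∑ℚ-*ˡ c []       f = sym (ℚ.*-zeroʳ c)
  ∑ℚ-*ˡ c (x ∷ xs) f = trans (cong (c ℚ.* f x ℚ.+_) (∑ℚ-*ˡ c xs f))
    (sym (ℚ.*-distribˡ-+ c (f x) (∑ℚ xs f)))

  ∑ℚ-nonNeg : ∀ (xs : List A) {f : A → ℚ} → (∀ x → 0ℚ ℚ.≤ f x) → 0ℚ ℚ.≤ ∑ℚ xs f
  ∑ℚ-nonNeg []       f≥0 = ℚ.≤-refl
  ∑ℚ-nonNeg (x ∷ xs) f≥0 = ℚ.+-mono-≤ (f≥0 x) (∑ℚ-nonNeg xs f≥0)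

  ∑ℚ-++ : ∀ (xs ys : List A) (f : A → ℚ) → ∑ℚ (xs List.++ ys) f ≡ ∑ℚ xs f ℚ.+ ∑ℚ ys f
  ∑ℚ-++ []       ys f = sym (ℚ.+-identityˡ _)
  ∑ℚ-++ (x ∷ xs) ys f = trans (cong (f x ℚ.+_) (∑ℚ-++ xs ys f)) (sym (ℚ.+-assoc (f x) _ _))

  ∑ℚ-↭ : ∀ {xs ys : List A} (f : A → ℚ) → xs ↭ ys → ∑ℚ xs f ≡ ∑ℚ ys f
  ∑ℚ-↭ f Perm.refl         = refl
  ∑ℚ-↭ f (Perm.prep x p)   = cong (f x ℚ.+_) (∑ℚ-↭ f p)
  ∑ℚ-↭ f (Perm.swap x y p) = trans (cong (λ t → f x ℚ.+ (f y ℚ.+ t)) (∑ℚ-↭ f p))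
    (exchange (f x) (f y) _)
    where
    exchange : ∀ a b c → a ℚ.+ (b ℚ.+ c) ≡ b ℚ.+ (a ℚ.+ c)
    exchange = solve 3 (λ a b c → a :+ (b :+ c) := b :+ (a :+ c)) refl
  ∑ℚ-↭ f (Perm.trans p q)  = trans (∑ℚ-↭ f p) (∑ℚ-↭ f q)

∑ℚ-map : ∀ {A B : Set} (h : A → B) xs (f : B → ℚ) → ∑ℚ (List.map h xs) f ≡ ∑ℚ xs (f ∘ h)
∑ℚ-map h []       f = refl
∑ℚ-map h (x ∷ xs) f = cong (f (h x) ℚ.+_) (∑ℚ-map h xs f)

∑ℚ-swap : ∀ {A B : Set} (xs : List A) (ys : List B) (f : A → B → ℚ) →
          ∑ℚ xs (λ x → ∑ℚ ys (f x)) ≡ ∑ℚ ys (λ y → ∑ℚ xs (λ x → f x y))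
∑ℚ-swap []       ys f = sym (∑ℚ-0 ys)
∑ℚ-swap (x ∷ xs) ys f = trans (cong (∑ℚ ys (f x) ℚ.+_) (∑ℚ-swap xs ys f))
  (sym (∑ℚ-+ ys (f x) (λ y → ∑ℚ xs (λ x → f x y))))

-- Charges on a line

module _ {A : Set} (a u : A → ℚ) where

  -- Charges `a` at positions `u`, interacting through their distance; the sum runs over ordered
  -- pairs, which is the source of the doubled terms below.
  energy : List A → ℚ
  energy xs = ∑ℚ xs (λ x → ∑ℚ xs (λ y → (a x ℚ.* a y) ℚ.* ℚ.∣ u x ℚ.- u y ∣))

  moment : List A → ℚ → ℚ
  moment xs b = ∑ℚ xs (λ x → a x ℚ.* (u x ℚ.- b))

  energy-↭ : ∀ {xs ys} → xs ↭ ys → energy xs ≡ energy ys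
  energy-↭ {xs} {ys} p = trans (∑ℚ-↭ _ p) (∑ℚ-cong ys (λ x → ∑ℚ-↭ _ p))

  moment-shift : ∀ xs b c → moment xs b ≡ moment xs c ℚ.+ (c ℚ.- b) ℚ.* ∑ℚ xs a
  moment-shift xs b c = begin
    ∑ℚ xs (λ x → a x ℚ.* (u x ℚ.- b))
      ≡⟨ ∑ℚ-cong xs (λ x → solve 4 (λ a u b c → a :* (u :- b) := a :* (u :- c) :+ (c :- b) :* a) refl
           (a x) (u x) b c) ⟩
    ∑ℚ xs (λ x → a x ℚ.* (u x ℚ.- c) ℚ.+ (c ℚ.- b) ℚ.* a x)
      ≡⟨ ∑ℚ-+ xs _ _ ⟩
    moment xs c ℚ.+ ∑ℚ xs (λ x → (c ℚ.- b) ℚ.* a x)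
      ≡⟨ cong (moment xs c ℚ.+_) (∑ℚ-*ˡ (c ℚ.- b) xs a) ⟩
    moment xs c ℚ.+ (c ℚ.- b) ℚ.* ∑ℚ xs a ∎
    where open ≡-Reasoning

  private
    gap : ∀ {p q} → p ℚ.≤ q → 0ℚ ℚ.≤ q ℚ.- p
    gap {p} {q} p≤q = subst (ℚ._≤ q ℚ.- p) (ℚ.+-inverseʳ p) (ℚ.+-monoˡ-≤ (ℚ.- p) p≤q)

    square-nonNeg : ∀ p → 0ℚ ℚ.≤ p ℚ.* p
    square-nonNeg p with ℚ.≤-total 0ℚ p
    ... | inj₁ 0≤p = ℚ.nonNegative⁻¹ (p ℚ.* p)
      {{ℚ.nonNeg*nonNeg⇒nonNeg p {{ℚ.nonNegative 0≤p}} p {{ℚ.nonNegative 0≤p}}}}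
    ... | inj₂ p≤0 = ℚ.nonNegative⁻¹ (p ℚ.* p)
      {{ℚ.nonPos*nonPos⇒nonPos p {{ℚ.nonPositive p≤0}} p {{ℚ.nonPositive p≤0}}}}

  private
    _≼_ : A → A → Set
    x ≼ y = u x ℚ.≤ u y

  -- With `x` leftmost the absolute values open up, and the row and the column of `x` each
  -- contribute its charge times the moment of the others about `x`.
  energy-∷ : ∀ {x xs} → All (x ≼_) xs →
             energy (x ∷ xs) ≡ a x ℚ.* moment xs (u x) ℚ.+ a x ℚ.* moment xs (u x) ℚ.+ energy xs
  energy-∷ {x} {xs} x≼xs = begin
    (k x x ℚ.+ ∑ℚ xs (k x)) ℚ.+ ∑ℚ xs (λ y → k y x ℚ.+ ∑ℚ xs (k y))
      ≡⟨ cong₂ ℚ._+_ (cong₂ ℚ._+_ kxx≡0 (trans (∑ℚ-cong-All (All.map row x≼xs)) (∑ℚ-*ˡ (a x) xs _)))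
           (trans (∑ℚ-+ xs _ _) (cong (ℚ._+ energy xs)
             (trans (∑ℚ-cong-All (All.map column x≼xs)) (∑ℚ-*ˡ (a x) xs _)))) ⟩
    (0ℚ ℚ.+ m) ℚ.+ (m ℚ.+ energy xs)
      ≡⟨ cong (ℚ._+ (m ℚ.+ energy xs)) (ℚ.+-identityˡ m) ⟩
    m ℚ.+ (m ℚ.+ energy xs)
      ≡⟨ ℚ.+-assoc m m (energy xs) ⟨
    m ℚ.+ m ℚ.+ energy xs ∎
    where
    open ≡-Reasoning
    k : A → A → ℚ
    k x y = (a x ℚ.* a y) ℚ.* ℚ.∣ u x ℚ.- u y ∣
    m : ℚ
    m = a x ℚ.* moment xs (u x)
    kxx≡0 : k x x ≡ 0ℚ
    kxx≡0 = trans (cong (λ t → a x ℚ.* a x ℚ.* ℚ.∣ t ∣) (ℚ.+-inverseʳ (u x))) (ℚ.*-zeroʳ (a x ℚ.* a x))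
    column : ∀ {y} → x ≼ y → k y x ≡ a x ℚ.* (a y ℚ.* (u y ℚ.- u x))
    column {y} x≼y = trans (cong (a y ℚ.* a x ℚ.*_) (ℚ.0≤p⇒∣p∣≡p (gap x≼y)))
      (solve 3 (λ p q r → (q :* p) :* r := p :* (q :* r)) refl (a x) (a y) (u y ℚ.- u x))
    row : ∀ {y} → x ≼ y → k x y ≡ a x ℚ.* (a y ℚ.* (u y ℚ.- u x))
    row {y} x≼y = trans
      (cong₂ ℚ._*_ (ℚ.*-comm (a x) (a y)) (∣p-q∣≡∣q-p∣ (u x) (u y))) (column x≼y)

  -- With A the total charge, 2 A (moment b) exceeds the energy by
  -- 2 ∑ₖ (uₖ - uₖ₋₁) (aₖ + aₖ₊₁ + …)² when u is increasing and u₋₁ = b.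
  energy-sorted : ∀ {xs} b → AllPairs _≼_ xs → All (λ x → b ℚ.≤ u x) xs →
                  energy xs ℚ.≤ ∑ℚ xs a ℚ.* moment xs b ℚ.+ ∑ℚ xs a ℚ.* moment xs b
  energy-sorted b [] [] = ℚ.≤-refl
  energy-sorted {x ∷ xs} b (x≼xs ∷ sorted) (b≤x ∷ b≤xs) = begin
    energy (x ∷ xs)
      ≡⟨ energy-∷ x≼xs ⟩
    a x ℚ.* m ℚ.+ a x ℚ.* m ℚ.+ energy xs
      ≤⟨ ℚ.+-monoʳ-≤ (a x ℚ.* m ℚ.+ a x ℚ.* m) (energy-sorted (u x) sorted x≼xs) ⟩
    a x ℚ.* m ℚ.+ a x ℚ.* m ℚ.+ (t ℚ.* m ℚ.+ t ℚ.* m)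
      ≡⟨ ℚ.+-identityʳ _ ⟨
    a x ℚ.* m ℚ.+ a x ℚ.* m ℚ.+ (t ℚ.* m ℚ.+ t ℚ.* m) ℚ.+ 0ℚ
      ≤⟨ ℚ.+-monoʳ-≤ (a x ℚ.* m ℚ.+ a x ℚ.* m ℚ.+ (t ℚ.* m ℚ.+ t ℚ.* m)) (ℚ.+-mono-≤ slack slack) ⟩
    a x ℚ.* m ℚ.+ a x ℚ.* m ℚ.+ (t ℚ.* m ℚ.+ t ℚ.* m) ℚ.+ (s ℚ.+ s)
      ≡⟨ solve 4 (λ α m t d →
           α :* m :+ α :* m :+ (t :* m :+ t :* m) :+ (d :* ((α :+ t) :* (α :+ t)) :+ d :* ((α :+ t) :* (α :+ t)))
           := (α :+ t) :* (α :* d :+ (m :+ d :* t)) :+ (α :+ t) :* (α :* d :+ (m :+ d :* t))) refl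
           (a x) m t (u x ℚ.- b) ⟩
    (a x ℚ.+ t) ℚ.* (a x ℚ.* (u x ℚ.- b) ℚ.+ (m ℚ.+ (u x ℚ.- b) ℚ.* t)) ℚ.+
    (a x ℚ.+ t) ℚ.* (a x ℚ.* (u x ℚ.- b) ℚ.+ (m ℚ.+ (u x ℚ.- b) ℚ.* t))
      ≡⟨ cong (λ r → (a x ℚ.+ t) ℚ.* (a x ℚ.* (u x ℚ.- b) ℚ.+ r) ℚ.+ (a x ℚ.+ t) ℚ.* (a x ℚ.* (u x ℚ.- b) ℚ.+ r))
           (moment-shift xs b (u x)) ⟨
    ∑ℚ (x ∷ xs) a ℚ.* moment (x ∷ xs) b ℚ.+ ∑ℚ (x ∷ xs) a ℚ.* moment (x ∷ xs) b ∎
    where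
    open ℚ.≤-Reasoning
    m t s : ℚ
    m = moment xs (u x)
    t = ∑ℚ xs a
    s = (u x ℚ.- b) ℚ.* ((a x ℚ.+ t) ℚ.* (a x ℚ.+ t))
    slack : 0ℚ ℚ.≤ s
    slack = ℚ.nonNegative⁻¹ s {{ℚ.nonNeg*nonNeg⇒nonNeg (u x ℚ.- b) {{ℚ.nonNegative (gap b≤x)}}
      ((a x ℚ.+ t) ℚ.* (a x ℚ.+ t)) {{ℚ.nonNegative (square-nonNeg (a x ℚ.+ t))}}}}

  -- Energy does not depend on the order of the list, so the points may be sorted. The bound for
  -- sorted points carries the total charge as a factor and hence vanishes; its base point is taken
  -- to be the leftmost point.
  energy-nonPos : ∀ xs → ∑ℚ xs a ≡ 0ℚ → energy xs ℚ.≤ 0ℚ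
  energy-nonPos xs neutral = ℚ.≤-trans (ℚ.≤-reflexive (sym (energy-↭ (sort-↭ xs))))
    (bound (Linked⇒AllPairs ℚ.≤-trans (sort-↗ xs)) (trans (∑ℚ-↭ a (sort-↭ xs)) neutral))
    where
    open Sort (On.decTotalOrder ℚ.≤-decTotalOrder u)
    bound : ∀ {ys} → AllPairs _≼_ ys → ∑ℚ ys a ≡ 0ℚ → energy ys ℚ.≤ 0ℚ
    bound [] _ = ℚ.≤-refl
    bound {y ∷ ys} (y≼ys ∷ sorted) eq = ℚ.≤-trans
      (energy-sorted (u y) (y≼ys ∷ sorted) (ℚ.≤-refl ∷ y≼ys))
      (ℚ.≤-reflexive (cong (λ t → t ℚ.+ t) (trans (cong (ℚ._* moment (y ∷ ys) (u y)) eq)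
        (ℚ.*-zeroˡ (moment (y ∷ ys) (u y))))))

-- Characters and Fourier inversion on the cube

sign : Bool → ℚ
sign false = 1ℚ
sign true  = ℚ.- 1ℚ

sign-xor : ∀ a b → sign (a xor b) ≡ sign a ℚ.* sign b
sign-xor true  true  = refl
sign-xor true  false = refl
sign-xor false true  = refl
sign-xor false false = refl

sign-not : ∀ a → sign (not a) ≡ ℚ.- sign a
sign-not true  = refl
sign-not false = refl

∑-cube : ∀ {n} (f : 𝔽₂^ (suc n) → ℚ) → ∑ℚ (allVectors (suc n)) f ≡
         ∑ℚ (allVectors n) (f ∘ (false ∷_)) ℚ.+ ∑ℚ (allVectors n) (f ∘ (true ∷_))
∑-cube {n} f = trans (∑ℚ-++ (List.map (false ∷_) (allVectors n)) _ f)
  (cong₂ ℚ._+_ (∑ℚ-map (false ∷_) (allVectors n) f) (∑ℚ-map (true ∷_) (allVectors n) f))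

-- Flipping the first coordinate in which `β` is true reverses the sign, so the terms cancel in
-- pairs.
∑-character : ∀ {n} (β : 𝔽₂^ n) → β ≢ 𝟎 → ∑ℚ (allVectors n) (sign ∘ dot β) ≡ 0ℚ
∑-character []           β≢𝟎 = contradiction refl β≢𝟎
∑-character {suc n} (true ∷ β)  β≢𝟎 = begin
  ∑ℚ (allVectors (suc n)) (sign ∘ dot (true ∷ β))
    ≡⟨ ∑-cube (sign ∘ dot (true ∷ β)) ⟩
  ∑ℚ (allVectors n) (sign ∘ dot β) ℚ.+ ∑ℚ (allVectors n) (λ x → sign (not (dot β x)))
    ≡⟨ ∑ℚ-+ (allVectors n) _ _ ⟨
  ∑ℚ (allVectors n) (λ x → sign (dot β x) ℚ.+ sign (not (dot β x)))
    ≡⟨ ∑ℚ-cong (allVectors n) (λ x → trans (cong (sign (dot β x) ℚ.+_) (sign-not (dot β x)))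
         (ℚ.+-inverseʳ (sign (dot β x)))) ⟩
  ∑ℚ (allVectors n) (λ _ → 0ℚ)
    ≡⟨ ∑ℚ-0 (allVectors n) ⟩
  0ℚ ∎
  where open ≡-Reasoning
∑-character {suc n} (false ∷ β) β≢𝟎 = trans (∑-cube (sign ∘ dot (false ∷ β)))
  (cong₂ ℚ._+_ eq eq)
  where
  eq : ∑ℚ (allVectors n) (sign ∘ dot β) ≡ 0ℚ
  eq = ∑-character β (β≢𝟎 ∘ cong (false ∷_))

cubeSize : ℕ → ℚ
cubeSize n = ∑ℚ (allVectors n) (λ _ → 1ℚ)

-- Characters factor over coordinates, so induction on the dimension works. Summing over the head of
-- `β` cancels the terms whose head differs from that of `v` and doubles the others.
fourier-inversion : ∀ {n} (F : 𝔽₂^ n → ℚ) v →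
  ∑ℚ (allVectors n) (λ β → ∑ℚ (allVectors n) (λ y → F y ℚ.* sign (dot β (y ⊕ v)))) ≡ cubeSize n ℚ.* F v
fourier-inversion {zero} F [] =
  solve 1 (λ f → (f :* con 1ℚ :+ con 0ℚ) :+ con 0ℚ := (con 1ℚ :+ con 0ℚ) :* f) refl (F [])
fourier-inversion {suc n} F (b ∷ v) = begin
  ∑ℚ (allVectors (suc n)) (λ β → ∑ℚ (allVectors (suc n)) (λ y → F y ℚ.* sign (dot β (y ⊕ (b ∷ v)))))
    ≡⟨ ∑-cube {n} _ ⟩
  ∑ℚ (allVectors n) (λ β → row (false ∷ β)) ℚ.+ ∑ℚ (allVectors n) (λ β → row (true ∷ β))
    ≡⟨ cong₂ ℚ._+_ (half false) (half true) ⟩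
  (at false false ℚ.+ at false true) ℚ.+ (at true false ℚ.+ at true true)
    ≡⟨ collect b ⟩
  (N ℚ.+ N) ℚ.* F (b ∷ v)
    ≡⟨ cong (ℚ._* F (b ∷ v)) (∑-cube {n} (λ _ → 1ℚ)) ⟨
  cubeSize (suc n) ℚ.* F (b ∷ v) ∎
  where
  open ≡-Reasoning
  N : ℚ
  N = cubeSize n
  row : 𝔽₂^ (suc n) → ℚ
  row β = ∑ℚ (allVectors (suc n)) (λ y → F y ℚ.* sign (dot β (y ⊕ (b ∷ v))))
  at : Bool → Bool → ℚ
  at a c = sign (a ∧ (c xor b)) ℚ.* (N ℚ.* F (c ∷ v))
  term : ∀ a c → ∑ℚ (allVectors n) (λ β → ∑ℚ (allVectors n)
           (λ y → F (c ∷ y) ℚ.* sign ((a ∧ (c xor b)) xor dot β (y ⊕ v)))) ≡ at a c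
  term a c = begin
    ∑ℚ (allVectors n) (λ β → ∑ℚ (allVectors n) (λ y → F (c ∷ y) ℚ.* sign ((a ∧ (c xor b)) xor dot β (y ⊕ v))))
      ≡⟨ ∑ℚ-cong (allVectors n) (λ β → trans
           (∑ℚ-cong (allVectors n) (λ y → trans (cong (F (c ∷ y) ℚ.*_) (sign-xor (a ∧ (c xor b)) (dot β (y ⊕ v))))
             (solve 3 (λ f s t → f :* (s :* t) := s :* (f :* t)) refl
               (F (c ∷ y)) (sign (a ∧ (c xor b))) (sign (dot β (y ⊕ v))))))
           (∑ℚ-*ˡ (sign (a ∧ (c xor b))) (allVectors n) _)) ⟩
    ∑ℚ (allVectors n) (λ β → sign (a ∧ (c xor b)) ℚ.* ∑ℚ (allVectors n) (λ y → F (c ∷ y) ℚ.* sign (dot β (y ⊕ v))))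
      ≡⟨ ∑ℚ-*ˡ (sign (a ∧ (c xor b))) (allVectors n) _ ⟩
    sign (a ∧ (c xor b)) ℚ.* ∑ℚ (allVectors n) (λ β → ∑ℚ (allVectors n) (λ y → F (c ∷ y) ℚ.* sign (dot β (y ⊕ v))))
      ≡⟨ cong (sign (a ∧ (c xor b)) ℚ.*_) (fourier-inversion (F ∘ (c ∷_)) v) ⟩
    at a c ∎
  half : ∀ a → ∑ℚ (allVectors n) (λ β → row (a ∷ β)) ≡ at a false ℚ.+ at a true
  half a = trans (∑ℚ-cong (allVectors n) (λ β → ∑-cube {n} _))
    (trans (∑ℚ-+ (allVectors n) _ _) (cong₂ ℚ._+_ (term a false) (term a true)))
  -- `b` is quantified afresh so that a case split lets the four signs compute.
  collect : ∀ b → let at′ = λ a c → sign (a ∧ (c xor b)) ℚ.* (N ℚ.* F (c ∷ v)) in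
    (at′ false false ℚ.+ at′ false true) ℚ.+ (at′ true false ℚ.+ at′ true true) ≡ (N ℚ.+ N) ℚ.* F (b ∷ v)
  collect true  = solve 3 (λ N f g → (con 1ℚ :* (N :* f) :+ con 1ℚ :* (N :* g)) :+
    ((:- con 1ℚ) :* (N :* f) :+ con 1ℚ :* (N :* g)) := (N :+ N) :* g) refl N (F (false ∷ v)) (F (true ∷ v))
  collect false = solve 3 (λ N f g → (con 1ℚ :* (N :* f) :+ con 1ℚ :* (N :* g)) :+
    (con 1ℚ :* (N :* f) :+ (:- con 1ℚ) :* (N :* g)) := (N :+ N) :* f) refl N (F (false ∷ v)) (F (true ∷ v))

-- The spectrum of an ℓ₁ metric

manhattan : ∀ {m} → (Fin m → ℚ) → (Fin m → ℚ) → ℚ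
manhattan u v = Vector.foldr ℚ._+_ 0ℚ (λ i → ℚ.∣ u i ℚ.- v i ∣)

manhattan-same : ∀ {m} (u : Fin m → ℚ) → manhattan u u ≡ 0ℚ
manhattan-same {zero}  u = refl
manhattan-same {suc m} u = trans
  (cong₂ ℚ._+_ (cong ℚ.∣_∣ (ℚ.+-inverseʳ (u zero))) (manhattan-same (u ∘ suc))) (ℚ.+-identityˡ 0ℚ)

seq-ℓ₁-distance : ∀ {m} (u v : Fin m → ℝ) n →
  seq (ℓ₁-distance u v) n ≡ manhattan (λ i → seq (u i) n) (λ i → seq (v i) n)
seq-ℓ₁-distance {zero}  u v n = refl
seq-ℓ₁-distance {suc m} u v n =
  cong (ℚ.∣ seq (u zero) n ℚ.- seq (v zero) n ∣ ℚ.+_) (seq-ℓ₁-distance (u ∘ suc) (v ∘ suc) n)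

∑∑-cong : ∀ {h} {f g : 𝔽₂^ h → 𝔽₂^ h → ℚ} → (∀ y z → f y z ≡ g y z) →
  ∑ℚ (allVectors h) (λ y → ∑ℚ (allVectors h) (f y)) ≡ ∑ℚ (allVectors h) (λ y → ∑ℚ (allVectors h) (g y))
∑∑-cong {h} eq = ∑ℚ-cong (allVectors h) (λ y → ∑ℚ-cong (allVectors h) (eq y))

-- Substituting `y = z ⊕ x` shows this to be minus the unnormalised Fourier coefficient at `β` of
-- `x ↦ ∑_z D (z ⊕ x) z`.
spectrum : ∀ {h} → (𝔽₂^ h → 𝔽₂^ h → ℚ) → 𝔽₂^ h → ℚ
spectrum {h} D β = ℚ.- ∑ℚ (allVectors h) (λ y → ∑ℚ (allVectors h) (λ z → D y z ℚ.* sign (dot β (y ⊕ z))))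

-- The ℓ₁ distance is a sum over coordinates. In each of them the character at `y ⊕ z` splits as a
-- product, which leaves the energy of the charges `sign (dot β y)`; their total is zero for
-- `β ≢ 𝟎`.
negativeType : ∀ {h m} (u : 𝔽₂^ h → Fin m → ℚ) β → β ≢ 𝟎 →
  ∑ℚ (allVectors h) (λ y → ∑ℚ (allVectors h) (λ z → manhattan (u y) (u z) ℚ.* sign (dot β (y ⊕ z)))) ℚ.≤ 0ℚ
negativeType {h} {zero} u β β≢𝟎 = ℚ.≤-reflexive (trans
  (∑ℚ-cong (allVectors h) (λ y → trans
    (∑ℚ-cong (allVectors h) (λ z → ℚ.*-zeroˡ (sign (dot β (y ⊕ z))))) (∑ℚ-0 (allVectors h))))
  (∑ℚ-0 (allVectors h)))
negativeType {h} {suc m} u β β≢𝟎 = begin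
  ∑ℚ X (λ y → ∑ℚ X (λ z → (line y z ℚ.+ rest y z) ℚ.* sign (dot β (y ⊕ z))))
    ≡⟨ ∑∑-cong (λ y z → ℚ.*-distribʳ-+ (sign (dot β (y ⊕ z))) (line y z) (rest y z)) ⟩
  ∑ℚ X (λ y → ∑ℚ X (λ z → line y z ℚ.* sign (dot β (y ⊕ z)) ℚ.+ rest y z ℚ.* sign (dot β (y ⊕ z))))
    ≡⟨ ∑ℚ-cong X (λ y → ∑ℚ-+ X _ _) ⟩
  ∑ℚ X (λ y → ∑ℚ X (λ z → line y z ℚ.* sign (dot β (y ⊕ z))) ℚ.+ ∑ℚ X (λ z → rest y z ℚ.* sign (dot β (y ⊕ z))))
    ≡⟨ ∑ℚ-+ X _ _ ⟩
  ∑ℚ X (λ y → ∑ℚ X (λ z → line y z ℚ.* sign (dot β (y ⊕ z)))) ℚ.+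
  ∑ℚ X (λ y → ∑ℚ X (λ z → rest y z ℚ.* sign (dot β (y ⊕ z))))
    ≡⟨ cong (ℚ._+ ∑ℚ X (λ y → ∑ℚ X (λ z → rest y z ℚ.* sign (dot β (y ⊕ z))))) (∑∑-cong separate) ⟩
  energy (sign ∘ dot β) (λ y → u y zero) X ℚ.+
  ∑ℚ X (λ y → ∑ℚ X (λ z → rest y z ℚ.* sign (dot β (y ⊕ z))))
    ≤⟨ ℚ.+-mono-≤ (energy-nonPos (sign ∘ dot β) (λ y → u y zero) X (∑-character β β≢𝟎))
         (negativeType (λ y → u y ∘ suc) β β≢𝟎) ⟩
  0ℚ ∎
  where
  open ℚ.≤-Reasoning
  X = allVectors h
  line rest : 𝔽₂^ h → 𝔽₂^ h → ℚ
  line y z = ℚ.∣ u y zero ℚ.- u z zero ∣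
  rest y z = manhattan (u y ∘ suc) (u z ∘ suc)
  separate : ∀ y z → line y z ℚ.* sign (dot β (y ⊕ z)) ≡ (sign (dot β y) ℚ.* sign (dot β z)) ℚ.* line y z
  separate y z = trans (ℚ.*-comm (line y z) _) (cong (ℚ._* line y z)
    (trans (cong sign (dot-⊕ʳ β y z)) (sign-xor (dot β y) (dot β z))))

-- The character at `x` merges with the one at `y ⊕ z`; for each fixed `z`, inversion then selects
-- `y = z ⊕ x`.
∑-spectrum-character : ∀ {h} (D : 𝔽₂^ h → 𝔽₂^ h → ℚ) x →
  ∑ℚ (allVectors h) (λ β → spectrum D β ℚ.* sign (dot β x)) ≡
  ℚ.- (cubeSize h ℚ.* ∑ℚ (allVectors h) (λ z → D (z ⊕ x) z))
∑-spectrum-character {h} D x = begin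
  ∑ℚ X (λ β → spectrum D β ℚ.* sign (dot β x))
    ≡⟨ ∑ℚ-cong X expand ⟩
  ∑ℚ X (λ β → ℚ.- 1ℚ ℚ.* ∑ℚ X (λ z → ∑ℚ X (λ y → D y z ℚ.* sign (dot β (y ⊕ (z ⊕ x))))))
    ≡⟨ ∑ℚ-*ˡ (ℚ.- 1ℚ) X _ ⟩
  ℚ.- 1ℚ ℚ.* ∑ℚ X (λ β → ∑ℚ X (λ z → ∑ℚ X (λ y → D y z ℚ.* sign (dot β (y ⊕ (z ⊕ x))))))
    ≡⟨ cong (ℚ.- 1ℚ ℚ.*_) (trans (∑ℚ-swap X X _)
         (trans (∑ℚ-cong X (λ z → fourier-inversion (λ y → D y z) (z ⊕ x))) (∑ℚ-*ˡ (cubeSize h) X _))) ⟩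
  ℚ.- 1ℚ ℚ.* (cubeSize h ℚ.* ∑ℚ X (λ z → D (z ⊕ x) z))
    ≡⟨ solve 1 (λ t → (:- con 1ℚ) :* t := :- t) refl (cubeSize h ℚ.* ∑ℚ X (λ z → D (z ⊕ x) z)) ⟩
  ℚ.- (cubeSize h ℚ.* ∑ℚ X (λ z → D (z ⊕ x) z)) ∎
  where
  open ≡-Reasoning
  X = allVectors h
  expand : ∀ β → spectrum D β ℚ.* sign (dot β x) ≡
           ℚ.- 1ℚ ℚ.* ∑ℚ X (λ z → ∑ℚ X (λ y → D y z ℚ.* sign (dot β (y ⊕ (z ⊕ x)))))
  expand β = trans (solve 2 (λ t s → (:- t) :* s := (:- con 1ℚ) :* (s :* t)) refl
      (∑ℚ X (λ y → ∑ℚ X (λ z → D y z ℚ.* sign (dot β (y ⊕ z))))) (sign (dot β x)))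
    (cong (ℚ.- 1ℚ ℚ.*_) (begin
      sign (dot β x) ℚ.* ∑ℚ X (λ y → ∑ℚ X (λ z → D y z ℚ.* sign (dot β (y ⊕ z))))
        ≡⟨ ∑ℚ-*ˡ (sign (dot β x)) X _ ⟨
      ∑ℚ X (λ y → sign (dot β x) ℚ.* ∑ℚ X (λ z → D y z ℚ.* sign (dot β (y ⊕ z))))
        ≡⟨ ∑ℚ-cong X (λ y → ∑ℚ-*ˡ (sign (dot β x)) X _) ⟨
      ∑ℚ X (λ y → ∑ℚ X (λ z → sign (dot β x) ℚ.* (D y z ℚ.* sign (dot β (y ⊕ z)))))
        ≡⟨ ∑∑-cong merge ⟩
      ∑ℚ X (λ y → ∑ℚ X (λ z → D y z ℚ.* sign (dot β (y ⊕ (z ⊕ x)))))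
        ≡⟨ ∑ℚ-swap X X _ ⟩
      ∑ℚ X (λ z → ∑ℚ X (λ y → D y z ℚ.* sign (dot β (y ⊕ (z ⊕ x))))) ∎))
    where
    merge : ∀ y z → sign (dot β x) ℚ.* (D y z ℚ.* sign (dot β (y ⊕ z))) ≡ D y z ℚ.* sign (dot β (y ⊕ (z ⊕ x)))
    merge y z = trans
      (solve 3 (λ s d t → s :* (d :* t) := d :* (t :* s)) refl (sign (dot β x)) (D y z) (sign (dot β (y ⊕ z))))
      (cong (D y z ℚ.*_) (trans (sym (sign-xor (dot β (y ⊕ z)) (dot β x)))
        (cong sign (trans (sym (dot-⊕ʳ β (y ⊕ z) x)) (cong (dot β) (⊕-assoc y z x))))))

-- Twice the indicator of `dot β x` is the character at `𝟎` minus the character at `x`. The first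
-- contributes the diagonal of `D`, which vanishes.
∑-spectrum-cut : ∀ {h} (D : 𝔽₂^ h → 𝔽₂^ h → ℚ) → (∀ z → D z z ≡ 0ℚ) → ∀ x →
  ∑ℚ (allVectors h) (λ β → if dot β x then spectrum D β ℚ.+ spectrum D β else 0ℚ) ≡
  cubeSize h ℚ.* ∑ℚ (allVectors h) (λ z → D (z ⊕ x) z)
∑-spectrum-cut {h} D Dzz≡0 x = begin
  ∑ℚ X (λ β → if dot β x then spectrum D β ℚ.+ spectrum D β else 0ℚ)
    ≡⟨ ∑ℚ-cong X (λ β → trans (cut (spectrum D β) (dot β x))
         (cong (λ b → spectrum D β ℚ.* sign b ℚ.+ ℚ.- 1ℚ ℚ.* (spectrum D β ℚ.* sign (dot β x))) (sym (dot-𝟎ʳ β)))) ⟩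
  ∑ℚ X (λ β → spectrum D β ℚ.* sign (dot β 𝟎) ℚ.+ ℚ.- 1ℚ ℚ.* (spectrum D β ℚ.* sign (dot β x)))
    ≡⟨ trans (∑ℚ-+ X _ _) (cong (∑ℚ X (λ β → spectrum D β ℚ.* sign (dot β 𝟎)) ℚ.+_) (∑ℚ-*ˡ (ℚ.- 1ℚ) X _)) ⟩
  ∑ℚ X (λ β → spectrum D β ℚ.* sign (dot β 𝟎)) ℚ.+ ℚ.- 1ℚ ℚ.* ∑ℚ X (λ β → spectrum D β ℚ.* sign (dot β x))
    ≡⟨ cong₂ (λ s t → s ℚ.+ ℚ.- 1ℚ ℚ.* t) (∑-spectrum-character D 𝟎) (∑-spectrum-character D x) ⟩
  ℚ.- (cubeSize h ℚ.* ∑ℚ X (λ z → D (z ⊕ 𝟎) z)) ℚ.+ ℚ.- 1ℚ ℚ.* ℚ.- (cubeSize h ℚ.* ∑ℚ X (λ z → D (z ⊕ x) z))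
    ≡⟨ cong (λ s → ℚ.- (cubeSize h ℚ.* s) ℚ.+ ℚ.- 1ℚ ℚ.* ℚ.- (cubeSize h ℚ.* ∑ℚ X (λ z → D (z ⊕ x) z)))
         (trans (∑ℚ-cong X (λ z → trans (cong (λ t → D t z) (⊕-identityʳ z)) (Dzz≡0 z))) (∑ℚ-0 X)) ⟩
  ℚ.- (cubeSize h ℚ.* 0ℚ) ℚ.+ ℚ.- 1ℚ ℚ.* ℚ.- (cubeSize h ℚ.* ∑ℚ X (λ z → D (z ⊕ x) z))
    ≡⟨ solve 2 (λ N t → (:- (N :* con 0ℚ)) :+ (:- con 1ℚ) :* (:- t) := t) refl
         (cubeSize h) (cubeSize h ℚ.* ∑ℚ X (λ z → D (z ⊕ x) z)) ⟩
  cubeSize h ℚ.* ∑ℚ X (λ z → D (z ⊕ x) z) ∎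
  where
  open ≡-Reasoning
  X = allVectors h
  cut : ∀ k b → (if b then k ℚ.+ k else 0ℚ) ≡ k ℚ.* sign false ℚ.+ ℚ.- 1ℚ ℚ.* (k ℚ.* sign b)
  cut k true  = solve 1 (λ k → k :+ k := k :* con 1ℚ :+ (:- con 1ℚ) :* (k :* (:- con 1ℚ))) refl k
  cut k false = solve 1 (λ k → con 0ℚ := k :* con 1ℚ :+ (:- con 1ℚ) :* (k :* con 1ℚ)) refl k

if-seq : ∀ b (x y : ℝ) n → seq (if b then x else y) n ≡ (if b then seq x n else seq y n)
if-seq true  x y n = refl
if-seq false x y n = refl

module _ {h m : ℕ} (f : 𝔽₂^ h → Fin m → ℝ) where

  private
    X = allVectors h

    spectrumℝ : 𝔽₂^ h → ℝ
    spectrumℝ β = - ∑ X (λ y → ∑ X (λ z → ℓ₁-distance (f y) (f z) * fromℚ (sign (dot β (y ⊕ z)))))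

    D : ℕ → 𝔽₂^ h → 𝔽₂^ h → ℚ
    D n y z = manhattan (λ i → seq (f y i) n) (λ i → seq (f z i) n)

    seq-spectrumℝ : ∀ β n → seq (spectrumℝ β) n ≡ spectrum (D n) β
    seq-spectrumℝ β n = cong ℚ.-_ (trans (seq-∑ X _ n) (∑ℚ-cong X (λ y → trans (seq-∑ X _ n)
      (∑ℚ-cong X (λ z → cong (ℚ._* sign (dot β (y ⊕ z))) (seq-ℓ₁-distance (f y) (f z) n))))))

  -- Doubled because [ β · x = 1 ] is half of 1 - χ_β(x); at β = 0 the
  -- spectrum is not nonnegative, but the form 0 · x cuts nothing.
  cutWeight : 𝔽₂^ h → ℝ
  cutWeight β = if does (β ≟ 𝟎) then 0ℝ else spectrumℝ β + spectrumℝ β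

  -- At index `n` the approximations to `f` are themselves points of a rational ℓ₁ space, so
  -- negative type applies to every term and not only in the limit.
  cutWeight-nonNeg : ∀ β n → 0ℚ ℚ.≤ seq (cutWeight β) n
  cutWeight-nonNeg β n with β ≟ 𝟎
  ... | yes _    = ℚ.≤-refl
  ... | no β≢𝟎 = ℚ.+-mono-≤ nonNeg nonNeg
    where
    nonNeg : 0ℚ ℚ.≤ seq (spectrumℝ β) n
    nonNeg = subst (0ℚ ℚ.≤_) (sym (seq-spectrumℝ β n))
      (ℚ.neg-antimono-≤ (negativeType (λ y i → seq (f y i) n) β β≢𝟎))

  ∑-cutWeight : ∀ x →
    ∑ X (λ β → if dot β x then cutWeight β else 0ℝ) ≃
    fromℚ (cubeSize h) * ∑ X (λ z → ℓ₁-distance (f (z ⊕ x)) (f z))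
  ∑-cutWeight x = ≃-termwise
    {∑ X (λ β → if dot β x then cutWeight β else 0ℝ)}
    {fromℚ (cubeSize h) * ∑ X (λ z → ℓ₁-distance (f (z ⊕ x)) (f z))} λ n → begin
    seq (∑ X (λ β → if dot β x then cutWeight β else 0ℝ)) n
      ≡⟨ seq-∑ X _ n ⟩
    ∑ℚ X (λ β → seq (if dot β x then cutWeight β else 0ℝ) n)
      ≡⟨ ∑ℚ-cong X (λ β → term β n) ⟩
    ∑ℚ X (λ β → if dot β x then spectrum (D n) β ℚ.+ spectrum (D n) β else 0ℚ)
      ≡⟨ ∑-spectrum-cut (D n) (λ z → manhattan-same (λ i → seq (f z i) n)) x ⟩
    cubeSize h ℚ.* ∑ℚ X (λ z → D n (z ⊕ x) z)
      ≡⟨ cong (cubeSize h ℚ.*_) (trans (seq-∑ X _ n)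
           (∑ℚ-cong X (λ z → seq-ℓ₁-distance (f (z ⊕ x)) (f z) n))) ⟨
    seq (fromℚ (cubeSize h) * ∑ X (λ z → ℓ₁-distance (f (z ⊕ x)) (f z))) n ∎
    where
    open ≡-Reasoning
    dot-𝟎ˡ : ∀ {n} (x : 𝔽₂^ n) → dot 𝟎 x ≡ false
    dot-𝟎ˡ []       = refl
    dot-𝟎ˡ (a ∷ x) = dot-𝟎ˡ x
    term : ∀ β n → seq (if dot β x then cutWeight β else 0ℝ) n ≡
                   (if dot β x then spectrum (D n) β ℚ.+ spectrum (D n) β else 0ℚ)
    term β n with β ≟ 𝟎
    ... | no _ = trans (if-seq (dot β x) _ _ n)
      (cong (λ t → if dot β x then t else 0ℚ) (cong₂ ℚ._+_ (seq-spectrumℝ β n) (seq-spectrumℝ β n)))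
    ... | yes refl rewrite dot-𝟎ˡ x = refl

∑-δ : ∀ {n} (v : 𝔽₂^ n) (g : 𝔽₂^ n → ℚ) →
      ∑ℚ (allVectors n) (λ α → if does (v ≟ α) then g α else 0ℚ) ≡ g v
∑-δ []       g = ℚ.+-identityʳ (g [])
∑-δ {suc n} (true ∷ v)  g = trans (∑-cube {n} _)
  (trans (cong₂ ℚ._+_ (∑ℚ-0 (allVectors n)) (∑-δ v (g ∘ (true ∷_)))) (ℚ.+-identityˡ _))
∑-δ {suc n} (false ∷ v) g = trans (∑-cube {n} _)
  (trans (cong₂ ℚ._+_ (∑-δ v (g ∘ (false ∷_))) (∑ℚ-0 (allVectors n))) (ℚ.+-identityʳ _))

pushforward : ∀ {A : Set} {n} → List A → (A → 𝔽₂^ n) → (A → ℝ) → 𝔽₂^ n → ℝ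
pushforward xs t w α = ∑ xs (λ x → if does (t x ≟ α) then w x else 0ℝ)

-- Change of variables for an image measure. The factor `r` stands for the normalisation of the
-- tester, which is applied to each vector separately.
∑-pushforward : ∀ {A : Set} {n} (xs : List A) (t : A → 𝔽₂^ n) (w : A → ℝ) r (e : 𝔽₂^ n → Bool) →
  sumOver (λ α → if e α then pushforward xs t w α * r else 0ℝ) ≃
  ∑ xs (λ x → if e (t x) then w x else 0ℝ) * r
∑-pushforward {n = n} xs t w r e = ≃-termwise
  {sumOver (λ α → if e α then pushforward xs t w α * r else 0ℝ)}
  {∑ xs (λ x → if e (t x) then w x else 0ℝ) * r} λ k → begin
  seq (sumOver (λ α → if e α then pushforward xs t w α * r else 0ℝ)) k
    ≡⟨ seq-∑ (allVectors n) _ k ⟩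
  ∑ℚ (allVectors n) (λ α → seq (if e α then pushforward xs t w α * r else 0ℝ) k)
    ≡⟨ ∑ℚ-cong (allVectors n) (λ α → outer α k) ⟩
  ∑ℚ (allVectors n) (λ α → ∑ℚ xs (λ x → if does (t x ≟ α) then g k α x else 0ℚ))
    ≡⟨ ∑ℚ-swap (allVectors n) xs _ ⟩
  ∑ℚ xs (λ x → ∑ℚ (allVectors n) (λ α → if does (t x ≟ α) then g k α x else 0ℚ))
    ≡⟨ ∑ℚ-cong xs (λ x → ∑-δ (t x) (λ α → g k α x)) ⟩
  ∑ℚ xs (λ x → seq r k ℚ.* (if e (t x) then seq (w x) k else 0ℚ))
    ≡⟨ ∑ℚ-*ˡ (seq r k) xs _ ⟩
  seq r k ℚ.* ∑ℚ xs (λ x → if e (t x) then seq (w x) k else 0ℚ)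
    ≡⟨ ℚ.*-comm (seq r k) _ ⟩
  ∑ℚ xs (λ x → if e (t x) then seq (w x) k else 0ℚ) ℚ.* seq r k
    ≡⟨ cong (ℚ._* seq r k) (trans (seq-∑ xs _ k) (∑ℚ-cong xs (λ x → if-seq (e (t x)) (w x) 0ℝ k))) ⟨
  seq (∑ xs (λ x → if e (t x) then w x else 0ℝ) * r) k ∎
  where
  open ≡-Reasoning
  g : ℕ → 𝔽₂^ n → _ → ℚ
  g k α x = seq r k ℚ.* (if e α then seq (w x) k else 0ℚ)
  outer : ∀ α k → seq (if e α then pushforward xs t w α * r else 0ℝ) k ≡
                  ∑ℚ xs (λ x → if does (t x ≟ α) then g k α x else 0ℚ)
  outer α k with e α
  ... | true  = trans (cong (ℚ._* seq r k) (seq-∑ xs _ k)) (trans (ℚ.*-comm _ (seq r k))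
    (trans (sym (∑ℚ-*ˡ (seq r k) xs _)) (∑ℚ-cong xs (λ x → inner (does (t x ≟ α)) x))))
    where
    inner : ∀ b x → seq r k ℚ.* seq (if b then w x else 0ℝ) k ≡ (if b then seq r k ℚ.* seq (w x) k else 0ℚ)
    inner true  x = refl
    inner false x = ℚ.*-zeroʳ (seq r k)
  ... | false = sym (trans (∑ℚ-cong xs (λ x → inner (does (t x ≟ α)))) (∑ℚ-0 xs))
    where
    inner : ∀ b → (if b then seq r k ℚ.* 0ℚ else 0ℚ) ≡ 0ℚ
    inner true  = ℚ.*-zeroʳ (seq r k)
    inner false = refl

-- Thresholds for the two families

fromℕ-<-suc : ∀ k → fromℕ k < fromℕ (suc k)
fromℕ-<-suc k = ½ , ℚ.positive⁻¹ ½ , 0 , λ _ _ → subst (ι k ℚ.+ ½ ℚ.<_)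
  (trans (ℚ.+-comm (ι k) 1ℚ) (sym (ι-+ 1 k)))
  (ℚ.+-monoʳ-< (ι k) (subst (ℚ._< 1ℚ) (ℚ.+-identityˡ ½) (ℚ.+-monoˡ-< ½ (ℚ.positive⁻¹ ½))))

fromℕ-suc-≤⇒< : ∀ m n → fromℕ (suc m) ≤ fromℕ n → m ℕ.< n
-- Slack 1 gives `suc m < n + 1` at some index, which for naturals is already the claim.
fromℕ-suc-≤⇒< m n le with le 1ℚ (ℚ.positive⁻¹ 1ℚ)
... | N , lt = ℕ.s<s⁻¹ (ι-cancel-< (suc m) (suc n)
  (subst (ι (suc m) ℚ.<_) (trans (ℚ.+-comm (ι n) 1ℚ) (sym (ι-+ 1 n))) (lt N ℕ.≤-refl)))

ι-upper-bound : ∀ q → ∃[ k ] q ℚ.≤ ι k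
ι-upper-bound q@(mkℚ i d _) = ℤ.∣ i ∣ , ℚ.toℚᵘ-cancel-≤
  (ℚᵘ.≤-respʳ-≃ (ℚᵘ.≃-sym (ℚ.toℚᵘ-fromℚᵘ (ℚᵘ.mkℚᵘ (+ ℤ.∣ i ∣) 0))) (ℚᵘ.*≤* (bound i)))
  where
  bound : ∀ i → i ℤ.* + 1 ℤ.≤ + ℤ.∣ i ∣ ℤ.* + suc d
  bound (+ n)    = subst₂ ℤ._≤_ (ℤ.pos-* n 1) (ℤ.pos-* n (suc d))
    (ℤ.+≤+ (ℕ.*-monoʳ-≤ n (ℕ.s≤s ℕ.z≤n)))
  bound -[1+ n ] = subst (-[1+ n ] ℤ.* + 1 ℤ.≤_) (ℤ.pos-* (suc n) (suc d)) ℤ.-≤+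

*-monoˡ-≤-fromℕ : ∀ {x y} k → x ≤ y → x * fromℕ k ≤ y * fromℕ k
*-monoˡ-≤-fromℕ {x} {y} zero x≤y = ≤-termwise {x * fromℕ 0} {y * fromℕ 0}
  λ n → ℚ.≤-reflexive (trans (ℚ.*-zeroʳ (seq x n)) (sym (ℚ.*-zeroʳ (seq y n))))
*-monoˡ-≤-fromℕ {x} {y} (suc k) x≤y = ≤-trans {x * i} {i * x} {y * i} (≃⇒≤ {x * i} {i * x} (*-comm x i))
  (≤-trans {i * x} {i * y} {y * i} (*-monoʳ-≤ {x} {y} {i} i>0 x≤y) (≃⇒≤ {i * y} {y * i} (*-comm i y)))
  where
  i = fromℕ (suc k)
  i>0 : 0ℝ < i
  i>0 = ≤-<-trans {0ℝ} {fromℕ k} {i} (≤-termwise {0ℝ} {fromℕ k} λ _ → ι-mono-≤ {0} {k} ℕ.z≤n) (fromℕ-<-suc k)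

module _ {k h n : ℕ} {t : ℝ} (k+h≡n : k ℕ.+ h ≡ n) where

  private
    difference : ∀ j → ι k ℚ.- (ι n ℚ.- seq t j) ≡ seq t j ℚ.- ι h
    difference j = trans
      (cong (λ q → ι k ℚ.- (q ℚ.- seq t j)) (trans (cong ι (sym k+h≡n)) (ι-+ k h)))
      (solve 3 (λ k h t → k :- ((k :+ h) :- t) := t :- h) refl (ι k) (ι h) (seq t j))

  codimension⁺ : fromℕ k ≃ fromℕ n - t → t ≃ fromℕ h
  codimension⁺ k≃n-t ε ε>0 = eventually-map
    (λ {j} → subst (ℚ._< ε) (cong ℚ.∣_∣ (difference j))) (k≃n-t ε ε>0)

  codimension⁻ : t ≃ fromℕ h → fromℕ k ≃ fromℕ n - t
  codimension⁻ t≃h ε ε>0 = eventually-map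
    (λ {j} → subst (ℚ._< ε) (cong ℚ.∣_∣ (sym (difference j)))) (t≃h ε ε>0)

archimedean-lower : ∀ {c} → 0ℝ < c → ∀ k → ∃[ K ] fromℕ k ≤ c * fromℕ K
archimedean-lower {c} (η , η>0 , M , η<c) k =
  let
    q , q>0 , ηq≡1 = scale (ℚ.positive⁻¹ 1ℚ) η>0
    K , kq≤K = ι-upper-bound (ι k ℚ.* q)
  in K , ≤-eventually {fromℕ k} {c * fromℕ K} (M , λ n n≥ → begin
    ι k                 ≡⟨ ℚ.*-identityʳ (ι k) ⟨
    ι k ℚ.* 1ℚ          ≡⟨ cong (ι k ℚ.*_) ηq≡1 ⟨
    ι k ℚ.* (η ℚ.* q)   ≡⟨ solve 3 (λ k η q → k :* (η :* q) := η :* (k :* q)) refl (ι k) η q ⟩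
    η ℚ.* (ι k ℚ.* q)   ≤⟨ ℚ.*-monoˡ-≤-nonNeg η {{ℚ.nonNegative (ℚ.<⇒≤ η>0)}} kq≤K ⟩
    η ℚ.* ι K           ≡⟨ cong (ℚ._* ι K) (ℚ.+-identityˡ η) ⟨
    (0ℚ ℚ.+ η) ℚ.* ι K  ≤⟨ ℚ.*-monoʳ-≤-nonNeg (ι K) {{ℚ.nonNegative (ι-mono-≤ {0} {K} ℕ.z≤n)}}
                             (ℚ.<⇒≤ (η<c n n≥)) ⟩
    seq c n ℚ.* ι K     ∎)
  where open ℚ.≤-Reasoning

archimedean-upper : ∀ c k → ∃[ K ] c * fromℕ k ≤ fromℕ K
archimedean-upper c k =
  let
    M , B , B>0 , ∣c∣≤B = eventually-bounded c
    K , Bk≤K = ι-upper-bound (B ℚ.* ι k)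
  in K , ≤-eventually {c * fromℕ k} {fromℕ K} (M , λ j j≥ → ℚ.≤-trans
    (ℚ.*-monoʳ-≤-nonNeg (ι k) {{ℚ.nonNegative (ι-mono-≤ {0} {k} ℕ.z≤n)}}
      (ℚ.≤-trans (p≤∣p∣ (seq c j)) (∣c∣≤B j j≥)))
    Bk≤K)

-- `2 ^ K` with `N + 1 ≤ c K`: beyond it `h = c log₂ n` is at least `c K`, hence exceeds `N`.
logThreshold : ∀ {c} → 0ℝ < c → ℕ → ℕ
logThreshold {c} c>0 N = 2 ℕ.^ proj₁ (archimedean-lower {c} c>0 (suc N))

logThreshold-< : ∀ {c} (c>0 : 0ℝ < c) N {n h} →
  logThreshold {c} c>0 N ℕ.< n → c * log₂ n ≃ fromℕ h → N ℕ.< h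
logThreshold-< {c} c>0 N {n} {h} 2^K<n clog≃h =
  let K , N+1≤cK = archimedean-lower {c} c>0 (suc N)
  in fromℕ-suc-≤⇒< N h
    (≤-trans {fromℕ (suc N)} {c * fromℕ K} {fromℕ h} N+1≤cK
      (≤-trans {c * fromℕ K} {c * log₂ n} {fromℕ h}
        (*-monoʳ-≤ {fromℕ K} {log₂ n} {c} c>0 (2^≤⇒≤log₂ K (ℕ.<⇒≤ 2^K<n)))
        (≃⇒≤ {c * log₂ n} {fromℕ h} clog≃h)))

n<2^n : ∀ n → n ℕ.< 2 ℕ.^ n
n<2^n zero    = ℕ.s≤s ℕ.z≤n
n<2^n (suc n) = ℕ.≤-trans (ℕ.+-mono-≤ (ℕ.>-nonZero⁻¹ _ {{ℕ.m^n≢0 2 n}}) (n<2^n n))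
  (ℕ.≤-reflexive (cong (2 ℕ.^ n ℕ.+_) (sym (ℕ.+-identityʳ (2 ℕ.^ n)))))

-- A natural number above `c (N + 1)`. For larger `h` the exponent `h / c` is at least `N + 1`,
-- hence strictly above `N` as the cut requires, and `N < 2 ^ N < n`.
powerThreshold : ℝ → ℕ → ℕ
powerThreshold c N = proj₁ (archimedean-upper c (suc N))

powerThreshold-< : ∀ {c} (c>0 : 0ℝ < c) N {h n} →
  powerThreshold c N ℕ.< h → n ≡2^ fromℕ h ÷ c [ c>0 ] → N ℕ.< n
powerThreshold-< {c} c>0 N {h} {n} K<h n≡2^ =
  ℕ.<-trans (n<2^n N) (subst (2 ℕ.^ N ℕ.<_) (trans (ℕ.*-identityˡ (n ℕ.^ 1)) (ℕ.^-identityʳ n)) 2^N<n)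
  where
  K : ℕ
  K = powerThreshold c N
  c[N+1]≤h : c * fromℕ (suc N) ≤ fromℕ h
  c[N+1]≤h = ≤-trans {c * fromℕ (suc N)} {fromℕ K} {fromℕ h} (proj₂ (archimedean-upper c (suc N)))
    (≤-termwise {fromℕ K} {fromℕ h} λ _ → ι-mono-≤ (ℕ.<⇒≤ K<h))
  N+1≤h/c : fromℕ (suc N) ≤ fromℕ h ÷ c [ c>0 ]
  N+1≤h/c = ≤-trans {fromℕ (suc N)} {(c * fromℕ (suc N)) ÷ c [ c>0 ]} {fromℕ h ÷ c [ c>0 ]}
    (≃⇒≤ {fromℕ (suc N)} {(c * fromℕ (suc N)) ÷ c [ c>0 ]}
      (≃-sym {(c * fromℕ (suc N)) ÷ c [ c>0 ]} {fromℕ (suc N)} (*-÷-cancel c c>0 (fromℕ (suc N)))))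
    (÷-mono-≤ {c * fromℕ (suc N)} {fromℕ h} c c>0 c[N+1]≤h)
  2^N<n : 2 ℕ.^ N ℕ.< 1 ℕ.* n ℕ.^ 1
  2^N<n = proj₁ (n≡2^ N 0 1)
    (<-≤-trans {fromℕ N} {fromℕ (suc N)} {fromℕ h ÷ c [ c>0 ]} (fromℕ-<-suc N) N+1≤h/c)

-- From codes to graphs

∑-+ : ∀ {A : Set} (xs : List A) (f g : A → ℝ) → ∑ xs (λ x → f x + g x) ≃ ∑ xs f + ∑ xs g
∑-+ xs f g = ≃-termwise {∑ xs (λ x → f x + g x)} {∑ xs f + ∑ xs g} λ n →
  trans (seq-∑ xs _ n) (trans (∑ℚ-+ xs (λ x → seq (f x) n) (λ x → seq (g x) n))
    (sym (cong₂ ℚ._+_ (seq-∑ xs f n) (seq-∑ xs g n))))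

if-xor-≤ : ∀ {p} → 0ℝ ≤ p → ∀ a b c →
  (if (a ∧ b) xor c then p else 0ℝ) ≤ (if a ∧ b then p else 0ℝ) + (if c then p else 0ℝ)
if-xor-≤ {p} p≥0 a b c with a ∧ b | c
... | true  | true  = ≤-trans {0ℝ} {0ℝ + 0ℝ} {p + p} (≤-termwise {0ℝ} {0ℝ + 0ℝ} λ _ → ℚ.≤-refl)
  (+-mono-≤ {0ℝ} {p} {0ℝ} {p} p≥0 p≥0)
... | true  | false = ≤-termwise {p} {p + 0ℝ} λ n → ℚ.≤-reflexive (sym (ℚ.+-identityʳ (seq p n)))
... | false | true  = ≤-termwise {p} {0ℝ + p} λ n → ℚ.≤-reflexive (sym (ℚ.+-identityˡ (seq p n)))
... | false | false = ≤-termwise {0ℝ} {0ℝ + 0ℝ} λ _ → ℚ.≤-refl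

-- An odd number of hits on the support of `r` is at least one hit. The rows `e` are arbitrary
-- functions so that the induction on `r` can drop a coordinate.
union-bound : ∀ {A : Set} {n} (xs : List A) (p : A → ℝ) → (∀ x → 0ℝ ≤ p x) →
  (e : A → Fin n → Bool) (ε : ℝ) → (∀ i → ∑ xs (λ x → if e x i then p x else 0ℝ) ≤ ε) →
  ∀ r → ∑ xs (λ x → if dot (tabulate (e x)) r then p x else 0ℝ) ≤ ε * fromℕ (weight r)
union-bound xs p p≥0 e ε smooth [] = ≤-termwise {∑ xs (λ _ → 0ℝ)} {ε * fromℕ 0} λ n →
  ℚ.≤-reflexive (trans (seq-∑ xs (λ _ → 0ℝ) n) (trans (∑ℚ-0 xs) (sym (ℚ.*-zeroʳ (seq ε n)))))
union-bound xs p p≥0 e ε smooth (false ∷ r) = ≤-trans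
  {∑ xs (λ x → if dot (tabulate (e x)) (false ∷ r) then p x else 0ℝ)}
  {∑ xs (λ x → if dot (tabulate (e x ∘ suc)) r then p x else 0ℝ)}
  {ε * fromℕ (weight r)}
  (∑-mono-≤ xs (λ x → subst (λ b → (if b xor dot (tabulate (e x ∘ suc)) r then p x else 0ℝ) ≤
      (if dot (tabulate (e x ∘ suc)) r then p x else 0ℝ)) (sym (Bool.∧-zeroʳ (e x zero)))
    (≤-refl {if dot (tabulate (e x ∘ suc)) r then p x else 0ℝ})))
  (union-bound xs p p≥0 (λ x → e x ∘ suc) ε (smooth ∘ suc) r)
union-bound xs p p≥0 e ε smooth (true ∷ r) =
  ≤-trans {lhs} {∑ xs first + ∑ xs others} {ε * fromℕ (suc (weight r))}
    (≤-trans {lhs} {∑ xs (λ x → first x + others x)} {∑ xs first + ∑ xs others}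
      (∑-mono-≤ xs (λ x → if-xor-≤ (p≥0 x) (e x zero) true (dot (tabulate (e x ∘ suc)) r)))
      (≃⇒≤ {∑ xs (λ x → first x + others x)} {∑ xs first + ∑ xs others} (∑-+ xs first others)))
    (≤-trans {∑ xs first + ∑ xs others} {ε + ε * fromℕ (weight r)} {ε * fromℕ (suc (weight r))}
      (+-mono-≤ {∑ xs first} {ε} {∑ xs others} {ε * fromℕ (weight r)}
        (≤-trans {∑ xs first} {∑ xs (λ x → if e x zero then p x else 0ℝ)} {ε}
          (∑-mono-≤ xs (λ x → subst (λ b → first x ≤ (if b then p x else 0ℝ))
            (Bool.∧-identityʳ (e x zero)) (≤-refl {first x})))
          (smooth zero))
        (union-bound xs p p≥0 (λ x → e x ∘ suc) ε (smooth ∘ suc) r))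
      (≤-termwise {ε + ε * fromℕ (weight r)} {ε * fromℕ (suc (weight r))} λ n → ℚ.≤-reflexive
        (trans (solve 2 (λ ε w → ε :+ ε :* w := ε :* (con 1ℚ :+ w)) refl (seq ε n) (ι (weight r)))
          (cong (seq ε n ℚ.*_) (sym (ι-+ 1 (weight r)))))))
  where
  first others : _ → ℝ
  first x = if e x zero ∧ true then p x else 0ℝ
  others x = if dot (tabulate (e x ∘ suc)) r then p x else 0ℝ
  lhs : ℝ
  lhs = ∑ xs (λ x → if dot (tabulate (e x)) (true ∷ r) then p x else 0ℝ)

-- With `∣∣≤cut` this says that a coordinate of weight `p` contributes the cut metric, which turns
-- ℓ₁ distances into probabilities.
cut≤∣∣ : ∀ {p} a b → (if a xor b then p else 0ℝ) ≤ ∣ (if a then p else 0ℝ) - (if b then p else 0ℝ) ∣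
cut≤∣∣ {p} true  true  = ≤-termwise {0ℝ} {∣ p - p ∣} λ n → ℚ.0≤∣p∣ (seq p n ℚ.- seq p n)
cut≤∣∣ {p} true  false = ≤-termwise {p} {∣ p - 0ℝ ∣} λ n →
  subst (ℚ._≤ ℚ.∣ seq p n ℚ.- 0ℚ ∣) (ℚ.+-identityʳ (seq p n)) (p≤∣p∣ (seq p n ℚ.- 0ℚ))
cut≤∣∣ {p} false true  = ≤-termwise {p} {∣ 0ℝ - p ∣} λ n →
  subst₂ ℚ._≤_ (ℚ.+-identityʳ (seq p n)) (∣p-q∣≡∣q-p∣ (seq p n) 0ℚ) (p≤∣p∣ (seq p n ℚ.- 0ℚ))
cut≤∣∣ {p} false false = ≤-termwise {0ℝ} {∣ 0ℝ - 0ℝ ∣} λ n → ℚ.≤-refl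

∣∣≤cut : ∀ {p} → 0ℝ ≤ p → ∀ a b →
  ∣ (if a then p else 0ℝ) - (if b then p else 0ℝ) ∣ ≤ (if a xor b then p else 0ℝ)
∣∣≤cut {p} p≥0 true  true  = ≤-termwise {∣ p - p ∣} {0ℝ} λ n →
  ℚ.≤-reflexive (cong ℚ.∣_∣ (ℚ.+-inverseʳ (seq p n)))
∣∣≤cut {p} p≥0 true  false = ≤-trans {∣ p - 0ℝ ∣} {∣ p ∣} {p} (≤-termwise {∣ p - 0ℝ ∣} {∣ p ∣} λ n →
  ℚ.≤-reflexive (cong ℚ.∣_∣ (ℚ.+-identityʳ (seq p n)))) (0≤x⇒∣x∣≤x {p} p≥0)
∣∣≤cut {p} p≥0 false true  = ≤-trans {∣ 0ℝ - p ∣} {∣ p ∣} {p} (≤-termwise {∣ 0ℝ - p ∣} {∣ p ∣} λ n →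
  ℚ.≤-reflexive (trans (∣p-q∣≡∣q-p∣ 0ℚ (seq p n)) (cong ℚ.∣_∣ (ℚ.+-identityʳ (seq p n))))) (0≤x⇒∣x∣≤x {p} p≥0)
∣∣≤cut {p} p≥0 false false = ≤-termwise {∣ 0ℝ - 0ℝ ∣} {0ℝ} λ n → ℚ.≤-refl

foldr-lookup : ∀ {A : Set} (xs : List A) (q : A → ℝ) →
  Vector.foldr _+_ 0ℝ (λ i → q (List.lookup xs i)) ≡ ∑ xs q
foldr-lookup []       q = refl
foldr-lookup (x ∷ xs) q = cong (λ t → q x + t) (foldr-lookup xs q)

combination-closed : ∀ {n} (𝒞 : LinearCode n) {k} (v : Fin k → 𝔽₂^ n) → (∀ i → v i ∈ Codeword 𝒞) →
                     ∀ a → combination a v ∈ Codeword 𝒞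
combination-closed 𝒞 {zero}  v v∈𝒞 a = 𝟎-closed 𝒞
combination-closed 𝒞 {suc k} v v∈𝒞 a = ⊕-closed 𝒞 (scaled (a zero))
  (combination-closed 𝒞 (v ∘ suc) (v∈𝒞 ∘ suc) (a ∘ suc))
  where
  scaled : ∀ b → (b • v zero) ∈ Codeword 𝒞
  scaled true  = subst (_∈ Codeword 𝒞) (sym (true• (v zero))) (v∈𝒞 zero)
  scaled false = subst (_∈ Codeword 𝒞) (sym (false• (v zero))) (𝟎-closed 𝒞)

combination-𝟎 : ∀ {k n} a (v : Fin k → 𝔽₂^ n) → (∀ i → v i ≡ 𝟎) → combination a v ≡ 𝟎
combination-𝟎 {zero}  a v v≡𝟎 = refl
combination-𝟎 {suc k} a v v≡𝟎 = trans
  (cong₂ _⊕_ (trans (cong (a zero •_) (v≡𝟎 zero)) (•-𝟎 (a zero)))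
    (combination-𝟎 (a ∘ suc) (v ∘ suc) (v≡𝟎 ∘ suc)))
  (⊕-same 𝟎)

module CayleyGraphOfCode {n k : ℕ} (𝒞 : LinearCode n) (v : Fin k → 𝔽₂^ n) (v∈𝒞 : ∀ i → v i ∈ Codeword 𝒞)
  (v-independent : LinearlyIndependent v) (v-spans : Spans v (Codeword 𝒞)) where

  open ParityCheck (parityCheck v v-independent) public
    renaming (map to H; map-⊕ to H-⊕; onto to H-onto; map-v to H-v; kernel to H-kernel)

  codeword⇒H≡𝟎 : ∀ {c} → c ∈ Codeword 𝒞 → H c ≡ 𝟎
  codeword⇒H≡𝟎 c∈𝒞 =
    let a , eq = v-spans c∈𝒞
    in trans (cong H (sym eq)) (trans (additive-combination H-⊕ a v) (combination-𝟎 a (H ∘ v) H-v))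

  H≡𝟎⇒codeword : ∀ c → H c ≡ 𝟎 → c ∈ Codeword 𝒞
  H≡𝟎⇒codeword c Hc≡𝟎 =
    let a , eq = H-kernel c Hc≡𝟎
    in subst (_∈ Codeword 𝒞) eq (combination-closed 𝒞 v v∈𝒞 a)

  S : Fin n → 𝔽₂^ h
  S = H ∘ unit

  S-spans : Spans S (λ _ → ⊤)
  S-spans {y} _ =
    let x , Hx≡y = H-onto y
    in lookup x , trans (sym (additive≡syndrome H-⊕ x)) Hx≡y

  leader : 𝔽₂^ h → 𝔽₂^ n
  leader = cosetLeader H H-onto

  ρ : 𝔽₂^ h → 𝔽₂^ h → ℕ
  ρ x y = weight (leader (x ⊕ y))

  ρ-shortest : IsShortestPathMetric (Cay h S) ρ
  ρ-shortest x y =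
    vector⇒walk S (leader (x ⊕ y))
      (trans (sym (additive≡syndrome H-⊕ (leader (x ⊕ y)))) (H-cosetLeader H H-onto (x ⊕ y))) ,
    λ ℓ w → let a , σa≡x⊕y , wa≤ℓ = walk⇒vector S w in
      ℕ.≤-trans (cosetLeader-minimal H H-onto a (trans (additive≡syndrome H-⊕ a) σa≡x⊕y)) wa≤ℓ

  -- The translates `r ⊕ c` by codewords fill the fibre of `H` over `y`, so the nearest codeword
  -- differs from `r` by the coset leader.
  leader-distance : ∀ r {y} → H r ≡ y → IsDistanceTo r 𝒞 (weight (leader y))
  leader-distance r {y} Hr≡y =
    (r ⊕ leader y , H≡𝟎⇒codeword _ (trans (H-⊕ r (leader y))
      (trans (cong₂ _⊕_ Hr≡y (H-cosetLeader H H-onto y)) (⊕-same y))) ,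
      cong weight (⊕-cancelˡ r (leader y))) ,
    λ c c∈𝒞 → cosetLeader-minimal H H-onto (r ⊕ c)
      (trans (H-⊕ r c) (trans (cong₂ _⊕_ Hr≡y (codeword⇒H≡𝟎 c∈𝒞)) (⊕-identityʳ y)))

  module _ (𝒟 : LocalTester 𝒞) where

    section : 𝔽₂^ h → 𝔽₂^ n
    section y = proj₁ (H-onto y)

    -- Vectors outside the dual code also get a coordinate, but of probability zero; the others do
    -- not depend on the preimage chosen by `section`.
    embedding : 𝔽₂^ h → Fin (List.length (allVectors n)) → ℝ
    embedding x i = let α = List.lookup (allVectors n) i in if dot α (section x) then prob 𝒟 α else 0ℝ

    section-⊕ : ∀ x y → H (section x ⊕ section y) ≡ x ⊕ y
    section-⊕ x y = trans (H-⊕ (section x) (section y)) (cong₂ _⊕_ (proj₂ (H-onto x)) (proj₂ (H-onto y)))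

    private
      gap : 𝔽₂^ h → 𝔽₂^ h → 𝔽₂^ n → ℝ
      gap x y α = ∣ (if dot α (section x) then prob 𝒟 α else 0ℝ) -
                    (if dot α (section y) then prob 𝒟 α else 0ℝ) ∣

      distance-∑ : ∀ x y → ℓ₁-distance (embedding x) (embedding y) ≡ ∑ (allVectors n) (gap x y)
      distance-∑ x y = foldr-lookup (allVectors n) (gap x y)

    Pr≤distance : ∀ x y → Pr 𝒟 (λ α → dot α (section x ⊕ section y)) ≤ ℓ₁-distance (embedding x) (embedding y)
    Pr≤distance x y = subst (Pr 𝒟 (λ α → dot α (section x ⊕ section y)) ≤_) (sym (distance-∑ x y))
      (∑-mono-≤ (allVectors n) λ α → subst (λ b → (if b then prob 𝒟 α else 0ℝ) ≤ gap x y α)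
        (sym (dot-⊕ʳ α (section x) (section y))) (cut≤∣∣ (dot α (section x)) (dot α (section y))))

    distance≤Pr : ∀ x y → ℓ₁-distance (embedding x) (embedding y) ≤ Pr 𝒟 (λ α → dot α (section x ⊕ section y))
    distance≤Pr x y = subst (_≤ Pr 𝒟 (λ α → dot α (section x ⊕ section y))) (sym (distance-∑ x y))
      (∑-mono-≤ (allVectors n) λ α → subst (λ b → gap x y α ≤ (if b then prob 𝒟 α else 0ℝ))
        (sym (dot-⊕ʳ α (section x) (section y)))
        (∣∣≤cut (nonNegative 𝒟 α) (dot α (section x)) (dot α (section y))))

    Pr-coset : ∀ r s → H r ≡ H s → Pr 𝒟 (λ α → dot α r) ≤ Pr 𝒟 (λ α → dot α s)
    Pr-coset r s Hr≡Hs = ∑-mono-≤ (allVectors n) compare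
      where
      r⊕s∈𝒞 : (r ⊕ s) ∈ Codeword 𝒞
      r⊕s∈𝒞 = H≡𝟎⇒codeword (r ⊕ s) (trans (H-⊕ r s) (trans (cong (_⊕ H s) Hr≡Hs) (⊕-same (H s))))
      compare : ∀ α → (if dot α r then prob 𝒟 α else 0ℝ) ≤ (if dot α s then prob 𝒟 α else 0ℝ)
      -- Membership in the dual code quantifies over all codewords; orthogonality to the basis
      -- decides it.
      compare α with Fin.all? (λ i → dot α (v i) Bool.≟ false)
      ... | yes orth = subst
        (λ b → (if b then prob 𝒟 α else 0ℝ) ≤ (if dot α s then prob 𝒟 α else 0ℝ)) (sym same)
        (≤-refl {if dot α s then prob 𝒟 α else 0ℝ})
        where
        α-⊥ : dot α (r ⊕ s) ≡ false
        α-⊥ = let a , eq = v-spans r⊕s∈𝒞 in trans (cong (dot α) (sym eq)) (dot-combination α a v orth)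
        same : dot α r ≡ dot α s
        same = begin
          dot α r                                ≡⟨ cong (dot α) (⊕-cancelʳ r s) ⟨
          dot α ((r ⊕ s) ⊕ s)                    ≡⟨ dot-⊕ʳ α (r ⊕ s) s ⟩
          dot α (r ⊕ s) xor dot α s              ≡⟨ cong (_xor dot α s) α-⊥ ⟩
          dot α s                                ∎
          where open ≡-Reasoning
      ... | no ¬orth = negligible (dot α r) (dot α s)
        where
        p≃0 : prob 𝒟 α ≃ 0ℝ
        p≃0 = supported 𝒟 α λ α∈𝒞⊥ → ¬orth (λ i → α∈𝒞⊥ (v i) (v∈𝒞 i))
        negligible : ∀ a b → (if a then prob 𝒟 α else 0ℝ) ≤ (if b then prob 𝒟 α else 0ℝ)
        negligible true  true  = ≤-refl {prob 𝒟 α}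
        negligible true  false = ≃⇒≤ {prob 𝒟 α} {0ℝ} p≃0
        negligible false true  = nonNegative 𝒟 α
        negligible false false = ≤-refl {0ℝ}

    Pr≤weight : ∀ {ε} → IsSmooth 𝒟 ε → ∀ r → Pr 𝒟 (λ α → dot α r) ≤ ε * fromℕ (weight r)
    Pr≤weight {ε} smooth r = subst (_≤ ε * fromℕ (weight r))
      (cong (List.foldr _+_ 0ℝ) (List.map-cong
        (λ α → cong (λ β → if dot β r then prob 𝒟 α else 0ℝ) (Vec.tabulate∘lookup α)) (allVectors n)))
      (union-bound (allVectors n) (prob 𝒟) (nonNegative 𝒟) lookup ε smooth r)

    -- Soundness applies to any representative of the coset `x ⊕ y`, whereas the union bound needs
    -- the lightest one; `Pr-coset` permits the exchange. The scale of the embedding is `δ`.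
    embeds : ∀ {C ε δ} (δ>0 : 0ℝ < δ) → IsSmooth 𝒟 ε → HasSoundness 𝒟 δ → ε ÷ δ [ δ>0 ] ≤ C →
             EmbedsIntoℓ₁ (𝔽₂^ h) (λ x y → fromℕ (ρ x y)) C
    embeds {C} {ε} {δ} δ>0 smooth sound ε/δ≤C = _ , embedding , δ , δ>0 , λ x y →
      let
        s = section x ⊕ section y
        l = leader (x ⊕ y)
        d = ℓ₁-distance (embedding x) (embedding y)
      in
      ≤-trans {δ * fromℕ (ρ x y)} {Pr 𝒟 (λ α → dot α s)} {d}
        (sound s (ρ x y) (leader-distance s (section-⊕ x y))) (Pr≤distance x y) ,
      ≤-trans {d} {Pr 𝒟 (λ α → dot α s)} {C * δ * fromℕ (ρ x y)} (distance≤Pr x y)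
        (≤-trans {Pr 𝒟 (λ α → dot α s)} {Pr 𝒟 (λ α → dot α l)} {C * δ * fromℕ (ρ x y)}
          (Pr-coset s l (trans (section-⊕ x y) (sym (H-cosetLeader H H-onto (x ⊕ y)))))
          (≤-trans {Pr 𝒟 (λ α → dot α l)} {ε * fromℕ (ρ x y)} {C * δ * fromℕ (ρ x y)}
            (Pr≤weight {ε} smooth l)
            (*-monoˡ-≤-fromℕ {ε} {C * δ} (ρ x y) (≤-trans {ε} {δ * C} {C * δ}
              (÷≤⇒≤* {ε} {C} {δ} δ>0 ε/δ≤C) (≃⇒≤ {δ * C} {C * δ} (*-comm δ C))))))

  module _ {c : ℝ} (c>0 : 0ℝ < c) (k≃n-clog : fromℕ k ≃ fromℕ n - c * log₂ n) where

    clog≃h : c * log₂ n ≃ fromℕ h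
    clog≃h = codimension⁺ {k} {h} {n} {c * log₂ n} dim k≃n-clog

    n≡2^h/c : .{{_ : ℕ.NonZero n}} → n ≡2^ fromℕ h ÷ c [ c>0 ]
    n≡2^h/c = ≃log₂⇒≡2^ n {fromℕ h ÷ c [ c>0 ]}
      (≃-trans {fromℕ h ÷ c [ c>0 ]} {(c * log₂ n) ÷ c [ c>0 ]} {log₂ n}
        (÷-cong {fromℕ h} {c * log₂ n} c c>0 (≃-sym {c * log₂ n} {fromℕ h} clog≃h))
        (*-÷-cancel c c>0 (log₂ n)))

    codimension>threshold : ∀ {N} → logThreshold {c} c>0 N ℕ.< n → N ℕ.< h
    codimension>threshold {N} threshold<n = logThreshold-< {c} c>0 N {n} {h} threshold<n clog≃h

graph-of-code : ∀ {d c C n k N} (c>0 : 0ℝ < c) (𝒞 : LinearCode n) →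
  HasDimension 𝒞 k → HasDistance 𝒞 d → fromℕ k ≃ fromℕ n - c * log₂ n →
  (𝒟 : LocalTester 𝒞) (ε δ : ℝ) (δ>0 : 0ℝ < δ) → IsSmooth 𝒟 ε → HasSoundness 𝒟 δ → ε ÷ δ [ δ>0 ] ≤ C →
  logThreshold {c} c>0 N ℕ.< n →
  Σ[ h ∈ ℕ ] N ℕ.< h × (Σ[ n ∈ ℕ ] Σ[ S ∈ (Fin n → 𝔽₂^ h) ]
    Spans S (λ _ → ⊤) × n ≡2^ fromℕ h ÷ c [ c>0 ] × WiseIndependent d S ×
    (Σ[ ρ ∈ (𝔽₂^ h → 𝔽₂^ h → ℕ) ]
      IsShortestPathMetric (Cay h S) ρ ×
      EmbedsIntoℓ₁ (𝔽₂^ h) (λ x y → fromℕ (ρ x y)) C))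
graph-of-code {d} {c} {C} {n} {k} {N} c>0 𝒞 (v , v∈𝒞 , v-indep , v-spans) dist k≃n-clog
  𝒟 ε δ δ>0 smooth sound ratio n₀<n =
    h , codimension>threshold {c} c>0 k≃n-clog n₀<n , n , S , (λ {y} → S-spans {y}) ,
    n≡2^h/c {c} c>0 k≃n-clog {{ℕ.>-nonZero (ℕ.≤-trans (ℕ.s≤s ℕ.z≤n) n₀<n)}} ,
    distance⇒wiseIndependent H H-⊕ (λ x Hx≡𝟎 → dist x (H≡𝟎⇒codeword x Hx≡𝟎)) ,
    ρ , ρ-shortest , embeds 𝒟 {C} {ε} {δ} δ>0 smooth sound ratio
  where open CayleyGraphOfCode 𝒞 v v∈𝒞 v-indep v-spans

codes⇒graphs : ∀ d c (c>0 : 0ℝ < c) → SmoothTestableCodes d c → ℓ₁-EmbeddableCayleyGraphs d c c>0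
codes⇒graphs d c c>0 (C , codes) = C , λ N → let
  n , n₀<n , 𝒞 , k , dim , dist , k≃n-clog , 𝒟 , ε , δ , δ>0 , smooth , sound , ratio =
    codes (logThreshold {c} c>0 N)
  in graph-of-code {d} {c} {C} {n} {k} {N} c>0 𝒞 dim dist k≃n-clog 𝒟 ε δ δ>0 smooth sound ratio n₀<n

-- From graphs to codes

∑-cong-≡ : ∀ {A : Set} (xs : List A) {f g : A → ℝ} → (∀ x → f x ≡ g x) → ∑ xs f ≡ ∑ xs g
∑-cong-≡ xs f≡g = cong (List.foldr _+_ 0ℝ) (List.map-cong f≡g xs)

∑-const : ∀ n a → ∑ (allVectors n) (λ _ → a) ≃ fromℚ (cubeSize n) * a
∑-const n a = ≃-termwise {∑ (allVectors n) (λ _ → a)} {fromℚ (cubeSize n) * a} λ k → begin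
  seq (∑ (allVectors n) (λ _ → a)) k        ≡⟨ seq-∑ (allVectors n) (λ _ → a) k ⟩
  ∑ℚ (allVectors n) (λ _ → seq a k)         ≡⟨ ∑ℚ-cong (allVectors n) (λ _ → ℚ.*-identityʳ (seq a k)) ⟨
  ∑ℚ (allVectors n) (λ _ → seq a k ℚ.* 1ℚ)  ≡⟨ ∑ℚ-*ˡ (seq a k) (allVectors n) (λ _ → 1ℚ) ⟩
  seq a k ℚ.* cubeSize n                    ≡⟨ ℚ.*-comm (seq a k) (cubeSize n) ⟩
  cubeSize n ℚ.* seq a k                    ∎
  where open ≡-Reasoning

cubeSize>0 : ∀ n → 0ℚ ℚ.< cubeSize n
cubeSize>0 zero    = ℚ.positive⁻¹ 1ℚ
cubeSize>0 (suc n) = subst (0ℚ ℚ.<_) (sym (∑-cube {n} (λ _ → 1ℚ))) (ℚ.+-mono-< (cubeSize>0 n) (cubeSize>0 n))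

fromℚ>0 : ∀ {q} → 0ℚ ℚ.< q → 0ℝ < fromℚ q
fromℚ>0 {q} q>0 = q ℚ.* ½ , half-pos q>0 , 0 , λ _ _ →
  subst₂ ℚ._<_ (sym (ℚ.+-identityˡ (q ℚ.* ½))) (halves q)
    (p<p+ε (q ℚ.* ½) (half-pos q>0))

module CodeOfCayleyGraph {h n : ℕ} (S : Fin n → 𝔽₂^ h) (S-spans : Spans S (λ _ → ⊤)) where

  σ : 𝔽₂^ n → 𝔽₂^ h
  σ = syndrome S

  σ-⊕ : Additive σ
  σ-⊕ = syndrome-⊕ S

  𝒞 : LinearCode n
  𝒞 = record
    { Codeword = λ x → σ x ≡ 𝟎
    ; 𝟎-closed = additive-𝟎 σ-⊕
    ; ⊕-closed = λ {x} {y} σx≡𝟎 σy≡𝟎 → trans (σ-⊕ x y) (trans (cong₂ _⊕_ σx≡𝟎 σy≡𝟎) (⊕-same 𝟎))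
    }

  σ-onto : ∀ y → ∃[ x ] σ x ≡ y
  σ-onto y = let a , eq = S-spans {y} _ in tabulate a , trans (syndrome-tabulate S a) eq

  open Kernel (kernel-of-surjection h σ σ-⊕ σ-onto) public
    using (k; dim)
    renaming (map to K; map-⊕ to K-⊕; injective to K-injective; L-map to σ-K; kernel to K-onto)

  dimension : HasDimension 𝒞 k
  dimension = K ∘ unit , (λ i → σ-K (unit i)) , independent ,
    λ {x} σx≡𝟎 → let z , Kz≡x = K-onto x σx≡𝟎 in lookup z , trans (sym (additive≡syndrome K-⊕ z)) Kz≡x
    where
    independent : LinearlyIndependent (K ∘ unit)
    independent a eq i = begin
      a i                   ≡⟨ Vec.lookup∘tabulate a i ⟨
      lookup (tabulate a) i ≡⟨ cong (λ t → lookup t i) (combination-unit a) ⟨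
      lookup (combination a unit) i
        ≡⟨ cong (λ t → lookup t i) (K-injective _ (trans (additive-combination K-⊕ a unit) eq)) ⟩
      lookup 𝟎 i            ≡⟨ Vec.lookup-replicate i false ⟩
      false                 ∎
      where open ≡-Reasoning

  transpose-⊥ : ∀ β → transpose S β ∈ 𝒞 ⊥
  transpose-⊥ β c σc≡𝟎 = trans (dot-transpose S β c) (trans (cong (dot β) σc≡𝟎) (dot-𝟎ʳ β))

  module _ {ρ : 𝔽₂^ h → 𝔽₂^ h → ℕ} (ρ-shortest : IsShortestPathMetric (Cay h S) ρ) where

    -- With `ρ-achieved` this identifies the distance, for every `z`, with the least weight of a
    -- vector of syndrome `x`: the metric is translation invariant.
    ρ≤weight : ∀ z a {x} → σ a ≡ x → ρ (z ⊕ x) z ℕ.≤ weight a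
    ρ≤weight z a {x} σa≡x = proj₂ (ρ-shortest (z ⊕ x) z) (weight a) (vector⇒walk S a
      (trans σa≡x (sym (trans (cong (_⊕ z) (⊕-comm z x)) (⊕-cancelʳ x z)))))

    ρ-achieved : ∀ z x → ∃[ a ] σ a ≡ x × weight a ℕ.≤ ρ (z ⊕ x) z
    ρ-achieved z x = let a , σa≡ , wa≤ = walk⇒vector S (proj₁ (ρ-shortest (z ⊕ x) z)) in
      a , trans σa≡ (trans (cong (_⊕ z) (⊕-comm z x)) (⊕-cancelʳ x z)) , wa≤

    ρ≡distance : ∀ {r m} → IsDistanceTo r 𝒞 m → ∀ z → ρ (z ⊕ σ r) z ≡ m
    ρ≡distance {r} {m} ((c , σc≡𝟎 , d≡m) , minimal) z = ℕ.≤-antisym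
      (ℕ.≤-trans (ρ≤weight z (r ⊕ c) (trans (σ-⊕ r c) (trans (cong (σ r ⊕_) σc≡𝟎) (⊕-identityʳ (σ r)))))
        (ℕ.≤-reflexive d≡m))
      (let a , σa≡σr , wa≤ρ = ρ-achieved z (σ r) in
        ℕ.≤-trans (minimal (r ⊕ a) (trans (σ-⊕ r a) (trans (cong (σ r ⊕_) σa≡σr) (⊕-same (σ r)))))
          (ℕ.≤-trans (ℕ.≤-reflexive (cong weight (⊕-cancelˡ r a))) wa≤ρ))

    ρ-generator≤1 : ∀ z i → ρ (z ⊕ S i) z ℕ.≤ 1
    ρ-generator≤1 z i = ℕ.≤-trans (ρ≤weight z (unit i) (syndrome-at-unit S i)) (ℕ.≤-reflexive (weight-unit i))

    0<ρ : ∀ z {x} → x ≢ 𝟎 → 0 ℕ.< ρ (z ⊕ x) z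
    0<ρ z {x} x≢𝟎 = ℕ.≰⇒> λ ρ≤0 →
      let a , σa≡x , wa≤ρ = ρ-achieved z x in
      x≢𝟎 (trans (sym σa≡x) (trans (cong σ (weight≡0⇒𝟎 a (ℕ.n≤0⇒n≡0 (ℕ.≤-trans wa≤ρ ρ≤0)))) (additive-𝟎 σ-⊕)))

    module Tester {m : ℕ} (f : 𝔽₂^ h → Fin m → ℝ) (C α : ℝ) (α>0 : 0ℝ < α)
      (lower : ∀ x y → α * fromℕ (ρ x y) ≤ ℓ₁-distance (f x) (f y))
      (upper : ∀ x y → ℓ₁-distance (f x) (f y) ≤ C * α * fromℕ (ρ x y))
      (x₀ : 𝔽₂^ h) (x₀≢𝟎 : x₀ ≢ 𝟎) where

      X : List (𝔽₂^ h)
      X = allVectors h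

      -- One factor `N` of `base` comes from Fourier inversion, the other from summing the bound `α`
      -- over all translations `z`.
      N base W : ℝ
      N    = fromℚ (cubeSize h)
      base = N * (N * α)
      W    = ∑ X (cutWeight f)

      average : 𝔽₂^ h → ℝ
      average x = N * ∑ X (λ z → ℓ₁-distance (f (z ⊕ x)) (f z))

      N>0 : 0ℝ < N
      N>0 = fromℚ>0 (cubeSize>0 h)

      average-lower : ∀ x k → (∀ z → k ℕ.≤ ρ (z ⊕ x) z) → base * fromℕ k ≤ average x
      average-lower x k k≤ρ = ≤-trans {base * fromℕ k} {N * (N * (α * fromℕ k))} {average x}
        (≤-termwise {base * fromℕ k} {N * (N * (α * fromℕ k))} λ j → ℚ.≤-reflexive
          (solve 3 (λ N α k → (N :* (N :* α)) :* k := N :* (N :* (α :* k))) refl (cubeSize h) (seq α j) (ι k)))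
        (*-monoʳ-≤ {N * (α * fromℕ k)} {∑ X (λ z → ℓ₁-distance (f (z ⊕ x)) (f z))} {N} N>0
          (≤-trans {N * (α * fromℕ k)} {∑ X (λ _ → α * fromℕ k)} {∑ X (λ z → ℓ₁-distance (f (z ⊕ x)) (f z))}
            (≃⇒≤ {N * (α * fromℕ k)} {∑ X (λ _ → α * fromℕ k)}
              (≃-sym {∑ X (λ _ → α * fromℕ k)} {N * (α * fromℕ k)} (∑-const h (α * fromℕ k))))
            (∑-mono-≤ X λ z → ≤-trans {α * fromℕ k} {α * fromℕ (ρ (z ⊕ x) z)} {ℓ₁-distance (f (z ⊕ x)) (f z)}
              (*-monoʳ-≤ {fromℕ k} {fromℕ (ρ (z ⊕ x) z)} {α} α>0
                (≤-termwise {fromℕ k} {fromℕ (ρ (z ⊕ x) z)} λ _ → ι-mono-≤ (k≤ρ z)))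
              (lower (z ⊕ x) z))))

      -- The absolute value gives one bound for both distances: at distance 0 the right-hand side
      -- must still be nonnegative.
      average-upper : ∀ x → (∀ z → ρ (z ⊕ x) z ℕ.≤ 1) → average x ≤ ∣ C ∣ * base
      average-upper x ρ≤1 = ≤-trans {average x} {N * (N * (∣ C ∣ * α))} {∣ C ∣ * base}
        (*-monoʳ-≤ {∑ X (λ z → ℓ₁-distance (f (z ⊕ x)) (f z))} {N * (∣ C ∣ * α)} {N} N>0
          (≤-trans {∑ X (λ z → ℓ₁-distance (f (z ⊕ x)) (f z))} {∑ X (λ _ → ∣ C ∣ * α)} {N * (∣ C ∣ * α)}
            (∑-mono-≤ X λ z → ≤-trans {ℓ₁-distance (f (z ⊕ x)) (f z)} {C * α * fromℕ (ρ (z ⊕ x) z)} {∣ C ∣ * α}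
              (upper (z ⊕ x) z) (short (ρ≤1 z)))
            (≃⇒≤ {∑ X (λ _ → ∣ C ∣ * α)} {N * (∣ C ∣ * α)} (∑-const h (∣ C ∣ * α)))))
        (≤-termwise {N * (N * (∣ C ∣ * α))} {∣ C ∣ * base} λ j → ℚ.≤-reflexive
          (solve 3 (λ N C α → N :* (N :* (C :* α)) := C :* (N :* (N :* α))) refl
            (cubeSize h) ℚ.∣ seq C j ∣ (seq α j)))
        where
        short : ∀ {k} → k ℕ.≤ 1 → C * α * fromℕ k ≤ ∣ C ∣ * α
        short {zero} _ = ≤-eventually {C * α * fromℕ 0} {∣ C ∣ * α} (eventually-map
          (λ {j} αj>0 → ℚ.≤-trans (ℚ.≤-reflexive
              (trans (ℚ.*-zeroʳ (seq C j ℚ.* seq α j)) (sym (ℚ.*-zeroˡ (seq α j)))))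
            (ℚ.*-monoʳ-≤-nonNeg (seq α j) {{ℚ.nonNegative (ℚ.<⇒≤ αj>0)}} (ℚ.0≤∣p∣ (seq C j))))
          (eventually-positive {α} α>0))
        short {suc zero} _ = ≤-eventually {C * α * fromℕ 1} {∣ C ∣ * α} (eventually-map
          (λ {j} αj>0 → ℚ.≤-trans (ℚ.≤-reflexive (ℚ.*-identityʳ (seq C j ℚ.* seq α j)))
            (ℚ.*-monoʳ-≤-nonNeg (seq α j) {{ℚ.nonNegative (ℚ.<⇒≤ αj>0)}} (p≤∣p∣ (seq C j))))
          (eventually-positive {α} α>0))
        short {suc (suc _)} (ℕ.s≤s ())

      base>0 : 0ℝ < base
      base>0 = 0<x*y {N} {N * α} N>0 (0<x*y {N} {α} N>0 α>0)

      -- Normalisation requires positive total weight. The nonzero `x₀` is at distance at least 1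
      -- from `𝟎`, so the cuts separating it from `𝟎` already weigh at least `base`.
      W>0 : 0ℝ < W
      W>0 = <-≤-trans {0ℝ} {base} {W} base>0
        (≤-trans {base} {average x₀} {W}
          (≤-trans {base} {base * fromℕ 1} {average x₀}
            (≤-termwise {base} {base * fromℕ 1} λ j → ℚ.≤-reflexive (sym (ℚ.*-identityʳ (seq base j))))
            (average-lower x₀ 1 (λ z → 0<ρ z x₀≢𝟎)))
          (≤-trans {average x₀} {cut} {W}
            (≃⇒≤ {average x₀} {cut} (≃-sym {cut} {average x₀} (∑-cutWeight f x₀)))
            (∑-mono-≤ X λ β → drop (cutWeight f β) (cutWeight-nonNeg f β) (dot β x₀))))
        where
        cut : ℝ
        cut = ∑ X (λ β → if dot β x₀ then cutWeight f β else 0ℝ)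
        drop : ∀ w → (∀ n → 0ℚ ℚ.≤ seq w n) → ∀ b → (if b then w else 0ℝ) ≤ w
        drop w w≥0 true  = ≤-refl {w}
        drop w w≥0 false = ≤-termwise {0ℝ} {w} w≥0

      μ : 𝔽₂^ n → ℝ
      μ = pushforward X (transpose S) (cutWeight f)

      density : 𝔽₂^ n → ℝ
      density a = μ a ÷ W [ W>0 ]

      density-supported : ∀ a → a ∉ 𝒞 ⊥ → density a ≃ 0ℝ
      density-supported a a∉𝒞⊥ = ≃-termwise {density a} {0ℝ} λ j → trans
        (cong (ℚ._* seq (W ⁻¹[ W>0 ]) j) (trans (seq-∑ X _ j)
          (trans (∑ℚ-cong X (λ β → vanish β j)) (∑ℚ-0 X))))
        (ℚ.*-zeroˡ (seq (W ⁻¹[ W>0 ]) j))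
        where
        vanish : ∀ β j → seq (if does (transpose S β ≟ a) then cutWeight f β else 0ℝ) j ≡ 0ℚ
        vanish β j with transpose S β ≟ a
        ... | yes eq = contradiction (subst (_∈ 𝒞 ⊥) eq (transpose-⊥ β)) a∉𝒞⊥
        ... | no  _  = refl

      density-nonNeg : ∀ a → 0ℝ ≤ density a
      density-nonNeg a = ≤-termwise {0ℝ} {density a} λ j →
        subst (ℚ._≤ seq (density a) j) (ℚ.*-zeroˡ (seq (W ⁻¹[ W>0 ]) j))
          (ℚ.*-monoʳ-≤-nonNeg (seq (W ⁻¹[ W>0 ]) j) {{ℚ.nonNegative (ℚ.<⇒≤ (0<⁻¹-termwise W W>0 j))}}
            (subst (0ℚ ℚ.≤_) (sym (seq-∑ X _ j)) (∑ℚ-nonNeg X (λ β → kept (does (transpose S β ≟ a)) β j))))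
        where
        kept : ∀ b β j → 0ℚ ℚ.≤ seq (if b then cutWeight f β else 0ℝ) j
        kept true  β j = cutWeight-nonNeg f β j
        kept false β j = ℚ.≤-refl

      density-total : sumOver density ≃ 1ℝ
      density-total = ≃-trans {sumOver density} {W ÷ W [ W>0 ]} {1ℝ}
        (∑-pushforward X (transpose S) (cutWeight f) (W ⁻¹[ W>0 ]) (λ _ → true))
        (≃-eventually {W ÷ W [ W>0 ]} {1ℝ}
          (eventually-map (λ {j} eq → trans (ℚ.*-comm (seq W j) _) eq) (⁻¹-inverse W W>0)))

      𝒟 : LocalTester 𝒞
      𝒟 = record
        { prob        = density
        ; nonNegative = density-nonNeg
        ; total       = density-total
        ; supported   = density-supported
        }

      -- Smoothness and soundness concern events of one kind: reading coordinate `i` is the cut by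
      -- `S i`, and testing `r` is the cut by `σ r`.
      Pr-cut : ∀ (e : 𝔽₂^ n → Bool) x → (∀ β → e (transpose S β) ≡ dot β x) →
               Pr 𝒟 e ≃ average x ÷ W [ W>0 ]
      Pr-cut e x e≡ = ≃-trans {Pr 𝒟 e}
        {∑ X (λ β → if dot β x then cutWeight f β else 0ℝ) ÷ W [ W>0 ]}
        {average x ÷ W [ W>0 ]}
        (subst (λ s → Pr 𝒟 e ≃ s ÷ W [ W>0 ])
          (∑-cong-≡ X (λ β → cong (λ b → if b then cutWeight f β else 0ℝ) (e≡ β)))
          (∑-pushforward X (transpose S) (cutWeight f) (W ⁻¹[ W>0 ]) e))
        (÷-cong {∑ X (λ β → if dot β x then cutWeight f β else 0ℝ)} {average x} W W>0 (∑-cutWeight f x))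

      δ ε : ℝ
      δ = base ÷ W [ W>0 ]
      ε = ∣ C ∣ * δ

      δ>0 : 0ℝ < δ
      δ>0 = 0<x*y {base} {W ⁻¹[ W>0 ]} base>0 (0<⁻¹ W W>0)

      smooth : IsSmooth 𝒟 ε
      smooth i = ≤-trans {Pr 𝒟 (λ a → lookup a i)} {average (S i) ÷ W [ W>0 ]} {ε}
        (≃⇒≤ {Pr 𝒟 (λ a → lookup a i)} {average (S i) ÷ W [ W>0 ]}
          (Pr-cut (λ a → lookup a i) (S i) (λ β → Vec.lookup∘tabulate (λ i → dot β (S i)) i)))
        (≤-trans {average (S i) ÷ W [ W>0 ]} {(∣ C ∣ * base) ÷ W [ W>0 ]} {ε}
          (÷-mono-≤ {average (S i)} {∣ C ∣ * base} W W>0 (average-upper (S i) (λ z → ρ-generator≤1 z i)))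
          (≤-termwise {(∣ C ∣ * base) ÷ W [ W>0 ]} {ε} λ j → ℚ.≤-reflexive
            (ℚ.*-assoc ℚ.∣ seq C j ∣ (seq base j) (seq (W ⁻¹[ W>0 ]) j))))

      sound : HasSoundness 𝒟 δ
      sound r d dist = ≤-trans {δ * fromℕ d} {(base * fromℕ d) ÷ W [ W>0 ]} {Pr 𝒟 (λ a → dot a r)}
        (≤-termwise {δ * fromℕ d} {(base * fromℕ d) ÷ W [ W>0 ]} λ j → ℚ.≤-reflexive
          (solve 3 (λ b w d → (b :* w) :* d := (b :* d) :* w) refl (seq base j) (seq (W ⁻¹[ W>0 ]) j) (ι d)))
        (≤-trans {(base * fromℕ d) ÷ W [ W>0 ]} {average (σ r) ÷ W [ W>0 ]} {Pr 𝒟 (λ a → dot a r)}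
          (÷-mono-≤ {base * fromℕ d} {average (σ r)} W W>0
            (average-lower (σ r) d (λ z → ℕ.≤-reflexive (sym (ρ≡distance {r} {d} dist z)))))
          (≃⇒≤ {average (σ r) ÷ W [ W>0 ]} {Pr 𝒟 (λ a → dot a r)}
            (≃-sym {Pr 𝒟 (λ a → dot a r)} {average (σ r) ÷ W [ W>0 ]}
              (Pr-cut (λ a → dot a r) (σ r) (λ β → dot-transpose S β r)))))

      ratio : ε ÷ δ [ δ>0 ] ≤ ∣ C ∣
      ratio = ≤-trans {ε ÷ δ [ δ>0 ]} {(δ * ∣ C ∣) ÷ δ [ δ>0 ]} {∣ C ∣}
        (÷-mono-≤ {ε} {δ * ∣ C ∣} δ δ>0 (≃⇒≤ {ε} {δ * ∣ C ∣} (*-comm ∣ C ∣ δ)))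
        (≃⇒≤ {(δ * ∣ C ∣) ÷ δ [ δ>0 ]} {∣ C ∣} (*-÷-cancel δ δ>0 ∣ C ∣))

  k≃n-clog : ∀ {c} (c>0 : 0ℝ < c) .{{_ : ℕ.NonZero n}} → n ≡2^ fromℕ h ÷ c [ c>0 ] →
             fromℕ k ≃ fromℕ n - c * log₂ n
  k≃n-clog {c} c>0 n≡2^ = codimension⁻ {k} {h} {n} {c * log₂ n} dim
    (≃-trans {c * log₂ n} {c * (fromℕ h ÷ c [ c>0 ])} {fromℕ h}
      (≃-sym {c * (fromℕ h ÷ c [ c>0 ])} {c * log₂ n}
        (*-congˡ {fromℕ h ÷ c [ c>0 ]} {log₂ n} {c} c>0 (≡2^⇒≃log₂ n {fromℕ h ÷ c [ c>0 ]} n≡2^)))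
      (÷-*-cancel c c>0 (fromℕ h)))

unit-nonzero : ∀ {n} → 0 ℕ.< n → ∃[ x ] x ≢ 𝟎 {n}
unit-nonzero {suc n} _ = unit zero , λ ()

code-of-graph : ∀ {d c C h n N} (c>0 : 0ℝ < c) (S : Fin n → 𝔽₂^ h) → Spans S (λ _ → ⊤) →
  n ≡2^ fromℕ h ÷ c [ c>0 ] → WiseIndependent d S →
  (ρ : 𝔽₂^ h → 𝔽₂^ h → ℕ) → IsShortestPathMetric (Cay h S) ρ →
  EmbedsIntoℓ₁ (𝔽₂^ h) (λ x y → fromℕ (ρ x y)) C → powerThreshold c N ℕ.< h →
  N ℕ.< n × (Σ[ 𝒞 ∈ LinearCode n ] Σ[ k ∈ ℕ ]
    HasDimension 𝒞 k × HasDistance 𝒞 d × fromℕ k ≃ fromℕ n - c * log₂ n ×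
    (Σ[ 𝒟 ∈ LocalTester 𝒞 ] Σ[ ε ∈ ℝ ] Σ[ δ ∈ ℝ ] Σ[ δ>0 ∈ 0ℝ < δ ]
      IsSmooth 𝒟 ε × HasSoundness 𝒟 δ × ε ÷ δ [ δ>0 ] ≤ ∣ C ∣))
code-of-graph {d} {c} {C} {h} {n} {N} c>0 S S-spans n≡2^ indep ρ ρ-shortest (m , f , α , α>0 , bounds) h₀<h =
  N<n , 𝒞 , k , dimension , wiseIndependent⇒distance S indep ,
  k≃n-clog {c} c>0 {{ℕ.>-nonZero (ℕ.≤-trans (ℕ.s≤s ℕ.z≤n) N<n)}} n≡2^ ,
  𝒟 , ε , δ , δ>0 , smooth , sound , ratio
  where
  N<n : N ℕ.< n
  N<n = powerThreshold-< {c} c>0 N {h} {n} h₀<h n≡2^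
  x₀ : ∃[ x ] x ≢ 𝟎 {h}
  x₀ = unit-nonzero (ℕ.≤-trans (ℕ.s≤s ℕ.z≤n) h₀<h)
  open CodeOfCayleyGraph S (λ {y} → S-spans {y})
  open Tester ρ-shortest f C α α>0 (λ x y → proj₁ (bounds x y)) (λ x y → proj₂ (bounds x y))
    (proj₁ x₀) (proj₂ x₀)

graphs⇒codes : ∀ d c (c>0 : 0ℝ < c) → ℓ₁-EmbeddableCayleyGraphs d c c>0 → SmoothTestableCodes d c
graphs⇒codes d c c>0 (C , graphs) = ∣ C ∣ , λ N → let
  h , h₀<h , n , S , S-spans , n≡2^ , indep , ρ , ρ-shortest , embeds = graphs (powerThreshold c N)
  in n , code-of-graph {d} {c} {C} {h} {n} {N} c>0 S (λ {y} → S-spans {y}) n≡2^ indep ρ ρ-shortest embeds h₀<h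

corollary3 : (d : ℕ) → 1 ℕ.≤ d → (c : ℝ) (c>0 : 0ℝ < c) →
    SmoothTestableCodes d c ⇔ ℓ₁-EmbeddableCayleyGraphs d c c>0
corollary3 d _ c c>0 = mk⇔ (codes⇒graphs d c c>0) (graphs⇒codes d c c>0)
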